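{- Let $g\ge 3$ and let $G=C_{T_1,\dots,T_g}\in\mathcal{U}_{n,l}^{g,2}$. Then $U_{n,l}^{g,0}\prec G$.
   Context: For a graph $G$ on $n$ vertices with Laplacian matrix $L(G)=D(G)-A(G)$, write $\det(\lambda I_n-L(G))=\sum_{k=0}^n(-1)^k c_k(G)\lambda^{n-k}$. For graphs $G,H$ of order $n$, $G\preceq H$ means $c_k(G)\le c_k(H)$ for all $0\le k\le n$, and $G\prec H$ means $G\preceq H$ and $c_k(G)<c_k(H)$ for some $k$. A leaf is a vertex of degree $1$. $\mathcal{U}_{n,l}^g$ is the set of connected unicyclic graphs with $n$ vertices, exactly $l$ leaves and girth $g$; each such graph is written $C_{T_1,\dots,T_g}$, meaning it is obtained from the cycle $C_g=u_1\cdots u_g$ by attaching trees $T_1,\dots,T_g$ rooted at $u_1,\dots,u_g$. $\mathcal{U}_{n,l}^{g,2}$ is the set of $C_{T_1,\dots,T_g}\in\mathcal{U}_{n,l}^g$ such that $|V(T_1)|>1$, $|V(T_i)|>1$ for some $i\ne 1$, and $|V(T_j)|=1$ for all $j\ne 1,i$. The balanced starlike tree $BST_{m,l}$ is the tree of order $m$ with $l$ leaves obtained by identifying one end of each of $l$ paths, each of order $\lfloor\frac{m-1}{l}\rfloor+1$ or $\lceil\frac{m-1}{l}\rceil+1$, into a single vertex (its center). $U_{n,l}^{g,0}$ is the graph obtained from the cycle $C_g$ by identifying one cycle vertex with the center of $BST_{n-g+1,l}$. -}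

module Defs where

open import Data.Bool using (Bool; true; false; if_then_else_; _∧_; _∨_; not)
open import Data.Bool.Properties using (∨-comm)
open import Data.Nat as ℕ using (ℕ; zero; suc; _∸_; _≤_; _<_; _≡ᵇ_)
open import Data.Nat.Properties using (≡ᵇ⇒≡; ≡⇒≡ᵇ)
open import Data.Fin using (Fin; toℕ; punchIn)
import Data.Fin as F
open import Data.Integer as ℤ using (ℤ; +_; -_)
open import Data.List using (List; []; _∷_; _++_; replicate)
open import Data.Bool.ListAction using (any)
open import Data.Product using (Σ; _×_; _,_; ∃)
open import Data.Sum using (_⊎_)
open import Relation.Binary.PropositionalEquality using (_≡_; _≢_; refl; cong)
open import Relation.Nullary using (¬_)
open import Function using (Injective)

sumℕ : ∀ {n} → (Fin n → ℕ) → ℕ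
sumℕ {zero}  f = 0
sumℕ {suc n} f = f F.zero ℕ.+ sumℕ (λ i → f (F.suc i))

record Graph (n : ℕ) : Set where
  field
    adj    : Fin n → Fin n → Bool
    sym    : ∀ i j → adj i j ≡ adj j i
    irrefl : ∀ i → adj i i ≡ false
open Graph public

deg : ∀ {n} → Graph n → Fin n → ℕ
deg G i = sumℕ (λ j → if adj G i j then 1 else 0)

edgeCount : ∀ {n} → Graph n → ℕ
edgeCount G =
  sumℕ (λ i → sumℕ (λ j → if (suc (toℕ i) ℕ.≤ᵇ toℕ j) ∧ adj G i j then 1 else 0))

leafCount : ∀ {n} → Graph n → ℕ
leafCount G = sumℕ (λ i → if deg G i ≡ᵇ 1 then 1 else 0)

data ReachBy {n} (E : Fin n → Fin n → Set) : Fin n → Fin n → Set where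
  here : ∀ {a} → ReachBy E a a
  step : ∀ {a b c} → E a b → ReachBy E b c → ReachBy E a c

Edge : ∀ {n} → Graph n → Fin n → Fin n → Set
Edge G a b = adj G a b ≡ true

Connected : ∀ {n} → Graph n → Set
Connected G = ∀ a b → ReachBy (Edge G) a b

-- Polynomials over ℤ (coefficient lists, lowest degree first)

Poly : Set
Poly = List ℤ

_+ₚ_ : Poly → Poly → Poly
[]       +ₚ q        = q
(a ∷ p)  +ₚ []       = a ∷ p
(a ∷ p)  +ₚ (b ∷ q)  = (a ℤ.+ b) ∷ (p +ₚ q)

scaleₚ : ℤ → Poly → Poly
scaleₚ c []      = []
scaleₚ c (a ∷ p) = (c ℤ.* a) ∷ scaleₚ c p

_*ₚ_ : Poly → Poly → Poly
[]      *ₚ q = []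
(a ∷ p) *ₚ q = scaleₚ a q +ₚ (+ 0 ∷ (p *ₚ q))

coeff : Poly → ℕ → ℤ
coeff []      k       = + 0
coeff (a ∷ p) zero    = a
coeff (a ∷ p) (suc k) = coeff p k

sumₚ : ∀ {n} → (Fin n → Poly) → Poly
sumₚ {zero}  f = []
sumₚ {suc n} f = f F.zero +ₚ sumₚ (λ i → f (F.suc i))

signℕ : ℕ → ℤ
signℕ zero          = + 1
signℕ (suc zero)    = - (+ 1)
signℕ (suc (suc k)) = signℕ k

det : ∀ n → (Fin n → Fin n → Poly) → Poly
det zero    M = + 1 ∷ []
det (suc n) M =
  sumₚ (λ j → scaleₚ (signℕ (toℕ j))
                 (M F.zero j *ₚ det n (λ r c → M (F.suc r) (punchIn j c))))

-- the matrix λ I - L(G), L(G) = D(G) - A(G)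
charMatrix : ∀ {n} → Graph n → Fin n → Fin n → Poly
charMatrix G i j =
  if toℕ i ≡ᵇ toℕ j
  then (- (+ deg G i)) ∷ + 1 ∷ []
  else (if adj G i j then + 1 ∷ [] else [])

lapCharPoly : ∀ {n} → Graph n → Poly
lapCharPoly {n} G = det n (charMatrix G)

-- det(λI - L(G)) = Σ_k (-1)^k c_k(G) λ^(n-k)
lapCoeff : ∀ {n} → Graph n → ℕ → ℤ
lapCoeff {n} G k = signℕ k ℤ.* coeff (lapCharPoly G) (n ∸ k)

_⪯_ : ∀ {n} → Graph n → Graph n → Set
_⪯_ {n} G H = ∀ k → k ≤ n → lapCoeff G k ℤ.≤ lapCoeff H k

_≺_ : ∀ {n} → Graph n → Graph n → Set
_≺_ {n} G H = (G ⪯ H) × ∃ λ k → k ≤ n × lapCoeff G k ℤ.< lapCoeff H k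

-- consecutive indices on the cycle u_1 ... u_g (0-based: i, i+1 mod g)
Consec : ∀ {g} → Fin g → Fin g → Set
Consec {g} i j = (toℕ j ≡ suc (toℕ i)) ⊎ ((toℕ i ≡ g ∸ 1) × (toℕ j ≡ 0))

CycleEdge : ∀ {n g} → (Fin g → Fin n) → Fin n → Fin n → Set
CycleEdge u a b = ∃ λ i → ∃ λ j → Consec i j × ((u i ≡ a × u j ≡ b) ⊎ (u i ≡ b × u j ≡ a))

TreeEdge : ∀ {n g} → Graph n → (Fin g → Fin n) → Fin n → Fin n → Set
TreeEdge G u a b = Edge G a b × ¬ CycleEdge u a b

-- |V(T_i)| > 1, where T_i is the tree rooted at u_i, i.e. the component of
-- u_i in G - E(C_g)
NontrivialTree : ∀ {n g} → Graph n → (Fin g → Fin n) → Fin g → Set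
NontrivialTree G u i = ∃ λ v → (v ≢ u i) × ReachBy (TreeEdge G u) (u i) v

record InU2 (n l g : ℕ) (G : Graph n) : Set where
  field
    connected  : Connected G
    unicyclic  : edgeCount G ≡ n            -- connected with |E| = |V|
    leaves     : leafCount G ≡ l
    cyc        : Fin g → Fin n
    cycInj     : Injective _≡_ _≡_ cyc
    cycAdj     : ∀ i j → Consec i j → Edge G (cyc i) (cyc j)
    tree1      : ∀ i → toℕ i ≡ 0 → NontrivialTree G cyc i
    other      : Fin g
    otherNot1  : toℕ other ≢ 0
    treeOther  : NontrivialTree G cyc other
    restTrivial : ∀ j → toℕ j ≢ 0 → j ≢ other → ¬ NontrivialTree G cyc j

-- The graph U^{g,0}_{n,l}
-- vertices 0 … g-1 form the cycle (vertex 0 is the centre of BST),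
-- vertices g … n-1 lie on the l pendant paths of BST_{n-g+1,l}.

-- lengths (numbers of non-centre vertices) of the l paths of BST_{m+1,l}:
-- (m mod l) paths with ⌊m/l⌋+1 and the others with ⌊m/l⌋ vertices
bstLengths : ℕ → ℕ → List ℕ
bstLengths m zero    = []
bstLengths m (suc k) =
  replicate (m ℕ.% suc k) (suc (m ℕ./ suc k)) ++
  replicate (suc k ∸ m ℕ.% suc k) (m ℕ./ suc k)

pathFrom : ℕ → ℕ → ℕ → List (ℕ × ℕ)
pathFrom prev s zero    = []
pathFrom prev s (suc k) = (prev , s) ∷ pathFrom s (suc s) k

pathsEdges : ℕ → List ℕ → List (ℕ × ℕ)
pathsEdges s []          = []
pathsEdges s (len ∷ lns) = pathFrom 0 s len ++ pathsEdges (s ℕ.+ len) lns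

cycleEdgesFrom : ℕ → ℕ → List (ℕ × ℕ)
cycleEdgesFrom i zero    = []
cycleEdgesFrom i (suc k) = (i , suc i) ∷ cycleEdgesFrom (suc i) k

U0Edges : ℕ → ℕ → ℕ → List (ℕ × ℕ)
U0Edges n l g =
  ((g ∸ 1) , 0) ∷ cycleEdgesFrom 0 (g ∸ 1) ++ pathsEdges g (bstLengths (n ∸ g) l)

edgeIn : List (ℕ × ℕ) → ℕ → ℕ → Bool
edgeIn es a b = any (λ { (x , y) → (x ≡ᵇ a) ∧ (y ≡ᵇ b) }) es

private
  ≡ᵇ-sym : ∀ a b → (a ≡ᵇ b) ≡ (b ≡ᵇ a)
  ≡ᵇ-sym zero zero = refl
  ≡ᵇ-sym zero (suc b) = refl
  ≡ᵇ-sym (suc a) zero = refl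
  ≡ᵇ-sym (suc a) (suc b) = ≡ᵇ-sym a b

  ≡ᵇ-refl : ∀ a → (a ≡ᵇ a) ≡ true
  ≡ᵇ-refl zero = refl
  ≡ᵇ-refl (suc a) = ≡ᵇ-refl a

  ∧-false : ∀ b → (b ∧ false) ≡ false
  ∧-false true = refl
  ∧-false false = refl

graphFromEdges : (n : ℕ) → List (ℕ × ℕ) → Graph n
graphFromEdges n es = record
  { adj = A
  ; sym = symA
  ; irrefl = irr }
  where
  A : Fin n → Fin n → Bool
  A i j = (edgeIn es (toℕ i) (toℕ j) ∨ edgeIn es (toℕ j) (toℕ i)) ∧ not (toℕ i ≡ᵇ toℕ j)
  symA : ∀ i j → A i j ≡ A j i
  symA i j rewrite ∨-comm (edgeIn es (toℕ i) (toℕ j)) (edgeIn es (toℕ j) (toℕ i))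
                 | ≡ᵇ-sym (toℕ i) (toℕ j) = refl
  irr : ∀ i → A i i ≡ false
  irr i rewrite ≡ᵇ-refl (toℕ i) = ∧-false _

U0 : (n l g : ℕ) → Graph n
U0 n l g = graphFromEdges n (U0Edges n l g)

{-# OPTIONS --safe #-}

-- Write x = - λ and compare polynomials in x coefficientwise. A tree T with root r enters
-- det (x I + L(G)) only through the pair (b , c), where b is the determinant of x I + L(T)
-- without r and x b + c = det (x I + L(T)); pairs of trees glued at the root multiply by
-- (b b' , c b' + b c'). Trees with pairs (b , c), (b' , c') at two vertices of a cycle give
--   b b' D₀ + (c b' + b c') D₁ + c c' D₂,
-- where D₀, D₁, D₂ are principal minors of the bare cycle and D₁ does not depend on the
-- vertex. The last term disappears when both trees are glued at the same vertex; it is at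
-- least x², which gives strictness. Since D₀ ≥ x D₁, what remains is a nonnegative
-- combination of b and x b + c of the glued tree, and both are minimised by the balanced
-- spider: moving branches along an edge towards a heavier side lowers them, which flattens
-- a tree rooted near its centre to a spider with as many leaves, and then balances the legs.
module Submission where

open import Defs using
  ( Graph; adj; irrefl; deg; edgeCount; leafCount; sumℕ
  ; ReachBy; Edge; Connected; Consec; CycleEdge; NontrivialTree; InU2
  ; Poly; _+ₚ_; scaleₚ; _*ₚ_; coeff; sumₚ; signℕ; det; charMatrix; lapCharPoly; lapCoeff; _≺_
  ; bstLengths; pathFrom; pathsEdges; cycleEdgesFrom; U0Edges; edgeIn; graphFromEdges; U0 )
open import Algebra.Bundles using (CommutativeMonoid; CommutativeRing)
import Algebra.Properties.AbelianGroup
import Algebra.Properties.Group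
import Algebra.Properties.Ring
import Algebra.Properties.Semiring.Mult
import Algebra.Properties.Semiring.Mult.TCOptimised
import Algebra.Solver.CommutativeMonoid
import Algebra.Solver.Ring
open import Algebra.Solver.Ring.AlmostCommutativeRing using (fromCommutativeRing; _-Raw-AlmostCommutative⟶_)
open import Data.Bool as Bool using (Bool; true; false; if_then_else_; _∧_; _∨_; not)
import Data.Bool.Properties as Boolₚ
open import Data.Empty using (⊥; ⊥-elim)
open import Data.Fin as Fin using (Fin; toℕ; fromℕ<; punchIn)
import Data.Fin.Properties as Finₚ
import Data.Integer as ℤ
open ℤ using (ℤ)
import Data.Integer.Properties as ℤₚ
import Data.Integer.Tactic.RingSolver as ℤSolver
open import Data.List using (List; []; _∷_; _++_; _ʳ++_; [_]; allFin; foldr; length; map; replicate; tabulate)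
open import Data.List.Properties using
  ( ++-identityʳ; foldr-++; length-++; length-map; length-replicate; length-tabulate; length-ʳ++
  ; map-++; map-id; tabulate-cong )
open import Data.List.Membership.Propositional using (_∈_; _∉_)
import Data.List.Membership.Propositional.Properties as ∈ₚ
import Data.List.Membership.DecPropositional as DecMembership
open import Data.List.Relation.Binary.Permutation.Propositional using
  (_↭_; ↭-refl; ↭-sym; ↭-trans; ↭-prep; ↭-swap; ↭-reflexive; ↭⇒↭ₛ)
import Data.List.Relation.Binary.Permutation.Propositional.Properties as Perm
import Data.List.Relation.Binary.Permutation.Setoid.Properties as PermSetoid
open import Data.List.Relation.Unary.All as All using (All; []; _∷_)
import Data.List.Relation.Unary.All.Properties as Allₚ
open import Data.List.Relation.Unary.AllPairs using (AllPairs; []; _∷_)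
import Data.List.Relation.Unary.AllPairs.Properties as AllPairsₚ
open import Data.List.Relation.Unary.Any using (here; there)
open import Data.List.Relation.Unary.Unique.Propositional using (Unique)
import Data.List.Relation.Unary.Unique.Propositional.Properties as Uniqueₚ
open import Data.Maybe using (Maybe; just; nothing)
open import Data.Nat as ℕ using (ℕ; zero; suc; z≤n; s≤s; _≤_; _<_; _≥_; _∸_; _⊔_)
open import Data.Nat.Divisibility using (n∣m*n)
import Data.Nat.DivMod as DivMod
open import Data.Nat.ListAction using (sum)
open import Data.Nat.ListAction.Properties using (sum-++; sum-↭)
import Data.Nat.Properties as ℕₚ
open ℕₚ using
  ( ≤-refl; ≤-reflexive; ≤-trans; ≤-antisym; ≤-total; ≤-pred; <⇒≤; <⇒≢; <⇒≱
  ; n≤1+n; n<1+n; m≤m+n; m<m+n; +-suc; ⊔-lub )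
open import Data.Nat.Tactic.RingSolver using (solve-∀)
open import Data.Product using (_×_; _,_; ∃; proj₁; proj₂)
open import Data.Sum using (_⊎_; inj₁; inj₂)
open import Data.Unit using (⊤; tt)
open import Function using (_∘_; const; id)
open import Level using (0ℓ)
open import Relation.Binary.Definitions using (DecidableEquality; Tri; tri<; tri≈; tri>)
import Relation.Binary.PropositionalEquality as ≡
open ≡ using (_≡_; _≢_)
import Relation.Binary.Reasoning.Setoid
open import Relation.Nullary using (yes; no; does; ¬_)
open import Relation.Nullary.Decidable using (dec-true; dec-false)

-- The quotient c / b of a pair is an effective conductance: every edge conducts 1, and every vertex
-- except the root is joined to the ground with conductance x. Gluing adds quotients and a new edge
-- above the root acts in series, so "heavier" means a larger quotient and all comparisons of weight
-- are monotonicity statements, cleared of denominators because the ring has no division. The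
-- quantities b and x b + c need different arguments. The second does not depend on the root, so the
-- root may wander to a place where each side outweighs the paths in the other. Both bounds are
-- attained by the same spider, which is why they can be added with positive coefficients. Up to the
-- comparison of the two cycles, everything is done over an arbitrary commutative ring with a
-- positive cone; polynomials, and with them the signs of coefficients, come in only as an instance.

module IntegerSolver (R : CommutativeRing 0ℓ 0ℓ) where
  open CommutativeRing R
  open Algebra.Properties.Ring ring
  open Algebra.Properties.AbelianGroup +-abelianGroup using (⁻¹-∙-comm; ε⁻¹≈ε)
  open Algebra.Properties.Semiring.Mult.TCOptimised semiring using (×-homo-+; ×1-homo-*; 1+×) renaming (_×_ to _·_)
  open Relation.Binary.Reasoning.Setoid setoid

  -- Cancelling terms in the solver requires coefficients with decidable equality. An abstract ring
  -- has none, so the integers act through their canonical image.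
  fromℤ : ℤ → Carrier
  fromℤ (ℤ.+ n)    = n · 1#
  fromℤ (ℤ.-[1+ n ]) = - (suc n · 1#)

  private
    cancel-one : ∀ a b → a - b ≈ (1# + a) - (1# + b)
    cancel-one a b = sym (begin
      (1# + a) - (1# + b)       ≈⟨ +-cong (+-comm 1# a) (sym (⁻¹-∙-comm 1# b)) ⟩
      (a + 1#) + (- 1# + - b)   ≈⟨ +-assoc a 1# _ ⟩
      a + (1# + (- 1# + - b))   ≈⟨ +-congˡ (sym (+-assoc 1# (- 1#) (- b))) ⟩
      a + ((1# + - 1#) + - b)   ≈⟨ +-congˡ (+-congʳ (-‿inverseʳ 1#)) ⟩
      a + (0# + - b)            ≈⟨ +-congˡ (+-identityˡ (- b)) ⟩
      a - b                     ∎)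

    fromℤ-⊖ : ∀ m n → fromℤ (m ℤ.⊖ n) ≈ m · 1# - n · 1#
    fromℤ-⊖ zero zero = sym (-‿inverseʳ 0#)
    fromℤ-⊖ (suc m) zero = sym (trans (+-congˡ ε⁻¹≈ε) (+-identityʳ _))
    fromℤ-⊖ zero (suc n) = sym (+-identityˡ _)
    fromℤ-⊖ (suc m) (suc n) = begin
      fromℤ (suc m ℤ.⊖ suc n)           ≡⟨ ≡.cong fromℤ (ℤₚ.[1+m]⊖[1+n]≡m⊖n m n) ⟩
      fromℤ (m ℤ.⊖ n)                   ≈⟨ fromℤ-⊖ m n ⟩
      m · 1# - n · 1#                   ≈⟨ cancel-one _ _ ⟩
      (1# + m · 1#) - (1# + n · 1#)     ≈⟨ +-cong (sym (1+× m 1#)) (-‿cong (sym (1+× n 1#))) ⟩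
      suc m · 1# - suc n · 1#           ∎

    fromℤ-+ : ∀ i j → fromℤ (i ℤ.+ j) ≈ fromℤ i + fromℤ j
    fromℤ-+ (ℤ.+ m)      (ℤ.+ n)      = ×-homo-+ 1# m n
    fromℤ-+ (ℤ.+ m)      (ℤ.-[1+ n ]) = fromℤ-⊖ m (suc n)
    fromℤ-+ (ℤ.-[1+ m ]) (ℤ.+ n)      = trans (fromℤ-⊖ n (suc m)) (+-comm _ _)
    fromℤ-+ (ℤ.-[1+ m ]) (ℤ.-[1+ n ]) = begin
      - (suc (suc (m ℕ.+ n)) · 1#)      ≡⟨ ≡.cong (λ k → - (suc k · 1#)) (≡.sym (+-suc m n)) ⟩
      - ((suc m ℕ.+ suc n) · 1#)        ≈⟨ -‿cong (×-homo-+ 1# (suc m) (suc n)) ⟩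
      - (suc m · 1# + suc n · 1#)       ≈⟨ ⁻¹-∙-comm _ _ ⟨
      - (suc m · 1#) + - (suc n · 1#)   ∎

    fromℤ-neg : ∀ i → fromℤ (ℤ.- i) ≈ - fromℤ i
    fromℤ-neg (ℤ.+ zero)   = sym ε⁻¹≈ε
    fromℤ-neg (ℤ.+ suc n)  = refl
    fromℤ-neg (ℤ.-[1+ n ]) = sym (-‿involutive _)

    fromℤ-*₊ : ∀ m j → fromℤ (ℤ.+ m ℤ.* j) ≈ fromℤ (ℤ.+ m) * fromℤ j
    fromℤ-*₊ m (ℤ.+ n) = begin
      fromℤ (ℤ.+ m ℤ.* ℤ.+ n)  ≡⟨ ≡.cong fromℤ (≡.sym (ℤₚ.pos-* m n)) ⟩
      (m ℕ.* n) · 1#           ≈⟨ ×1-homo-* m n ⟩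
      m · 1# * n · 1#          ∎
    fromℤ-*₊ m (ℤ.-[1+ n ]) = begin
      fromℤ (ℤ.+ m ℤ.* (ℤ.- ℤ.+ suc n))   ≡⟨ ≡.cong fromℤ (≡.sym (ℤₚ.neg-distribʳ-* (ℤ.+ m) (ℤ.+ suc n))) ⟩
      fromℤ (ℤ.- (ℤ.+ m ℤ.* ℤ.+ suc n))   ≈⟨ fromℤ-neg (ℤ.+ m ℤ.* ℤ.+ suc n) ⟩
      - fromℤ (ℤ.+ m ℤ.* ℤ.+ suc n)       ≈⟨ -‿cong (fromℤ-*₊ m (ℤ.+ suc n)) ⟩
      - (m · 1# * suc n · 1#)             ≈⟨ -‿distribʳ-* _ _ ⟩
      m · 1# * - (suc n · 1#)             ∎

    fromℤ-* : ∀ i j → fromℤ (i ℤ.* j) ≈ fromℤ i * fromℤ j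
    fromℤ-* (ℤ.+ m) j = fromℤ-*₊ m j
    fromℤ-* (ℤ.-[1+ m ]) j = begin
      fromℤ ((ℤ.- ℤ.+ suc m) ℤ.* j)   ≡⟨ ≡.cong fromℤ (≡.sym (ℤₚ.neg-distribˡ-* (ℤ.+ suc m) j)) ⟩
      fromℤ (ℤ.- (ℤ.+ suc m ℤ.* j))   ≈⟨ fromℤ-neg (ℤ.+ suc m ℤ.* j) ⟩
      - fromℤ (ℤ.+ suc m ℤ.* j)       ≈⟨ -‿cong (fromℤ-*₊ (suc m) j) ⟩
      - (suc m · 1# * fromℤ j)        ≈⟨ -‿distribˡ-* _ _ ⟩
      - (suc m · 1#) * fromℤ j        ∎

    fromℤ-morphism : ℤ.+-*-rawRing -Raw-AlmostCommutative⟶ fromCommutativeRing R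
    fromℤ-morphism = record
      { ⟦_⟧    = fromℤ
      ; +-homo = fromℤ-+
      ; *-homo = fromℤ-*
      ; -‿homo = fromℤ-neg
      ; 0-homo = refl
      ; 1-homo = refl
      }

    _≟'_ : ∀ i j → Maybe (fromℤ i ≈ fromℤ j)
    i ≟' j with i ℤ.≟ j
    ... | yes i≡j = just (reflexive (≡.cong fromℤ i≡j))
    ... | no _    = nothing

  open Algebra.Solver.Ring ℤ.+-*-rawRing (fromCommutativeRing R) fromℤ-morphism _≟'_ public
    using (solve; _:=_; _:+_; _:*_; _:-_; :-_; con; Polynomial)

  :0 :1 :2 : ∀ {n} → Polynomial n
  :0 = con (ℤ.+ 0)
  :1 = con (ℤ.+ 1)
  :2 = con (ℤ.+ 2)

-- Determinants indexed by lists of vertices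

module Determinant (R : CommutativeRing 0ℓ 0ℓ) {V : Set} where
  open CommutativeRing R renaming (refl to ≈-refl; sym to ≈-sym; trans to ≈-trans)
  open Algebra.Properties.Ring ring
  open Relation.Binary.Reasoning.Setoid setoid
  open IntegerSolver R
  open _↭_

  -- Laplace expansion along one row ρ; F is the complementary minor as a
  -- function of the remaining columns.
  expand : (V → Carrier) → (List V → Carrier) → List V → Carrier
  expand ρ F []       = 0#
  expand ρ F (c ∷ cs) = ρ c * F cs - expand ρ (λ ds → F (c ∷ ds)) cs

  -- Rows and columns are lists of vertices, so that deleting or reordering vertices is an operation
  -- on lists and the matrix is never reindexed. Lists of different lengths give 0, which keeps the
  -- alternating laws valid for all lists.
  minor : (V → V → Carrier) → List V → List V → Carrier
  minor m []       []      = 1#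
  minor m []       (_ ∷ _) = 0#
  minor m (r ∷ rs) cs      = expand (m r) (minor m rs) cs

  Alternating : (List V → Carrier) → Set
  Alternating F = ∀ pre c d post → F (pre ++ c ∷ d ∷ post) ≈ - F (pre ++ d ∷ c ∷ post)

  expand-cong : ∀ {ρ ρ' F F'} (Q : V → Set) → (∀ c → Q c → ρ c ≈ ρ' c) →
    (∀ ds → All Q ds → F ds ≈ F' ds) → ∀ cs → All Q cs → expand ρ F cs ≈ expand ρ' F' cs
  expand-cong Q ρ≈ F≈ []       []       = ≈-refl
  expand-cong Q ρ≈ F≈ (c ∷ cs) (q ∷ qs) =
    +-cong (*-cong (ρ≈ c q) (F≈ cs qs))
           (-‿cong (expand-cong Q ρ≈ (λ ds qs' → F≈ (c ∷ ds) (q ∷ qs')) cs qs))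

  expand-congF : ∀ ρ {F F'} → (∀ ds → F ds ≈ F' ds) → ∀ cs → expand ρ F cs ≈ expand ρ F' cs
  expand-congF ρ F≈ []       = ≈-refl
  expand-congF ρ F≈ (c ∷ cs) =
    +-cong (*-congˡ (F≈ cs)) (-‿cong (expand-congF ρ (λ ds → F≈ (c ∷ ds)) cs))

  minor-cong : ∀ {m m'} (Q : V → Set) rs → All (λ r → ∀ c → Q c → m r c ≈ m' r c) rs →
    ∀ cs → All Q cs → minor m rs cs ≈ minor m' rs cs
  minor-cong Q []       []       []      _  = ≈-refl
  minor-cong Q []       []       (_ ∷ _) _  = ≈-refl
  minor-cong Q (r ∷ rs) (p ∷ ps) cs      qs = expand-cong Q p (minor-cong Q rs ps) cs qs

  expand-linearF : ∀ ρ a b F G cs →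
    expand ρ (λ ds → a * F ds + b * G ds) cs ≈ a * expand ρ F cs + b * expand ρ G cs
  expand-linearF ρ a b F G [] = solve 2 (λ a b → :0 := a :* :0 :+ b :* :0) ≈-refl a b
  expand-linearF ρ a b F G (c ∷ cs) = begin
    ρ c * (a * F cs + b * G cs) - expand ρ (λ ds → a * F (c ∷ ds) + b * G (c ∷ ds)) cs
      ≈⟨ +-congˡ (-‿cong (expand-linearF ρ a b _ _ cs)) ⟩
    ρ c * (a * F cs + b * G cs) - (a * f + b * g)
      ≈⟨ solve 7 (λ r a b F G f g → r :* (a :* F :+ b :* G) :- (a :* f :+ b :* g)
                     := a :* (r :* F :- f) :+ b :* (r :* G :- g))
               ≈-refl (ρ c) a b (F cs) (G cs) f g ⟩
    a * (ρ c * F cs - f) + b * (ρ c * G cs - g) ∎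
    where f = expand ρ (λ ds → F (c ∷ ds)) cs
          g = expand ρ (λ ds → G (c ∷ ds)) cs

  expand-linearρ : ∀ {ρ₁ ρ₂ ρ₃} a b F cs → All (λ c → ρ₁ c ≈ a * ρ₂ c + b * ρ₃ c) cs →
    expand ρ₁ F cs ≈ a * expand ρ₂ F cs + b * expand ρ₃ F cs
  expand-linearρ a b F [] [] = solve 2 (λ a b → :0 := a :* :0 :+ b :* :0) ≈-refl a b
  expand-linearρ {ρ₁} {ρ₂} {ρ₃} a b F (c ∷ cs) (e ∷ es) = begin
    ρ₁ c * F cs - expand ρ₁ F' cs
      ≈⟨ +-cong (*-congʳ e) (-‿cong (expand-linearρ a b F' cs es)) ⟩
    (a * ρ₂ c + b * ρ₃ c) * F cs - (a * expand ρ₂ F' cs + b * expand ρ₃ F' cs)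
      ≈⟨ solve 7 (λ a b r s F f g → (a :* r :+ b :* s) :* F :- (a :* f :+ b :* g)
                     := a :* (r :* F :- f) :+ b :* (s :* F :- g))
               ≈-refl a b (ρ₂ c) (ρ₃ c) (F cs) (expand ρ₂ F' cs) (expand ρ₃ F' cs) ⟩
    a * (ρ₂ c * F cs - expand ρ₂ F' cs) + b * (ρ₃ c * F cs - expand ρ₃ F' cs) ∎
    where F' = λ ds → F (c ∷ ds)

  expand-zeroρ : ∀ {ρ} F cs → All (λ c → ρ c ≈ 0#) cs → expand ρ F cs ≈ 0#
  expand-zeroρ F []       []       = ≈-refl
  expand-zeroρ {ρ} F (c ∷ cs) (e ∷ es) = begin
    ρ c * F cs - expand ρ (λ ds → F (c ∷ ds)) cs ≈⟨ +-cong (*-congʳ e) (-‿cong (expand-zeroρ _ cs es)) ⟩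
    0# * F cs - 0#                               ≈⟨ solve 1 (λ F → :0 :* F :- :0 := :0) ≈-refl (F cs) ⟩
    0# ∎

  expand-zeroF : ∀ ρ {F} → (∀ ds → F ds ≈ 0#) → ∀ cs → expand ρ F cs ≈ 0#
  expand-zeroF ρ {F} F≈0 []       = ≈-refl
  expand-zeroF ρ {F} F≈0 (c ∷ cs) = begin
    ρ c * F cs - expand ρ (λ ds → F (c ∷ ds)) cs
      ≈⟨ +-cong (*-congˡ (F≈0 cs)) (-‿cong (expand-zeroF ρ (λ ds → F≈0 (c ∷ ds)) cs)) ⟩
    ρ c * 0# - 0# ≈⟨ solve 1 (λ F → F :* :0 :- :0 := :0) ≈-refl (ρ c) ⟩
    0# ∎

  private
    neg-as-linear : ∀ a b → - a ≈ (- 1#) * a + 0# * b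
    neg-as-linear = solve 2 (λ a b → :- a := (:- :1) :* a :+ :0 :* b) ≈-refl

  expand-negF : ∀ ρ F cs → expand ρ (λ ds → - F ds) cs ≈ - expand ρ F cs
  expand-negF ρ F cs = begin
    expand ρ (λ ds → - F ds) cs                         ≈⟨ expand-congF ρ (λ ds → neg-as-linear (F ds) (F ds)) cs ⟩
    expand ρ (λ ds → (- 1#) * F ds + 0# * F ds) cs      ≈⟨ expand-linearF ρ (- 1#) 0# F F cs ⟩
    (- 1#) * expand ρ F cs + 0# * expand ρ F cs         ≈⟨ neg-as-linear _ _ ⟨
    - expand ρ F cs ∎

  -- Expansions are interior products; their anticommutation makes minors
  -- alternate in the rows.
  expand-anticomm : ∀ ρ σ F cs → expand ρ (expand σ F) cs ≈ - expand σ (expand ρ F) cs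
  expand-anticomm ρ σ F []       = solve 0 (:0 := :- :0) ≈-refl
  expand-anticomm ρ σ F (c ∷ cs) = begin
    ρ c * expand σ F cs - expand ρ (λ ds → σ c * F ds - expand σ F' ds) cs
      ≈⟨ +-congˡ (-‿cong (split ρ σ)) ⟩
    ρ c * expand σ F cs - (σ c * expand ρ F cs - expand ρ (expand σ F') cs)
      ≈⟨ +-congˡ (-‿cong (+-congˡ (-‿cong (expand-anticomm ρ σ F' cs)))) ⟩
    ρ c * expand σ F cs - (σ c * expand ρ F cs - - expand σ (expand ρ F') cs)
      ≈⟨ solve 5 (λ r s a b w → r :* a :- (s :* b :- (:- w)) := :- (s :* b :- (r :* a :- w)))
               ≈-refl (ρ c) (σ c) (expand σ F cs) (expand ρ F cs) (expand σ (expand ρ F') cs) ⟩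
    - (σ c * expand ρ F cs - (ρ c * expand σ F cs - expand σ (expand ρ F') cs))
      ≈⟨ -‿cong (+-congˡ (-‿cong (split σ ρ))) ⟨
    - (σ c * expand ρ F cs - expand σ (λ ds → ρ c * F ds - expand ρ F' ds) cs) ∎
    where
    F' = λ ds → F (c ∷ ds)
    split : ∀ ρ σ → expand ρ (λ ds → σ c * F ds - expand σ F' ds) cs
                  ≈ σ c * expand ρ F cs - expand ρ (expand σ F') cs
    split ρ σ = begin
      expand ρ (λ ds → σ c * F ds - expand σ F' ds) cs
        ≈⟨ expand-congF ρ (λ ds → minus-as-linear (σ c) (F ds) (expand σ F' ds)) cs ⟩
      expand ρ (λ ds → σ c * F ds + (- 1#) * expand σ F' ds) cs
        ≈⟨ expand-linearF ρ (σ c) (- 1#) F (expand σ F') cs ⟩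
      σ c * expand ρ F cs + (- 1#) * expand ρ (expand σ F') cs
        ≈⟨ minus-as-linear _ _ _ ⟨
      σ c * expand ρ F cs - expand ρ (expand σ F') cs ∎
      where
      minus-as-linear : ∀ s a b → s * a - b ≈ s * a + (- 1#) * b
      minus-as-linear = solve 3 (λ s a b → s :* a :- b := s :* a :+ (:- :1) :* b) ≈-refl

  minor-alternating-rows : ∀ m cs → Alternating (λ rs → minor m rs cs)
  minor-alternating-rows m cs [] r s post = expand-anticomm (m r) (m s) (minor m post) cs
  minor-alternating-rows m cs (p ∷ pre) r s post = begin
    expand (m p) (minor m (pre ++ r ∷ s ∷ post)) cs
      ≈⟨ expand-congF (m p) (λ ds → minor-alternating-rows m ds pre r s post) cs ⟩
    expand (m p) (λ ds → - minor m (pre ++ s ∷ r ∷ post) ds) cs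
      ≈⟨ expand-negF (m p) _ cs ⟩
    - expand (m p) (minor m (pre ++ s ∷ r ∷ post)) cs ∎

  expand-alternating : ∀ ρ F → Alternating F → Alternating (expand ρ F)
  expand-alternating ρ F alt [] c d post = begin
    ρ c * F (d ∷ post) - (ρ d * F (c ∷ post) - expand ρ (λ ds → F (c ∷ d ∷ ds)) post)
      ≈⟨ +-congˡ (-‿cong (+-congˡ (-‿cong (≈-trans (expand-congF ρ (λ ds → alt [] c d ds) post) (expand-negF ρ _ post))))) ⟩
    ρ c * F (d ∷ post) - (ρ d * F (c ∷ post) - - expand ρ (λ ds → F (d ∷ c ∷ ds)) post)
      ≈⟨ solve 3 (λ a b w → a :- (b :- (:- w)) := :- (b :- (a :- w))) ≈-refl _ _ _ ⟩
    - (ρ d * F (c ∷ post) - (ρ c * F (d ∷ post) - expand ρ (λ ds → F (d ∷ c ∷ ds)) post)) ∎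
  expand-alternating ρ F alt (p ∷ pre) c d post = begin
    ρ p * F (pre ++ c ∷ d ∷ post) - expand ρ (λ ds → F (p ∷ ds)) (pre ++ c ∷ d ∷ post)
      ≈⟨ +-cong (*-congˡ (alt pre c d post))
                (-‿cong (expand-alternating ρ (λ ds → F (p ∷ ds)) (λ pre → alt (p ∷ pre)) pre c d post)) ⟩
    ρ p * - F (pre ++ d ∷ c ∷ post) - - expand ρ (λ ds → F (p ∷ ds)) (pre ++ d ∷ c ∷ post)
      ≈⟨ solve 3 (λ r a w → r :* (:- a) :- (:- w) := :- (r :* a :- w)) ≈-refl _ _ _ ⟩
    - (ρ p * F (pre ++ d ∷ c ∷ post) - expand ρ (λ ds → F (p ∷ ds)) (pre ++ d ∷ c ∷ post)) ∎

  minor-alternating-columns : ∀ m rs → Alternating (minor m rs)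
  minor-alternating-columns m [] []        c d post = solve 0 (:0 := :- :0) ≈-refl
  minor-alternating-columns m [] (_ ∷ pre) c d post = solve 0 (:0 := :- :0) ≈-refl
  minor-alternating-columns m (r ∷ rs) = expand-alternating (m r) (minor m rs) (minor-alternating-columns m rs)

  -- One ε serves every alternating F. A principal minor alternates in its rows and in its columns,
  -- so a permutation of the vertices contributes ε twice and `ε * ε` disappears.
  alternating-↭ : ∀ {vs ws} → vs ↭ ws →
    ∃ λ ε → (ε * ε ≈ 1#) × (∀ F → Alternating F → F ws ≈ ε * F vs)
  alternating-↭ refl = 1# , *-identityˡ 1# , λ F _ → ≈-sym (*-identityˡ _)
  alternating-↭ (prep c p) with alternating-↭ p
  ... | ε , ε² , h = ε , ε² , λ F alt → h (λ ds → F (c ∷ ds)) (λ pre → alt (c ∷ pre))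
  alternating-↭ (swap {vs} {ws} c d p) with alternating-↭ p
  ... | ε , ε² , h = - ε , ≈-trans (solve 1 (λ e → (:- e) :* (:- e) := e :* e) ≈-refl ε) ε² , λ F alt → begin
    F (d ∷ c ∷ ws)         ≈⟨ alt [] d c ws ⟩
    - F (c ∷ d ∷ ws)       ≈⟨ -‿cong (h (λ ds → F (c ∷ d ∷ ds)) (λ pre → alt (c ∷ d ∷ pre))) ⟩
    - (ε * F (c ∷ d ∷ vs)) ≈⟨ -‿distribˡ-* _ _ ⟩
    - ε * F (c ∷ d ∷ vs)   ∎
  alternating-↭ (trans p q) with alternating-↭ p | alternating-↭ q
  ... | ε , ε² , h | η , η² , k = η * ε ,
    ≈-trans (solve 2 (λ e f → (f :* e) :* (f :* e) := (e :* e) :* (f :* f)) ≈-refl ε η)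
            (≈-trans (*-cong ε² η²) (*-identityˡ 1#)) ,
    λ F alt → ≈-trans (k F alt) (≈-trans (*-congˡ (h F alt)) (≈-sym (*-assoc _ _ _)))

  principal-↭ : ∀ m {vs ws} → vs ↭ ws → minor m vs vs ≈ minor m ws ws
  principal-↭ m {vs} {ws} p with alternating-↭ p
  ... | ε , ε² , h = begin
    minor m vs vs              ≈⟨ *-identityˡ _ ⟨
    1# * minor m vs vs         ≈⟨ *-congʳ ε² ⟨
    (ε * ε) * minor m vs vs    ≈⟨ *-assoc _ _ _ ⟩
    ε * (ε * minor m vs vs)    ≈⟨ *-congˡ (h (λ rs → minor m rs vs) (minor-alternating-rows m vs)) ⟨
    ε * minor m ws vs          ≈⟨ h (minor m ws) (minor-alternating-columns m ws) ⟨
    minor m ws ws ∎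

  minor-zeroColumn : ∀ m rs v ds → All (λ r → m r v ≈ 0#) rs → minor m rs (v ∷ ds) ≈ 0#
  minor-zeroColumn m []       v ds []       = ≈-refl
  minor-zeroColumn m (r ∷ rs) v ds (e ∷ es) = begin
    m r v * minor m rs ds - expand (m r) (λ ds → minor m rs (v ∷ ds)) ds
      ≈⟨ +-cong (*-congʳ e) (-‿cong (expand-zeroF (m r) (λ ds → minor-zeroColumn m rs v ds es) ds)) ⟩
    0# * minor m rs ds - 0# ≈⟨ solve 1 (λ F → :0 :* F :- :0 := :0) ≈-refl (minor m rs ds) ⟩
    0# ∎

  minor-headColumn : ∀ m r rs c cs → All (λ r → m r c ≈ 0#) rs →
    minor m (r ∷ rs) (c ∷ cs) ≈ m r c * minor m rs cs
  minor-headColumn m r rs c cs es = begin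
    m r c * minor m rs cs - expand (m r) (λ ds → minor m rs (c ∷ ds)) cs
      ≈⟨ +-congˡ (-‿cong (expand-zeroF (m r) (λ ds → minor-zeroColumn m rs c ds es) cs)) ⟩
    m r c * minor m rs cs - 0# ≈⟨ solve 1 (λ a → a :- :0 := a) ≈-refl _ ⟩
    m r c * minor m rs cs ∎

  minor-headRow : ∀ m r rs c cs → All (λ d → m r d ≈ 0#) cs →
    minor m (r ∷ rs) (c ∷ cs) ≈ m r c * minor m rs cs
  minor-headRow m r rs c cs es = begin
    m r c * minor m rs cs - expand (m r) (λ ds → minor m rs (c ∷ ds)) cs
      ≈⟨ +-congˡ (-‿cong (expand-zeroρ _ cs es)) ⟩
    m r c * minor m rs cs - 0# ≈⟨ solve 1 (λ a → a :- :0 := a) ≈-refl _ ⟩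
    m r c * minor m rs cs ∎

  -- Only the columns v and w can carry a nonzero entry in the row of v, and in the cofactor of w
  -- the column v is left with the single entry in row w.
  minor-pendant : ∀ m v w us → All (λ u → m u v ≈ 0#) us → All (λ u → m v u ≈ 0#) us →
    minor m (v ∷ w ∷ us) (v ∷ w ∷ us)
      ≈ m v v * minor m (w ∷ us) (w ∷ us) - m v w * m w v * minor m us us
  minor-pendant m v w us col row = +-congˡ (-‿cong (begin
    m v w * minor m (w ∷ us) (v ∷ us) - expand (m v) (λ ds → minor m (w ∷ us) (v ∷ w ∷ ds)) us
      ≈⟨ +-cong (*-congˡ (minor-headColumn m w us v us col)) (-‿cong (expand-zeroρ _ us row)) ⟩
    m v w * (m w v * minor m us us) - 0#
      ≈⟨ solve 3 (λ a b c → a :* (b :* c) :- :0 := a :* b :* c) ≈-refl _ _ _ ⟩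
    m v w * m w v * minor m us us ∎))

module _ (R : CommutativeRing 0ℓ 0ℓ) {V W : Set} where
  open CommutativeRing R renaming (refl to ≈-refl)
  open Determinant R

  minor-map : ∀ (f : W → V) m rs cs → minor m (map f rs) (map f cs) ≈ minor (λ i j → m (f i) (f j)) rs cs
  minor-map f m = go
    where
    expand-map : ∀ ρ F F' → (∀ ds → F (map f ds) ≈ F' ds) → ∀ cs → expand ρ F (map f cs) ≈ expand (λ c → ρ (f c)) F' cs
    expand-map ρ F F' h []       = ≈-refl
    expand-map ρ F F' h (c ∷ cs) = +-cong (*-congˡ (h cs))
      (-‿cong (expand-map ρ (λ ds → F (f c ∷ ds)) (λ ds → F' (c ∷ ds)) (λ ds → h (c ∷ ds)) cs))
    go : ∀ rs cs → minor m (map f rs) (map f cs) ≈ minor (λ i j → m (f i) (f j)) rs cs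
    go []       []      = ≈-refl
    go []       (_ ∷ _) = ≈-refl
    go (r ∷ rs) cs      = expand-map (m (f r)) _ _ (go rs) cs

-- Positive cones and the preorder they induce

record PositiveCone (R : CommutativeRing 0ℓ 0ℓ) : Set₁ where
  open CommutativeRing R
  field
    Pos      : Carrier → Set
    Pos-resp : ∀ {p q} → p ≈ q → Pos p → Pos q
    Pos-0    : Pos 0#
    Pos-1    : Pos 1#
    Pos-+    : ∀ {p q} → Pos p → Pos q → Pos (p + q)
    Pos-*    : ∀ {p q} → Pos p → Pos q → Pos (p * q)

module Order (R : CommutativeRing 0ℓ 0ℓ) (C : PositiveCone R) where
  open CommutativeRing R
  open Algebra.Properties.Group +-group using (∙-cancelʳ)
  open Relation.Binary.Reasoning.Setoid setoid
  open IntegerSolver R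
  open PositiveCone C

  infix 4 _⊑_
  -- The difference is kept as data: later estimates take it apart and build their own difference
  -- from it by a ring identity.
  _⊑_ : Carrier → Carrier → Set
  p ⊑ q = ∃ λ d → Pos d × q ≈ p + d

  ⊑-reflexive : ∀ {p q} → p ≈ q → p ⊑ q
  ⊑-reflexive p≈q = 0# , Pos-0 , trans (sym p≈q) (sym (+-identityʳ _))

  ⊑-refl : ∀ {p} → p ⊑ p
  ⊑-refl = ⊑-reflexive refl

  ⊑-trans : ∀ {p q r} → p ⊑ q → q ⊑ r → p ⊑ r
  ⊑-trans (d , pd , e) (d' , pd' , e') = d + d' , Pos-+ pd pd' , trans e' (trans (+-congʳ e) (+-assoc _ _ _))

  ⊑-resp : ∀ {p p' q q'} → p ≈ p' → q ≈ q' → p ⊑ q → p' ⊑ q'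
  ⊑-resp p≈ q≈ (d , pd , e) = d , pd , trans (sym q≈) (trans e (+-congʳ p≈))

  ⊑-+ : ∀ {p p' q q'} → p ⊑ q → p' ⊑ q' → p + p' ⊑ q + q'
  ⊑-+ {p} {p'} (d , pd , e) (d' , pd' , e') = d + d' , Pos-+ pd pd' ,
    trans (+-cong e e') (solve 4 (λ p d p' d' → (p :+ d) :+ (p' :+ d') := (p :+ p') :+ (d :+ d')) refl p d p' d')

  ⊑-+ʳ : ∀ {p q d} → Pos d → p ⊑ q → p ⊑ q + d
  ⊑-+ʳ {p} {d = d} pd p⊑q = ⊑-resp (+-identityʳ p) refl (⊑-+ p⊑q (d , pd , sym (+-identityˡ d)))

  ⊑-* : ∀ {p p' q q'} → Pos p → Pos p' → p ⊑ q → p' ⊑ q' → p * p' ⊑ q * q'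
  ⊑-* {p} {p'} pp pp' (d , pd , e) (d' , pd' , e') =
    d * p' + p * d' + d * d' , Pos-+ (Pos-+ (Pos-* pd pp') (Pos-* pp pd')) (Pos-* pd pd') ,
    trans (*-cong e e') (solve 4 (λ p d p' d' → (p :+ d) :* (p' :+ d') := p :* p' :+ (d :* p' :+ p :* d' :+ d :* d')) refl p d p' d')

  ⊑-Pos : ∀ {p q} → Pos p → p ⊑ q → Pos q
  ⊑-Pos pp (d , pd , e) = Pos-resp (sym e) (Pos-+ pp pd)

  Pos⇒0⊑ : ∀ {p} → Pos p → 0# ⊑ p
  Pos⇒0⊑ {p} pp = p , pp , sym (+-identityˡ p)

  -- A form of inequality that the ring solver can work on: the solver proves the identity p + u = q
  -- + v, and v = u + d comes from the hypothesis at hand.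
  cancel-⊑ : ∀ {p q u v d} → p + u ≈ q + v → v ≈ u + d → p ≈ q + d
  cancel-⊑ {p} {q} {u} {v} {d} e f = ∙-cancelʳ u p (q + d) (begin
    p + u       ≈⟨ e ⟩
    q + v       ≈⟨ +-congˡ f ⟩
    q + (u + d) ≈⟨ solve 3 (λ q u d → q :+ (u :+ d) := q :+ d :+ u) refl q u d ⟩
    q + d + u ∎)

-- Rooted trees, their parameters, and the legs of a spider

data Tree : Set where
  pt  : Tree
  -- t ◃ s joins the root of t by an edge to the root of s
  _◃_ : Tree → Tree → Tree

infixr 6 _◃_ _⊙_

Nontrivial : Tree → Set
Nontrivial pt      = ⊥
Nontrivial (_ ◃ _) = ⊤

_⊙_ : Tree → Tree → Tree
pt       ⊙ s = s
(t ◃ t') ⊙ s = t ◃ (t' ⊙ s)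

-- size does not count the root; leaves counts a single point as a leaf,
-- rootedLeaves does not.
size height leaves rootedLeaves : Tree → ℕ
size pt      = 0
size (t ◃ s) = suc (size t ℕ.+ size s)
height pt      = 0
height (t ◃ s) = suc (height t) ⊔ height s
rootedLeaves pt      = 0
rootedLeaves (t ◃ s) = leaves t ℕ.+ rootedLeaves s
leaves pt      = 1
leaves (t ◃ s) = leaves t ℕ.+ rootedLeaves s

leaves≡rootedLeaves : ∀ T → Nontrivial T → leaves T ≡ rootedLeaves T
leaves≡rootedLeaves (t ◃ s) _ = ≡.refl

size-⊙ : ∀ T S → size (T ⊙ S) ≡ size T ℕ.+ size S
size-⊙ pt S = ≡.refl
size-⊙ (t ◃ s) S = ≡.cong suc (≡.trans (≡.cong (size t ℕ.+_) (size-⊙ s S)) (≡.sym (ℕₚ.+-assoc (size t) (size s) (size S))))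

rootedLeaves-⊙ : ∀ T S → rootedLeaves (T ⊙ S) ≡ rootedLeaves T ℕ.+ rootedLeaves S
rootedLeaves-⊙ pt S = ≡.refl
rootedLeaves-⊙ (t ◃ s) S = ≡.trans (≡.cong (leaves t ℕ.+_) (rootedLeaves-⊙ s S)) (≡.sym (ℕₚ.+-assoc (leaves t) (rootedLeaves s) (rootedLeaves S)))

height-⊙ : ∀ T S → height (T ⊙ S) ≡ height T ⊔ height S
height-⊙ pt S = ≡.refl
height-⊙ (t ◃ s) S = ≡.trans (≡.cong (suc (height t) ⊔_) (height-⊙ s S)) (≡.sym (ℕₚ.⊔-assoc (suc (height t)) (height s) (height S)))

Nontrivial-⊙ : ∀ T S → Nontrivial T → Nontrivial (T ⊙ S)
Nontrivial-⊙ (t ◃ s) S _ = tt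

height-Nontrivial : ∀ T → 1 ≤ height T → Nontrivial T
height-Nontrivial (t ◃ s) _ = tt

Nontrivial-height : ∀ T → Nontrivial T → 1 ≤ height T
Nontrivial-height (t ◃ s) _ = ≤-trans (s≤s z≤n) (ℕₚ.m≤m⊔n (suc (height t)) (height s))

-- Leg lengths of a spider: a longest leg, then the others.
Legs : Set
Legs = ℕ × List ℕ

-- Putting an edge above the root of a spider and gathering the legs again at its upper end
-- lengthens one leg only; the longest is chosen.
bump : Legs → Legs
bump (h , o) = suc h , o

combine : Legs → Legs → Legs
combine (p , o) (h , o') with ≤-total h p
... | inj₁ _ = p , h ∷ o ++ o'
... | inj₂ _ = h , p ∷ o ++ o'

-- A tree with one branch has its own clause because `legs pt` is a single leg of length 0:
-- combining with it would make the number of legs exceed `leaves`.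
legs : Tree → Legs
legs pt              = 0 , []
legs (t ◃ pt)        = bump (legs t)
legs (t ◃ (s ◃ s'))  = combine (bump (legs t)) (legs (s ◃ s'))

legList : Legs → List ℕ
legList (h , o) = h ∷ o

private
  length-combine : ∀ l l' → length (legList (combine l l')) ≡ length (legList l) ℕ.+ length (legList l')
  length-combine (p , o) (h , o') with ≤-total h p
  ... | inj₁ _ = ≡.cong suc (≡.trans (≡.cong suc (length-++ o)) (≡.sym (+-suc (length o) (length o'))))
  ... | inj₂ _ = ≡.cong suc (≡.trans (≡.cong suc (length-++ o)) (≡.sym (+-suc (length o) (length o'))))

  sum-combine : ∀ l l' → sum (legList (combine l l')) ≡ sum (legList l) ℕ.+ sum (legList l')
  sum-combine (p , o) (h , o') with ≤-total h p
  ... | inj₁ _ = ≡.trans (≡.cong (λ z → p ℕ.+ (h ℕ.+ z)) (sum-++ o o')) (lem p h (sum o) (sum o'))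
    where lem : ∀ p h a b → p ℕ.+ (h ℕ.+ (a ℕ.+ b)) ≡ p ℕ.+ a ℕ.+ (h ℕ.+ b)
          lem = solve-∀
  ... | inj₂ _ = ≡.trans (≡.cong (λ z → h ℕ.+ (p ℕ.+ z)) (sum-++ o o')) (lem p h (sum o) (sum o'))
    where lem : ∀ p h a b → h ℕ.+ (p ℕ.+ (a ℕ.+ b)) ≡ p ℕ.+ a ℕ.+ (h ℕ.+ b)
          lem = solve-∀

  head-combine : ∀ l l' → proj₁ (combine l l') ≡ proj₁ l ⊔ proj₁ l'
  head-combine (p , o) (h , o') with ≤-total h p
  ... | inj₁ h≤p = ≡.sym (ℕₚ.m≥n⇒m⊔n≡m h≤p)
  ... | inj₂ p≤h = ≡.sym (ℕₚ.m≤n⇒m⊔n≡n p≤h)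

length-legs : ∀ T → length (legList (legs T)) ≡ leaves T
length-legs pt = ≡.refl
length-legs (t ◃ pt) = ≡.trans (length-legs t) (≡.sym (ℕₚ.+-identityʳ _))
length-legs (t ◃ (s ◃ s')) = ≡.trans (length-combine (bump (legs t)) (legs (s ◃ s'))) (≡.cong₂ ℕ._+_ (length-legs t) (length-legs (s ◃ s')))

sum-legs : ∀ T → sum (legList (legs T)) ≡ size T
sum-legs pt = ≡.refl
sum-legs (t ◃ pt) = ≡.cong suc (≡.trans (sum-legs t) (≡.sym (ℕₚ.+-identityʳ _)))
sum-legs (t ◃ (s ◃ s')) = ≡.trans (sum-combine (bump (legs t)) (legs (s ◃ s'))) (≡.cong suc (≡.cong₂ ℕ._+_ (sum-legs t) (sum-legs (s ◃ s'))))

head-legs : ∀ T → proj₁ (legs T) ≡ height T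
head-legs pt = ≡.refl
head-legs (t ◃ pt) = ≡.cong suc (head-legs t)
head-legs (t ◃ (s ◃ s')) = ≡.trans (head-combine (bump (legs t)) (legs (s ◃ s'))) (≡.cong₂ _⊔_ (≡.cong suc (head-legs t)) (head-legs (s ◃ s')))

-- Pairs of rooted trees and flattening to a spider

module RootedPairs (R : CommutativeRing 0ℓ 0ℓ) (C : PositiveCone R)
                   (x : CommutativeRing.Carrier R) (Pos-x : PositiveCone.Pos C x) where
  open CommutativeRing R
  open IntegerSolver R
  open PositiveCone C
  open Order R C

  Pair : Set
  Pair = Carrier × Carrier

  infix 4 _≋_
  _≋_ : Pair → Pair → Set
  X ≋ Y = (proj₁ X ≈ proj₁ Y) × (proj₂ X ≈ proj₂ Y)

  -- For a tree T with root r the pair is (b , c), where b is the determinant of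
  -- x I + L(T) without row and column r, and x b + c = det (x I + L(T)).
  infixl 7 _⊗_
  _⊗_ : Pair → Pair → Pair
  (b , c) ⊗ (b' , c') = b * b' , c * b' + b * c'

  -- grounded behaves like an infinitely heavy branch at the root: it turns
  -- total into the first component.
  unit grounded : Pair
  unit     = 1# , 0#
  grounded = 0# , 1#

  total : Pair → Carrier
  total (b , c) = x * b + c

  -- The pair of a tree with a new root above the old one. For s = x + c / b this is the series law:
  -- the new quotient is s / (1 + s).
  plant : Pair → Pair
  plant (b , c) = (1# + x) * b + c , x * b + c

  pairMonoid : CommutativeMonoid 0ℓ 0ℓ
  pairMonoid = record
    { Carrier = Pair ; _≈_ = _≋_ ; _∙_ = _⊗_ ; ε = unit
    ; isCommutativeMonoid = record
      { isMonoid = record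
        { isSemigroup = record
          { isMagma = record
            { isEquivalence = record
              { refl  = refl , refl
              ; sym   = λ { (p , q) → sym p , sym q }
              ; trans = λ { (p , q) (p' , q') → trans p p' , trans q q' } }
            ; ∙-cong = λ { (p , q) (p' , q') → *-cong p p' , +-cong (*-cong q p') (*-cong p q') } }
          ; assoc = λ { (b , c) (b' , c') (b″ , c″) → *-assoc b b' b″ ,
              solve 6 (λ b c b' c' b″ c″ → (c :* b' :+ b :* c') :* b″ :+ (b :* b') :* c″
                                        := c :* (b' :* b″) :+ b :* (c' :* b″ :+ b' :* c″)) refl b c b' c' b″ c″ } }
        ; identity = (λ { (b , c) → *-identityˡ b , solve 2 (λ b c → :0 :* b :+ :1 :* c := c) refl b c })
                   , (λ { (b , c) → *-identityʳ b , solve 2 (λ b c → c :* :1 :+ b :* :0 := c) refl b c }) }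
      ; comm = λ { (b , c) (b' , c') → *-comm b b' ,
          solve 4 (λ b c b' c' → c :* b' :+ b :* c' := c' :* b :+ b' :* c) refl b c b' c' } } }

  module ⊗ = CommutativeMonoid pairMonoid
  private module ⊗S = Algebra.Solver.CommutativeMonoid pairMonoid
  open ⊗S using (_⊜_; _⊕_)

  total-cong : ∀ {X Y} → X ≋ Y → total X ≈ total Y
  total-cong (p , q) = +-cong (*-congˡ p) q

  plant-cong : ∀ {X Y} → X ≋ Y → plant X ≋ plant Y
  plant-cong (p , q) = +-cong (*-congˡ p) q , +-cong (*-congˡ p) q

  PosPair : Pair → Set
  PosPair (b , c) = Pos b × Pos c

  PosPair-⊗ : ∀ {X Y} → PosPair X → PosPair Y → PosPair (X ⊗ Y)
  PosPair-⊗ (p , q) (p' , q') = Pos-* p p' , Pos-+ (Pos-* q p') (Pos-* p q')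

  PosPair-unit : PosPair unit
  PosPair-unit = Pos-1 , Pos-0

  PosPair-grounded : PosPair grounded
  PosPair-grounded = Pos-0 , Pos-1

  PosPair-plant : ∀ {X} → PosPair X → PosPair (plant X)
  PosPair-plant (p , q) = Pos-+ (Pos-* (Pos-+ Pos-1 Pos-x) p) q , Pos-+ (Pos-* Pos-x p) q

  -- c / b ≥ c' / b', cleared of denominators
  infix 4 _≽_
  _≽_ : Pair → Pair → Set
  (b , c) ≽ (b' , c') = b * c' ⊑ c * b'

  ≽-resp : ∀ {X X' Y Y'} → X ≋ X' → Y ≋ Y' → X ≽ Y → X' ≽ Y'
  ≽-resp (p , q) (p' , q') = ⊑-resp (*-cong p q') (*-cong q p')

  ≽-unit : ∀ {X} → PosPair X → X ≽ unit
  ≽-unit {b , c} (_ , q) = ⊑-resp (sym (zeroʳ b)) (sym (*-identityʳ c)) (Pos⇒0⊑ q)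

  grounded-≽ : ∀ {Y} → PosPair Y → grounded ≽ Y
  grounded-≽ {b , c} (p , _) = ⊑-resp (sym (zeroˡ c)) (sym (*-identityˡ b)) (Pos⇒0⊑ p)

  -- `plant` is linear with determinant (1 + x) - x = 1, so the cross difference c b' - b c' does
  -- not change and the old witness d is reused.
  plant-≽ : ∀ {X Y} → X ≽ Y → plant X ≽ plant Y
  plant-≽ {b , c} {b' , c'} (d , pd , e) = d , pd ,
    cancel-⊑ (solve 5 (λ x b c b' c' → (x :* b :+ c) :* ((:1 :+ x) :* b' :+ c') :+ b :* c'
                                := ((:1 :+ x) :* b :+ c) :* (x :* b' :+ c') :+ c :* b') refl x b c b' c') e

  -- Quotients add under `⊗` and that of Z is nonnegative. Cleared of denominators, the new
  -- difference is b″ d + b c″ b'.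
  ⊗-≽ : ∀ {X Y Z} → PosPair X → PosPair Y → PosPair Z → X ≽ Y → X ⊗ Z ≽ Y
  ⊗-≽ {b , c} {b' , c'} {b″ , c″} (pb , pc) (pb' , pc') (pb″ , pc″) (d , pd , e) =
    b″ * d + b * c″ * b' , Pos-+ (Pos-* pb″ pd) (Pos-* (Pos-* pb pc″) pb') ,
    cancel-⊑ {u = b″ * (b * c')} {v = b″ * (c * b') + b * c″ * b'}
      (solve 6 (λ b c b' c' b″ c″ → (c :* b″ :+ b :* c″) :* b' :+ b″ :* (b :* c')
                      := b :* b″ :* c' :+ (b″ :* (c :* b') :+ b :* c″ :* b')) refl b c b' c' b″ c″)
      (trans (+-congʳ (*-congˡ e))
             (solve 4 (λ z u d w → z :* (u :+ d) :+ w := z :* u :+ (z :* d :+ w)) refl b″ (b * c') d (b * c″ * b')))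

  -- Both sides are the determinant of the tree made out of X and Y by an edge between their roots;
  -- `total` does not see which end of the edge is the root.
  reroot : ∀ X Y → total (X ⊗ plant Y) ≈ total (plant X ⊗ Y)
  reroot (b , c) (b' , c') =
    solve 5 (λ x b c b' c' → x :* (b :* ((:1 :+ x) :* b' :+ c')) :+ (c :* ((:1 :+ x) :* b' :+ c') :+ b :* (x :* b' :+ c'))
       := x :* (((:1 :+ x) :* b :+ c) :* b') :+ ((x :* b :+ c) :* b' :+ ((:1 :+ x) :* b :+ c) :* c')) refl x b c b' c'

  -- Moving a branch W from the far end of an edge to the near end.
  shift : ∀ X Y W → PosPair W → X ≽ Y → total (X ⊗ W ⊗ plant Y) ⊑ total (X ⊗ plant (Y ⊗ W))
  -- The two totals differ by exactly c″ (c b' - b c').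
  shift (b , c) (b' , c') (b″ , c″) (_ , pc″) (d , pd , e) = c″ * d , Pos-* pc″ pd ,
    cancel-⊑ {u = c″ * (b * c')} {v = c″ * (c * b')}
      (solve 7 (λ x b c b' c' b″ c″ →
          x :* (b :* ((:1 :+ x) :* (b' :* b″) :+ (c' :* b″ :+ b' :* c″)))
            :+ (c :* ((:1 :+ x) :* (b' :* b″) :+ (c' :* b″ :+ b' :* c″))
                :+ b :* (x :* (b' :* b″) :+ (c' :* b″ :+ b' :* c″)))
            :+ c″ :* (b :* c')
          := x :* (b :* b″ :* ((:1 :+ x) :* b' :+ c'))
            :+ ((c :* b″ :+ b :* c″) :* ((:1 :+ x) :* b' :+ c') :+ b :* b″ :* (x :* b' :+ c'))
            :+ c″ :* (c :* b')) refl x b c b' c' b″ c″)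
      (trans (*-congˡ e) (distribˡ c″ _ d))

  path : ℕ → Pair
  path zero    = unit
  path (suc k) = plant (path k)

  spider : List ℕ → Pair
  spider []       = unit
  spider (k ∷ ks) = path k ⊗ spider ks

  pair : Tree → Pair
  pair pt      = unit
  pair (t ◃ s) = plant (pair t) ⊗ pair s

  PosPair-path : ∀ k → PosPair (path k)
  PosPair-path zero    = PosPair-unit
  PosPair-path (suc k) = PosPair-plant (PosPair-path k)

  PosPair-spider : ∀ ks → PosPair (spider ks)
  PosPair-spider []       = PosPair-unit
  PosPair-spider (k ∷ ks) = PosPair-⊗ (PosPair-path k) (PosPair-spider ks)

  PosPair-pair : ∀ T → PosPair (pair T)
  PosPair-pair pt      = PosPair-unit
  PosPair-pair (t ◃ s) = PosPair-⊗ (PosPair-plant (PosPair-pair t)) (PosPair-pair s)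

  pair-⊙ : ∀ T S → pair (T ⊙ S) ≋ pair T ⊗ pair S
  pair-⊙ pt S      = ⊗.sym (⊗.identityˡ (pair S))
  pair-⊙ (t ◃ s) S = ⊗.trans (⊗.∙-congˡ {plant (pair t)} (pair-⊙ s S)) (⊗.sym (⊗.assoc (plant (pair t)) (pair s) (pair S)))

  spider-++ : ∀ ks ls → spider (ks ++ ls) ≋ spider ks ⊗ spider ls
  spider-++ [] ls       = ⊗.sym (⊗.identityˡ (spider ls))
  spider-++ (k ∷ ks) ls = ⊗.trans (⊗.∙-congˡ {path k} (spider-++ ks ls)) (⊗.sym (⊗.assoc (path k) (spider ks) (spider ls)))

  path-≽ : ∀ h k → k ≤ h → path h ≽ path k
  path-≽ h       zero    _         = ≽-unit (PosPair-path h)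
  path-≽ (suc h) (suc k) (s≤s k≤h) = plant-≽ (path-≽ h k k≤h)

  plant-path-≽ : ∀ {X} h → PosPair X → (∀ k → k ≤ h → X ≽ path k) → ∀ k → k ≤ suc h → plant X ≽ path k
  plant-path-≽ h pX X≽ zero    _         = ≽-unit (PosPair-plant pX)
  plant-path-≽ h pX X≽ (suc k) (s≤s k≤h) = plant-≽ (X≽ k k≤h)

  -- A highest branch of T dominates `path k` by induction, and the other branches only add weight.
  pair-≽ : ∀ T k → k ≤ height T → pair T ≽ path k
  pair-≽ pt      zero _ = ≽-unit PosPair-unit
  pair-≽ (t ◃ s) k k≤ with ≤-total (suc (height t)) (height s)
  ... | inj₁ le = ≽-resp (⊗.comm (pair s) (plant (pair t))) ⊗.refl
                    (⊗-≽ (PosPair-pair s) (PosPair-path k) (PosPair-plant (PosPair-pair t))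
                      (pair-≽ s k (≡.subst (k ≤_) (ℕₚ.m≤n⇒m⊔n≡n le) k≤)))
  ... | inj₂ ge = ⊗-≽ (PosPair-plant (PosPair-pair t)) (PosPair-path k) (PosPair-pair s)
                    (plant-path-≽ (height t) (PosPair-pair t) (pair-≽ t) k (≡.subst (k ≤_) (ℕₚ.m≥n⇒m⊔n≡m ge) k≤))

  spider-combine : ∀ l l' → spider (legList (combine l l')) ≋ spider (legList l) ⊗ spider (legList l')
  spider-combine (p , o) (h , o') with ≤-total h p
  ... | inj₁ _ = ⊗.trans (⊗.∙-congˡ {path p} (⊗.∙-congˡ {path h} (spider-++ o o')))
      (⊗S.solve 4 (λ p h o o' → p ⊕ (h ⊕ (o ⊕ o')) ⊜ (p ⊕ o) ⊕ (h ⊕ o')) ⊗.refl (path p) (path h) (spider o) (spider o'))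
  ... | inj₂ _ = ⊗.trans (⊗.∙-congˡ {path h} (⊗.∙-congˡ {path p} (spider-++ o o')))
      (⊗S.solve 4 (λ p h o o' → h ⊕ (p ⊕ (o ⊕ o')) ⊜ (p ⊕ o) ⊕ (h ⊕ o')) ⊗.refl (path p) (path h) (spider o) (spider o'))

  legSpider : Tree → Pair
  legSpider T = spider (legList (legs T))

  legSpider-≽ : ∀ T k → k ≤ height T → legSpider T ≽ path k
  legSpider-≽ T k k≤ = ⊗-≽ (PosPair-path (proj₁ (legs T))) (PosPair-path k) (PosPair-spider (proj₂ (legs T)))
    (path-≽ _ k (≡.subst (k ≤_) (≡.sym (head-legs T)) k≤))

  -- A branch of T is first flattened with the edge to its root counted to the
  -- context; then all its legs but the longest are shifted to the root of T.
  flatten : ∀ T Z → PosPair Z → (∀ k → k < height T → Z ≽ path k) → total (Z ⊗ legSpider T) ⊑ total (Z ⊗ pair T)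

  flatten-branch : ∀ t X → PosPair X → (∀ k → k ≤ height t → X ≽ path k) →
    total (X ⊗ spider (legList (bump (legs t)))) ⊑ total (X ⊗ plant (pair t))
  flatten-branch t X pX X≽ =
    ⊑-trans (⊑-resp (total-cong (⊗S.solve 3 (λ X o p → (X ⊕ o) ⊕ p ⊜ X ⊕ (p ⊕ o)) ⊗.refl X (spider o) (path (suc h)))) refl
               (shift X (path h) (spider o) (PosPair-spider o) (X≽ h (≤-reflexive (head-legs t)))))
            (⊑-resp (sym (reroot X _)) (sym (reroot X _))
               (flatten t (plant X) (PosPair-plant pX)
                 (λ k k< → plant-path-≽ (height t) pX X≽ k (≤-trans (<⇒≤ k<) (n≤1+n _)))))
    where h = proj₁ (legs t)
          o = proj₂ (legs t)

  flatten pt Z pZ Z≽ = ⊑-reflexive (total-cong (⊗.∙-congˡ {Z} (⊗.identityˡ unit)))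
  flatten (t ◃ pt) Z pZ Z≽ =
    ⊑-resp refl (total-cong (⊗.∙-congˡ {Z} (⊗.sym (⊗.identityʳ (plant (pair t))))))
      (flatten-branch t Z pZ (λ k k≤ → Z≽ k (s≤s k≤)))
  -- The later branches are flattened beside the spider B of the first branch, the first beside the
  -- original S. In both contexts the dominance comes from Z, and what is glued to Z only adds to
  -- it.
  flatten (t ◃ S@(s ◃ s')) Z pZ Z≽ =
    ⊑-trans
      (⊑-resp (total-cong (⊗.trans (⊗.assoc Z B (legSpider S)) (⊗.∙-congˡ {Z} (⊗.sym (spider-combine (bump (legs t)) (legs S)))))) refl
        (flatten S (Z ⊗ B) (PosPair-⊗ pZ pB)
          (λ k k< → ⊗-≽ pZ (PosPair-path k) pB (Z≽ k (≤-trans k< (ℕₚ.m≤n⊔m (suc (height t)) (height S)))))))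
      (⊑-resp
        (total-cong (⊗S.solve 3 (λ Z S B → (Z ⊕ S) ⊕ B ⊜ (Z ⊕ B) ⊕ S) ⊗.refl Z (pair S) B))
        (total-cong (⊗S.solve 3 (λ Z S B → (Z ⊕ S) ⊕ B ⊜ Z ⊕ (B ⊕ S)) ⊗.refl Z (pair S) (plant (pair t))))
        (flatten-branch t (Z ⊗ pair S) (PosPair-⊗ pZ (PosPair-pair S))
          (λ k k≤ → ⊗-≽ pZ (PosPair-path k) (PosPair-pair S)
            (Z≽ k (≤-trans (s≤s k≤) (ℕₚ.m≤m⊔n (suc (height t)) (height S)))))))
    where B = spider (legList (bump (legs t)))
          pB = PosPair-spider (legList (bump (legs t)))

  record SpiderBelow (X : Pair) (ℓ m : ℕ) : Set where
    constructor spiderBelow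
    field
      lengths : List ℕ
      number  : length lengths ≡ ℓ
      amount  : sum lengths ≡ m
      below   : total (spider lengths) ⊑ total X

  SpiderBelow-resp : ∀ {X Y ℓ ℓ' m m'} → total X ≈ total Y → ℓ ≡ ℓ' → m ≡ m' → SpiderBelow X ℓ m → SpiderBelow Y ℓ' m'
  SpiderBelow-resp e ≡.refl ≡.refl (spiderBelow ks p q r) = spiderBelow ks p q (⊑-resp refl e r)

  -- The root is moved towards the higher side T until both sides have heights
  -- differing by at most one; then each side contains the paths needed to
  -- flatten the other.
  recentre : ∀ Z T → Nontrivial Z → Nontrivial T → height Z ≤ suc (height T) →
    SpiderBelow (pair Z ⊗ pair T) (rootedLeaves Z ℕ.+ rootedLeaves T) (size Z ℕ.+ size T)
  recentre Z T@(t ◃ s) nZ nT hZ with ≤-total (height T) (suc (height Z))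
  -- `flatten` asks a side only for the paths strictly shorter than the other side's height, so
  -- heights that differ by one are good enough. T is flattened beside the spider of Z, whose
  -- longest leg still has the height of Z.
  ... | inj₁ le = spiderBelow (legList (legs Z) ++ legList (legs T))
    (≡.trans (length-++ (legList (legs Z))) (≡.cong₂ ℕ._+_ (≡.trans (length-legs Z) (leaves≡rootedLeaves Z nZ)) (length-legs T)))
    (≡.trans (sum-++ (legList (legs Z)) (legList (legs T))) (≡.cong₂ ℕ._+_ (sum-legs Z) (sum-legs T)))
    (⊑-trans
      (⊑-resp (total-cong (⊗.sym (spider-++ (legList (legs Z)) (legList (legs T))))) refl
        (flatten T (legSpider Z) (PosPair-spider (legList (legs Z)))
          (λ k k< → legSpider-≽ Z k (≤-pred (≤-trans k< le)))))
      (⊑-resp (total-cong (⊗.comm (pair T) (legSpider Z))) (total-cong (⊗.comm (pair T) (pair Z)))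
        (flatten Z (pair T) (PosPair-pair T) (λ k k< → pair-≽ T k (≤-pred (≤-trans k< hZ))))))
  ... | inj₂ ge with ≤-total (height s) (height t)
  -- The root crosses the edge to t, and everything else becomes one branch of the new Z. Both sides
  -- stay nontrivial, so neither the old nor the new root is a leaf and the leaf count is kept.
  ...   | inj₁ s≤t = SpiderBelow-resp
      (trans (total-cong (⊗.∙-congʳ {pair t} (⊗.identityʳ (plant (pair (Z ⊙ s))))))
        (trans (sym (reroot (pair (Z ⊙ s)) (pair t)))
          (total-cong (⊗.trans (⊗.∙-congʳ {plant (pair t)} (pair-⊙ Z s))
            (⊗S.solve 3 (λ Z s t → (Z ⊕ s) ⊕ t ⊜ Z ⊕ (t ⊕ s)) ⊗.refl (pair Z) (pair s) (plant (pair t)))))))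
      (≡.trans (≡.cong₂ ℕ._+_ (≡.trans (ℕₚ.+-identityʳ _) (≡.trans (leaves≡rootedLeaves (Z ⊙ s) (Nontrivial-⊙ Z s nZ)) (rootedLeaves-⊙ Z s)))
                              (≡.sym (leaves≡rootedLeaves t nt)))
               (arith₁ (rootedLeaves Z) (rootedLeaves s) (leaves t)))
      (≡.trans (≡.cong (λ z → suc (z ℕ.+ 0) ℕ.+ size t) (size-⊙ Z s)) (arith₂ (size Z) (size s) (size t)))
      (recentre ((Z ⊙ s) ◃ pt) t _ nt
        (≡.subst (_≤ suc (height t)) (≡.sym (≡.trans (ℕₚ.⊔-identityʳ _) (≡.cong suc (height-⊙ Z s))))
          (s≤s (⊔-lub hZ≤t s≤t))))
    where
    hZ≤t : height Z ≤ height t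
    hZ≤t = ≤-pred (≡.subst (suc (height Z) ≤_) (ℕₚ.m≥n⇒m⊔n≡m (≤-trans s≤t (n≤1+n _))) ge)
    nt : Nontrivial t
    nt = height-Nontrivial t (≤-trans (Nontrivial-height Z nZ) hZ≤t)
    arith₁ : ∀ z s t → z ℕ.+ s ℕ.+ t ≡ z ℕ.+ (t ℕ.+ s)
    arith₁ = solve-∀
    arith₂ : ∀ z s t → suc (z ℕ.+ s ℕ.+ 0) ℕ.+ t ≡ z ℕ.+ suc (t ℕ.+ s)
    arith₂ = solve-∀
  -- The root stays and the branch t changes sides; since t is not higher than s, the new Z is at
  -- most one higher than s.
  ...   | inj₂ t≤s = SpiderBelow-resp
      (total-cong (⊗.trans (⊗.∙-congʳ {pair s} (pair-⊙ Z (t ◃ pt)))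
        (⊗S.solve 3 (λ Z s t → (Z ⊕ (t ⊕ ⊗S.id)) ⊕ s ⊜ Z ⊕ (t ⊕ s)) ⊗.refl (pair Z) (pair s) (plant (pair t)))))
      (≡.trans (≡.cong (ℕ._+ rootedLeaves s) (rootedLeaves-⊙ Z (t ◃ pt))) (arith₁ (rootedLeaves Z) (rootedLeaves s) (leaves t)))
      (≡.trans (≡.cong (ℕ._+ size s) (size-⊙ Z (t ◃ pt))) (arith₂ (size Z) (size s) (size t)))
      (recentre (Z ⊙ (t ◃ pt)) s (Nontrivial-⊙ Z (t ◃ pt) nZ) ns
        (≡.subst (_≤ suc (height s)) (≡.sym (≡.trans (height-⊙ Z (t ◃ pt)) (≡.cong (height Z ⊔_) (ℕₚ.⊔-identityʳ _))))
          (⊔-lub (≤-trans hZ≤s (n≤1+n _)) (s≤s t≤s))))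
    where
    hZ≤s : height Z ≤ height s
    hZ≤s = ≤-pred (≤-trans ge (⊔-lub (s≤s t≤s) (n≤1+n _)))
    ns : Nontrivial s
    ns = height-Nontrivial s (≤-trans (Nontrivial-height Z nZ) hZ≤s)
    arith₁ : ∀ z s t → z ℕ.+ (t ℕ.+ 0) ℕ.+ s ≡ z ℕ.+ (t ℕ.+ s)
    arith₁ = solve-∀
    arith₂ : ∀ z s t → z ℕ.+ suc (t ℕ.+ 0) ℕ.+ s ≡ z ℕ.+ suc (t ℕ.+ s)
    arith₂ = solve-∀

-- Balancing a list of leg lengths

infix 4 _⇝_
-- Derivations are kept as syntax because they are read in several ways: for the sum and the number
-- of legs, which they preserve, and for `total`, which they lower in every positive context.
data _⇝_ : List ℕ → List ℕ → Set where
  perm : ∀ {ks ls} → ks ↭ ls → ks ⇝ ls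
  move : ∀ {p q} ks → q ≤ p → suc p ∷ q ∷ ks ⇝ p ∷ suc q ∷ ks
  keep : ∀ {ks ls} k → ks ⇝ ls → k ∷ ks ⇝ k ∷ ls
  _⟫_  : ∀ {ks ls ms} → ks ⇝ ls → ls ⇝ ms → ks ⇝ ms

infixr 5 _⟫_

⇝-length : ∀ {ks ls} → ks ⇝ ls → length ks ≡ length ls
⇝-length (perm p)   = Perm.↭-length p
⇝-length (move _ _) = ≡.refl
⇝-length (keep k r) = ≡.cong suc (⇝-length r)
⇝-length (r ⟫ r')   = ≡.trans (⇝-length r) (⇝-length r')

⇝-sum : ∀ {ks ls} → ks ⇝ ls → sum ks ≡ sum ls
⇝-sum (perm p)   = sum-↭ p
⇝-sum (move {p} {q} ks _) = ≡.sym (+-suc p (q ℕ.+ sum ks))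
⇝-sum (keep k r) = ≡.cong (k ℕ.+_) (⇝-sum r)
⇝-sum (r ⟫ r')   = ≡.trans (⇝-sum r) (⇝-sum r')

-- Counting the short legs as suc j puts i below the number of legs. So q and i are quotient and
-- remainder of the division in `bstLengths`, which then returns literally this list.
even : ℕ → ℕ → ℕ → List ℕ
even q i j = replicate i (suc q) ++ replicate (suc j) q

Even : List ℕ → Set
Even ks = ∃ λ q → ∃ λ i → ∃ λ j → ks ⇝ even q i j

private
  infixr 5 _⟫ᴱ_
  _⟫ᴱ_ : ∀ {ks ls} → ks ⇝ ls → Even ls → Even ks
  r ⟫ᴱ (q , i , j , r') = q , i , j , r ⟫ r'

  even-take : ∀ q i j → even q i j ↭ q ∷ (replicate i (suc q) ++ replicate j q)
  even-take q i j = Perm.shift q (replicate i (suc q)) (replicate j q)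

  take-one : ∀ d q i j → q ℕ.+ suc d ∷ even q i j ⇝ q ℕ.+ d ∷ suc q ∷ (replicate i (suc q) ++ replicate j q)
  take-one d q i j =
    perm (↭-trans (↭-prep _ (even-take q i j))
           (↭-reflexive (≡.cong (_∷ q ∷ (replicate i (suc q) ++ replicate j q)) (+-suc q d))))
    ⟫ move _ (m≤m+n q d)

  insert-above : ∀ d q i j → Even (q ℕ.+ d ∷ even q i j)
  insert-above 0 q i j = q , i , suc j ,
    perm (↭-trans (↭-reflexive (≡.cong (_∷ even q i j) (ℕₚ.+-identityʳ q))) (↭-sym (even-take q i (suc j))))
  insert-above 1 q i j = q , suc i , j , perm (↭-reflexive (≡.cong (_∷ even q i j) (ℕₚ.+-comm q 1)))
  insert-above (suc (suc e)) q i (suc j) = take-one (suc e) q i (suc j) ⟫ᴱ insert-above (suc e) q (suc i) j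
  -- The only leg of length q has been raised, so all listed legs have length suc q. With suc q as
  -- the new base the surplus of the inserted leg drops by two.
  insert-above (suc (suc e)) q i zero    = take-one (suc e) q i zero
    ⟫ᴱ perm (↭-reflexive (≡.cong₂ _∷_ (+-suc q e) (≡.cong (suc q ∷_) (++-identityʳ _))))
    ⟫ᴱ insert-above e (suc q) 0 i

  insert-below : ∀ d k i j → Even (k ∷ even (k ℕ.+ d) i j)
  insert-below zero k i j = perm (↭-reflexive (≡.cong (λ q → k ∷ even q i j) (ℕₚ.+-identityʳ k)))
    ⟫ᴱ (k , i , suc j , perm (↭-sym (even-take k i (suc j))))
  -- One of the longer legs gives a unit to the new leg. If there is none, as in the clauses below,
  -- a leg of the base length gives it, unless that length is suc k, when the list is even already.
  insert-below (suc d) k (suc i) j =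
    (perm (↭-swap _ _ ↭-refl) ⟫ move _ (m≤m+n k (suc d))
      ⟫ perm (↭-trans (↭-swap _ _ ↭-refl) (↭-prep _ (↭-sym (even-take (k ℕ.+ suc d) i (suc j)))))
      ⟫ perm (↭-reflexive (≡.cong (λ q → suc k ∷ even q i (suc j)) (+-suc k d))))
    ⟫ᴱ insert-below d (suc k) i (suc j)
  insert-below (suc zero) k zero j = k , suc j , 0 ,
    perm (↭-trans (↭-reflexive (≡.cong (λ q → k ∷ even q 0 j) (ℕₚ.+-comm k 1))) (↭-sym (↭-trans (even-take k (suc j) 0) (↭-prep k (↭-reflexive (++-identityʳ _))))))
  insert-below (suc (suc d)) k zero j =
    (perm (↭-trans (↭-reflexive (≡.cong (λ q → k ∷ even q 0 j) (+-suc k (suc d)))) (↭-swap _ _ ↭-refl))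
      ⟫ move _ (m≤m+n k (suc d))
      ⟫ perm (↭-trans (↭-swap _ _ ↭-refl)
          (↭-prep (suc k) (↭-sym (↭-trans (even-take (k ℕ.+ suc d) j 0) (↭-prep _ (↭-reflexive (++-identityʳ _)))))))
      ⟫ perm (↭-reflexive (≡.cong (λ q → suc k ∷ even q j 0) (+-suc k d))))
    ⟫ᴱ insert-below d (suc k) j 0

  insert : ∀ k q i j → Even (k ∷ even q i j)
  insert k q i j with ≤-total q k
  ... | inj₁ q≤k = ≡.subst (λ k → Even (k ∷ even q i j)) (ℕₚ.m+[n∸m]≡n q≤k) (insert-above (k ∸ q) q i j)
  ... | inj₂ k≤q = ≡.subst (λ q → Even (k ∷ even q i j)) (ℕₚ.m+[n∸m]≡n k≤q) (insert-below (q ∸ k) k i j)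

  sum-replicate : ∀ n q → sum (replicate n q) ≡ n ℕ.* q
  sum-replicate zero    q = ≡.refl
  sum-replicate (suc n) q = ≡.cong (q ℕ.+_) (sum-replicate n q)

  sum-even : ∀ q i j → sum (even q i j) ≡ i ℕ.+ q ℕ.* suc (i ℕ.+ j)
  sum-even q i j = ≡.trans (sum-++ (replicate i (suc q)) (replicate (suc j) q))
    (≡.trans (≡.cong₂ ℕ._+_ (sum-replicate i (suc q)) (sum-replicate (suc j) q)) (arith q i j))
    where arith : ∀ q i j → i ℕ.* suc q ℕ.+ suc j ℕ.* q ≡ i ℕ.+ q ℕ.* suc (i ℕ.+ j)
          arith = solve-∀

  length-even : ∀ q i j → length (even q i j) ≡ suc (i ℕ.+ j)
  length-even q i j = ≡.trans (length-++ (replicate i (suc q)))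
    (≡.trans (≡.cong₂ ℕ._+_ (length-replicate i) (length-replicate (suc j))) (+-suc i j))

  bstLengths-even : ∀ q i j → bstLengths (sum (even q i j)) (length (even q i j)) ≡ even q i j
  bstLengths-even q i j = ≡.trans (≡.cong₂ bstLengths (sum-even q i j) (length-even q i j))
    (≡.trans (≡.cong₂ (λ r d → replicate r (suc d) ++ replicate (suc (i ℕ.+ j) ∸ r) d) rem quot)
             (≡.cong (λ z → replicate i (suc q) ++ replicate z q) diff))
    where
    i< : i < suc (i ℕ.+ j)
    i< = s≤s (m≤m+n i j)
    rem : (i ℕ.+ q ℕ.* suc (i ℕ.+ j)) ℕ.% suc (i ℕ.+ j) ≡ i
    rem = ≡.trans (DivMod.[m+kn]%n≡m%n i q (suc (i ℕ.+ j))) (DivMod.m<n⇒m%n≡m i<)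
    quot : (i ℕ.+ q ℕ.* suc (i ℕ.+ j)) ℕ./ suc (i ℕ.+ j) ≡ q
    quot = ≡.trans (DivMod.+-distrib-/-∣ʳ i (n∣m*n q))
             (≡.cong₂ ℕ._+_ (DivMod.m<n⇒m/n≡0 i<) (DivMod.m*n/n≡m q (suc (i ℕ.+ j))))
    diff : suc (i ℕ.+ j) ∸ i ≡ suc j
    diff = ≡.trans (≡.cong (_∸ i) (≡.sym (+-suc i j))) (ℕₚ.m+n∸m≡n i (suc j))

-- As in an insertion sort, the tail is balanced first and one leg is then inserted. Sum and number
-- of legs are invariant, which identifies the even list that is reached.
balance : ∀ k ks → k ∷ ks ⇝ bstLengths (sum (k ∷ ks)) (length (k ∷ ks))
balance k ks with evenly k ks
  where
  evenly : ∀ k ks → Even (k ∷ ks)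
  evenly k []       = k , 0 , 0 , perm ↭-refl
  evenly k (l ∷ ks) with evenly l ks
  ... | q , i , j , r = keep k r ⟫ᴱ insert k q i j
... | q , i , j , r = ≡.subst (k ∷ ks ⇝_)
  (≡.sym (≡.trans (≡.cong₂ bstLengths (⇝-sum r) (⇝-length r)) (bstLengths-even q i j))) r

-- Minimality of the balanced spider

module Spiders (R : CommutativeRing 0ℓ 0ℓ) (C : PositiveCone R)
               (x : CommutativeRing.Carrier R) (Pos-x : PositiveCone.Pos C x) where
  open CommutativeRing R
  open PositiveCone C
  open Order R C
  open RootedPairs R C x Pos-x
  private module ⊗S = Algebra.Solver.CommutativeMonoid pairMonoid
  open ⊗S using (_⊜_; _⊕_)

  spider-↭ : ∀ {ks ls} → ks ↭ ls → spider ks ≋ spider ls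
  spider-↭ _↭_.refl = ⊗.refl
  spider-↭ (_↭_.prep k p) = ⊗.∙-congˡ {path k} (spider-↭ p)
  spider-↭ (_↭_.swap {xs} {ys} k l p) = ⊗.trans (⊗.∙-congˡ {path k} (⊗.∙-congˡ {path l} (spider-↭ p)))
    (⊗S.solve 3 (λ k l s → k ⊕ (l ⊕ s) ⊜ l ⊕ (k ⊕ s)) ⊗.refl (path k) (path l) (spider ys))
  spider-↭ (_↭_.trans p q) = ⊗.trans (spider-↭ p) (spider-↭ q)

  -- The context W has to be arbitrary for the induction, since `keep` moves a leg into it, and for
  -- the applications: W = `unit` yields the total, W = `grounded` the first component.
  ⇝-total : ∀ {ks ls} → ks ⇝ ls → ∀ W → PosPair W → total (W ⊗ spider ls) ⊑ total (W ⊗ spider ks)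
  ⇝-total (perm p) W pW = ⊑-reflexive (total-cong (⊗.∙-congˡ {W} (⊗.sym (spider-↭ p))))
  ⇝-total (move {p} {q} ks q≤p) W pW = ⊑-resp
    (total-cong (⊗S.solve 4 (λ p q W s → (p ⊕ (W ⊕ s)) ⊕ q ⊜ W ⊕ (p ⊕ (q ⊕ s))) ⊗.refl (path p) (plant (path q)) W (spider ks)))
    (trans (reroot (path p) _)
      (total-cong (⊗S.solve 4 (λ p q W s → p ⊕ (q ⊕ (W ⊕ s)) ⊜ W ⊕ (p ⊕ (q ⊕ s))) ⊗.refl (plant (path p)) (path q) W (spider ks))))
    -- The two legs form one path. Instead of a unit changing legs, the rest of the graph slides
    -- along this path by one edge, into the longer leg.
    (shift (path p) (path q) (W ⊗ spider ks) (PosPair-⊗ pW (PosPair-spider ks)) (path-≽ p q q≤p))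
  ⇝-total {k ∷ ks} {k ∷ ls} (keep k r) W pW = ⊑-resp (total-cong (⊗.assoc W (path k) (spider ls))) (total-cong (⊗.assoc W (path k) (spider ks)))
    (⇝-total r (W ⊗ path k) (PosPair-⊗ pW (PosPair-path k)))
  ⇝-total (r ⟫ r') W pW = ⊑-trans (⇝-total r' W pW) (⇝-total r W pW)

  bst : ℕ → ℕ → Pair
  bst m ℓ = spider (bstLengths m ℓ)

  bst-minimal : ∀ W → PosPair W → ∀ k ks → total (W ⊗ bst (sum (k ∷ ks)) (length (k ∷ ks))) ⊑ total (W ⊗ spider (k ∷ ks))
  bst-minimal W pW k ks = ⇝-total (balance k ks) W pW

  private
    total-grounded : ∀ X → total (grounded ⊗ X) ≈ proj₁ X
    total-grounded (b , c) = solve 3 (λ x b c → x :* (:0 :* b) :+ (:1 :* b :+ :0 :* c) := b) refl x b c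
      where open IntegerSolver R

  module _ (T S : Tree) (nT : Nontrivial T) (nS : Nontrivial S) where
    private
      m = size T ℕ.+ size S
      ℓ = rootedLeaves T ℕ.+ rootedLeaves S

    -- A total prescribes no root, so `recentre` may look for one. It wants its first argument at
    -- most one higher than its second, which is why T and S may be exchanged.
    bst-total : total (bst m ℓ) ⊑ total (pair T ⊗ pair S)
    bst-total = finish below
      where
      below : SpiderBelow (pair T ⊗ pair S) ℓ m
      below with ≤-total (height T) (height S)
      ... | inj₁ T≤S = recentre T S nT nS (≤-trans T≤S (n≤1+n _))
      ... | inj₂ S≤T = SpiderBelow-resp (total-cong (⊗.comm (pair S) (pair T)))
            (ℕₚ.+-comm (rootedLeaves S) (rootedLeaves T)) (ℕₚ.+-comm (size S) (size T))
            (recentre S T nS nT (≤-trans S≤T (n≤1+n _)))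
      finish : ∀ {ℓ m} → SpiderBelow (pair T ⊗ pair S) ℓ m → total (bst m ℓ) ⊑ total (pair T ⊗ pair S)
      finish (spiderBelow [] ≡.refl ≡.refl b) = b
      finish (spiderBelow (k ∷ ks) ≡.refl ≡.refl b) = ⊑-trans
        (⊑-resp (total-cong (⊗.identityˡ _)) (total-cong (⊗.identityˡ _)) (bst-minimal unit PosPair-unit k ks)) b

    -- Here the root is fixed. The context `grounded` dominates every path, so T and S can be
    -- flattened where they hang.
    bst-reduced : proj₁ (bst m ℓ) ⊑ proj₁ (pair T ⊗ pair S)
    bst-reduced = ⊑-trans
      (≡.subst₂ (λ m ℓ → proj₁ (bst m ℓ) ⊑ proj₁ (legSpider (T ⊙ S)))
        (≡.trans (sum-legs (T ⊙ S)) (size-⊙ T S))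
        (≡.trans (length-legs (T ⊙ S)) (≡.trans (leaves≡rootedLeaves (T ⊙ S) (Nontrivial-⊙ T S nT)) (rootedLeaves-⊙ T S)))
        (⊑-resp (total-grounded _) (total-grounded _)
          (bst-minimal grounded PosPair-grounded (proj₁ (legs (T ⊙ S))) (proj₂ (legs (T ⊙ S))))))
      (⊑-resp (total-grounded _) (trans (total-grounded _) (proj₁ (pair-⊙ T S)))
        (flatten (T ⊙ S) grounded PosPair-grounded (λ k _ → grounded-≽ (PosPair-path k))))

-- Graphs built from a core by attaching vertices one at a time

bit : Bool → ℕ
bit b = if b then 1 else 0

children : Tree → ℕ
children pt      = 0
children (t ◃ s) = suc (children s)

isOne : ℕ → ℕ
isOne k = bit (k ℕ.≡ᵇ 1)

∈-split : {V : Set} {w : V} {vs : List V} → Unique vs → w ∈ vs →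
  ∃ λ us → (vs ↭ w ∷ us) × All (w ≢_) us × Unique us
∈-split (w∉ ∷ uniq) (here ≡.refl) = _ , ↭-refl , w∉ , uniq
∈-split {w = w} {v ∷ vs} (v∉ ∷ uniq) (there w∈) with ∈-split uniq w∈
... | us , p , w∉us , uniq' with Perm.All-resp-↭ p v∉
...   | v≢w ∷ v∉us = v ∷ us , ↭-trans (↭-prep v p) (↭-swap v w ↭-refl) ,
                     (λ w≡v → v≢w (≡.sym w≡v)) ∷ w∉us , v∉us ∷ uniq'

module Attachments {V : Set} (_≟_ : DecidableEquality V) where

  -- An edge (w , v) of L attaches the new vertex v to the present vertex w.
  data Attach : List V → List (V × V) → Set where
    done   : ∀ {vs} → Attach vs []
    attach : ∀ {vs w v L} → w ∈ vs → All (v ≢_) vs → Attach (v ∷ vs) L → Attach vs ((w , v) ∷ L)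

  Within : List V → List (V × V) → Set
  Within vs E = All (λ e → (proj₁ e ∈ vs) × (proj₂ e ∈ vs)) E

  Avoids : V → List (V × V) → Set
  Avoids v E = All (λ e → (v ≢ proj₁ e) × (v ≢ proj₂ e)) E

  avoids : ∀ {vs E v} → All (v ≢_) vs → Within vs E → Avoids v E
  avoids v∉ = All.map (λ { (p , q) → All.lookup v∉ p , All.lookup v∉ q })

  within-attach : ∀ {vs E w v} → w ∈ vs → Within vs E → Within (v ∷ vs) ((w , v) ∷ E)
  within-attach w∈ W = (there w∈ , here ≡.refl) ∷ All.map (λ { (p , q) → there p , there q }) W

  -- `forest` folds from the last attachment, so τ v already holds all that is attached at v later
  -- and can be hung below w as a whole.
  graftAt : V × V → (V → Tree) → V → Tree
  graftAt (w , v) τ u = if does (u ≟ w) then τ v ◃ τ u else τ u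

  graft : ∀ w v τ → graftAt (w , v) τ w ≡ τ v ◃ τ w
  graft w v τ = ≡.cong (λ b → if b then τ v ◃ τ w else τ w) (dec-true (w ≟ w) ≡.refl)

  graft-other : ∀ w v τ u → u ≢ w → graftAt (w , v) τ u ≡ τ u
  graft-other w v τ u u≢w = ≡.cong (λ b → if b then τ v ◃ τ u else τ u) (dec-false (u ≟ w) u≢w)

  -- The trees hanging at the initial vertices after all attachments.
  forest : List (V × V) → V → Tree
  forest = foldr graftAt (const pt)

  -- Reversed append agrees with `Attach`, which puts each new vertex in front of the present ones;
  -- inductions over attachments then match by computation.
  vertices : List (V × V) → List V → List V
  vertices L vs = map proj₂ L ʳ++ vs

  forest-cases : ∀ L u → forest L u ≡ pt ⊎ (∃ λ y → (u , y) ∈ L)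
  forest-cases [] u = inj₁ ≡.refl
  forest-cases ((w , v) ∷ L) u with u ≟ w | forest-cases L u
  ... | yes ≡.refl | _             = inj₂ (v , here ≡.refl)
  ... | no _       | inj₁ e        = inj₁ e
  ... | no _       | inj₂ (y , y∈) = inj₂ (y , there y∈)

  forest-nontrivial : ∀ L u y → (u , y) ∈ L → Nontrivial (forest L u)
  forest-nontrivial ((w , v) ∷ L) u y u∈ with u ≟ w
  forest-nontrivial ((w , v) ∷ L) u y u∈             | yes _ = tt
  forest-nontrivial ((w , v) ∷ L) u y (here ≡.refl)  | no u≢u = ⊥-elim (u≢u ≡.refl)
  forest-nontrivial ((w , v) ∷ L) u y (there u∈)     | no _ = forest-nontrivial L u y u∈

  ≟-refl : ∀ v → does (v ≟ v) ≡ true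
  ≟-refl v = dec-true (v ≟ v) ≡.refl

  ≟-≢ : ∀ {u v} → u ≢ v → does (u ≟ v) ≡ false
  ≟-≢ {u} {v} = dec-false (u ≟ v)

  incidence : V → V × V → ℕ
  incidence u (p , q) = bit (does (u ≟ p)) ℕ.+ bit (does (u ≟ q))

  degree : List (V × V) → V → ℕ
  degree []      u = 0
  degree (e ∷ E) u = incidence u e ℕ.+ degree E u

  degree-avoids : ∀ {E v} → Avoids v E → degree E v ≡ 0
  degree-avoids [] = ≡.refl
  degree-avoids ((v≢p , v≢q) ∷ av) rewrite ≟-≢ v≢p | ≟-≢ v≢q = degree-avoids av

  -- The leaves that u contributes together with the tree hanging at it, where u may be a leaf
  -- itself. Summed over the vertices, this is invariant when a pendant vertex is absorbed into the
  -- tree of its neighbour.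
  vertexLeaves : List (V × V) → (V → Tree) → V → ℕ
  vertexLeaves E τ u = isOne (degree E u ℕ.+ children (τ u)) ℕ.+ rootedLeaves (τ u)

  private
    sum-map-cong : ∀ {f g : V → ℕ} {us} → All (λ u → f u ≡ g u) us → sum (map f us) ≡ sum (map g us)
    sum-map-cong []       = ≡.refl
    sum-map-cong (e ∷ es) = ≡.cong₂ ℕ._+_ e (sum-map-cong es)

    sum-map-↭ : ∀ (f : V → ℕ) {us vs} → us ↭ vs → sum (map f us) ≡ sum (map f vs)
    sum-map-↭ f p = sum-↭ (Perm.map⁺ f p)

    module Step {w v : V} {us : List V} (w∉ : All (w ≢_) us) (v∉ : All (v ≢_) (w ∷ us))
                {E : List (V × V)} (av : Avoids v E) (τ : V → Tree) where
      open ≡.≡-Reasoning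
      τ' = graftAt (w , v) τ

      -- Having a single edge outside its tree, v is a leaf exactly when nothing hangs at it; hence
      -- the value 1 of `leaves pt`.
      vertexLeaves-v : vertexLeaves ((w , v) ∷ E) τ v ≡ leaves (τ v)
      vertexLeaves-v rewrite ≟-≢ (All.head v∉) | ≟-refl v | degree-avoids av with τ v
      ... | pt    = ≡.refl
      ... | t ◃ s = ≡.refl

      vertexLeaves-w : leaves (τ v) ℕ.+ vertexLeaves ((w , v) ∷ E) τ w ≡ vertexLeaves E τ' w
      vertexLeaves-w rewrite graft w v τ | ≟-refl w | ≟-≢ (λ w≡v → All.head v∉ (≡.sym w≡v)) =
        ≡.trans (swap₁ (leaves (τ v)) (isOne (suc (degree E w ℕ.+ children (τ w)))) (rootedLeaves (τ w)))
          (≡.cong (λ k → isOne k ℕ.+ (leaves (τ v) ℕ.+ rootedLeaves (τ w))) (≡.sym (+-suc (degree E w) (children (τ w)))))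
        where swap₁ : ∀ a b c → a ℕ.+ (b ℕ.+ c) ≡ b ℕ.+ (a ℕ.+ c)
              swap₁ = solve-∀

      vertexLeaves-u : ∀ {u} → w ≢ u → v ≢ u → vertexLeaves ((w , v) ∷ E) τ u ≡ vertexLeaves E τ' u
      vertexLeaves-u {u} w≢u v≢u
        rewrite graft-other w v τ u (λ u≡w → w≢u (≡.sym u≡w))
              | ≟-≢ (λ u≡w → w≢u (≡.sym u≡w)) | ≟-≢ (λ u≡v → v≢u (≡.sym u≡v)) = ≡.refl

      leaves-step : sum (map (vertexLeaves ((w , v) ∷ E) τ) (v ∷ w ∷ us)) ≡ sum (map (vertexLeaves E τ') (w ∷ us))
      leaves-step = begin
        f v ℕ.+ (f w ℕ.+ sum (map f us))             ≡⟨ ≡.sym (ℕₚ.+-assoc (f v) (f w) _) ⟩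
        f v ℕ.+ f w ℕ.+ sum (map f us)               ≡⟨ ≡.cong (λ k → k ℕ.+ f w ℕ.+ sum (map f us)) vertexLeaves-v ⟩
        leaves (τ v) ℕ.+ f w ℕ.+ sum (map f us)      ≡⟨ ≡.cong₂ ℕ._+_ vertexLeaves-w
                                                         (sum-map-cong (All.zipWith (λ { (p , q) → vertexLeaves-u p q }) (w∉ , All.tail v∉))) ⟩
        sum (map (vertexLeaves E τ') (w ∷ us))       ∎
        where f = vertexLeaves ((w , v) ∷ E) τ

      size-step : sum (map (suc ∘ size ∘ τ) (v ∷ w ∷ us)) ≡ sum (map (suc ∘ size ∘ τ') (w ∷ us))
      size-step = ≡.trans (arith (size (τ v)) (size (τ w)) (sum (map (suc ∘ size ∘ τ) us)))
        (≡.cong₂ (λ t k → suc (size t) ℕ.+ k) (≡.sym (graft w v τ))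
          (sum-map-cong (All.map (λ {u} w≢u → ≡.cong (suc ∘ size) (≡.sym (graft-other w v τ u (λ u≡w → w≢u (≡.sym u≡w))))) w∉)))
        where arith : ∀ a b k → suc a ℕ.+ (suc b ℕ.+ k) ≡ suc (suc (a ℕ.+ b)) ℕ.+ k
              arith = solve-∀

  leaves-pruned : ∀ {vs E L} → Unique vs → Within vs E → Attach vs L →
    sum (map (vertexLeaves (L ʳ++ E) (const pt)) (vertices L vs)) ≡ sum (map (vertexLeaves E (forest L)) vs)
  leaves-pruned uniq W done = ≡.refl
  leaves-pruned {vs} {E} {(w , v) ∷ L} uniq W (attach w∈ v∉ A) with ∈-split uniq w∈
  ... | us , p , w∉ , _ = begin
    _ ≡⟨ leaves-pruned (v∉ ∷ uniq) (within-attach w∈ W) A ⟩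
    sum (map (vertexLeaves ((w , v) ∷ E) (forest L)) (v ∷ vs))     ≡⟨ sum-map-↭ _ (↭-prep v p) ⟩
    sum (map (vertexLeaves ((w , v) ∷ E) (forest L)) (v ∷ w ∷ us)) ≡⟨ Step.leaves-step w∉ (Perm.All-resp-↭ p v∉) (avoids v∉ W) (forest L) ⟩
    sum (map (vertexLeaves E (forest ((w , v) ∷ L))) (w ∷ us))     ≡⟨ sum-map-↭ _ (↭-sym p) ⟩
    sum (map (vertexLeaves E (forest ((w , v) ∷ L))) vs)           ∎
    where open ≡.≡-Reasoning

  size-pruned : ∀ {vs L} → Unique vs → Attach vs L →
    length (vertices L vs) ≡ sum (map (suc ∘ size ∘ forest L) vs)
  size-pruned {vs} uniq done = length-as-sum vs
    where length-as-sum : ∀ vs → length vs ≡ sum (map (suc ∘ size ∘ const pt) vs)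
          length-as-sum []       = ≡.refl
          length-as-sum (_ ∷ vs) = ≡.cong suc (length-as-sum vs)
  size-pruned {vs} {(w , v) ∷ L} uniq (attach w∈ v∉ A) with ∈-split uniq w∈
  ... | us , p , w∉ , _ = begin
    _ ≡⟨ size-pruned (v∉ ∷ uniq) A ⟩
    sum (map (suc ∘ size ∘ forest L) (v ∷ vs))                ≡⟨ sum-map-↭ (suc ∘ size ∘ forest L) (↭-prep v p) ⟩
    sum (map (suc ∘ size ∘ forest L) (v ∷ w ∷ us))            ≡⟨ Step.size-step w∉ (Perm.All-resp-↭ p v∉) {[]} [] (forest L) ⟩
    sum (map (suc ∘ size ∘ forest ((w , v) ∷ L)) (w ∷ us))    ≡⟨ sum-map-↭ (suc ∘ size ∘ forest ((w , v) ∷ L)) (↭-sym p) ⟩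
    sum (map (suc ∘ size ∘ forest ((w , v) ∷ L)) vs)          ∎
    where open ≡.≡-Reasoning

-- Pruning pendant vertices in the determinant

module WeightedLaplacian (R : CommutativeRing 0ℓ 0ℓ) (C : PositiveCone R)
    (x : CommutativeRing.Carrier R) (Pos-x : PositiveCone.Pos C x)
    {V : Set} (_≟_ : DecidableEquality V) where
  open CommutativeRing R
  open Relation.Binary.Reasoning.Setoid setoid
  open IntegerSolver R
  open Determinant R {V}
  open RootedPairs R C x Pos-x
  open Attachments _≟_

  δ : V → V → Carrier
  δ u v = if does (u ≟ v) then 1# else 0#

  δ-refl : ∀ u → δ u u ≈ 1#
  δ-refl u = reflexive (≡.cong (if_then 1# else 0#) (≟-refl u))

  δ-≢ : ∀ {u v} → u ≢ v → δ u v ≈ 0#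
  δ-≢ u≢v = reflexive (≡.cong (if_then 1# else 0#) (≟-≢ u≢v))

  δ-sym : ∀ u v → δ u v ≈ δ v u
  δ-sym u v with u ≟ v
  ... | yes ≡.refl = sym (δ-refl u)
  ... | no u≢v     = sym (δ-≢ (λ v≡u → u≢v (≡.sym v≡u)))

  -- The rank-one matrix of one edge. Summing these treats degrees and adjacency at once, and a
  -- vertex off the edge has a zero row and a zero column.
  edgeLaplacian : V × V → V → V → Carrier
  edgeLaplacian (p , q) u v = (δ u p - δ u q) * (δ v p - δ v q)

  laplacian : List (V × V) → V → V → Carrier
  laplacian []      u v = 0#
  laplacian (e ∷ E) u v = edgeLaplacian e u v + laplacian E u v

  laplacian-sym : ∀ E u v → laplacian E u v ≈ laplacian E v u
  laplacian-sym []      u v = refl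
  laplacian-sym (e ∷ E) u v = +-cong (*-comm _ _) (laplacian-sym E u v)

  -- The matrix x I + L(E), each row u rescaled by the first component of X u
  -- so that the pair of a tree rooted at u enters polynomially.
  weighted : List (V × V) → (V → Pair) → V → V → Carrier
  weighted E X u v = proj₁ (X u) * (x * δ u v + laplacian E u v) + proj₂ (X u) * δ u v

  weighted-congX : ∀ {E X Y u} v → X u ≋ Y u → weighted E X u v ≈ weighted E Y u v
  weighted-congX v (p , q) = +-cong (*-congʳ p) (*-congʳ q)

  laplacian-avoids : ∀ {E v} → Avoids v E → ∀ u → laplacian E v u ≈ 0#
  laplacian-avoids [] u = refl
  laplacian-avoids {(p , q) ∷ E} {v} ((v≢p , v≢q) ∷ av) u = begin
    (δ v p - δ v q) * (δ u p - δ u q) + laplacian E v u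
      ≈⟨ +-cong (*-congʳ (+-cong (δ-≢ v≢p) (-‿cong (δ-≢ v≢q)))) (laplacian-avoids av u) ⟩
    (0# - 0#) * (δ u p - δ u q) + 0#
      ≈⟨ solve 1 (λ a → (:0 :- :0) :* a :+ :0 := :0) refl _ ⟩
    0# ∎

  expand-δ : ∀ w F us → All (w ≢_) us → expand (δ w) F (w ∷ us) ≈ F us
  expand-δ w F us w∉ = begin
    δ w w * F us - expand (δ w) (λ ds → F (w ∷ ds)) us
      ≈⟨ +-cong (*-congʳ (δ-refl w)) (-‿cong (expand-zeroρ _ us (All.map δ-≢ w∉))) ⟩
    1# * F us - 0# ≈⟨ solve 1 (λ a → :1 :* a :- :0 := a) refl _ ⟩
    F us ∎

  minor-row-congʳ : ∀ {m m'} rs → All (λ r → ∀ c → m r c ≈ m' r c) rs → ∀ cs → minor m rs cs ≈ minor m' rs cs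
  minor-row-congʳ rs rows cs = minor-cong (const ⊤) rs (All.map (λ h c _ → h c) rows) cs (All.universal _ cs)

  module _ {w v : V} {us : List V} (w∉ : All (w ≢_) us) (v∉ : All (v ≢_) (w ∷ us))
           {E : List (V × V)} (av : Avoids v E) (X X' : V → Pair)
           (X'w : X' w ≋ plant (X v) ⊗ X w) (X'u : All (λ u → X' u ≋ X u) us) where
    private
      M  = weighted ((w , v) ∷ E) X
      M' = weighted E X'
      bv = proj₁ (X v)
      cv = proj₂ (X v)
      bw = proj₁ (X w)
      cw = proj₂ (X w)
      P = (1# + x) * bv + cv
      v≢w = All.head v∉
      w≢v = λ w≡v → v≢w (≡.sym w≡v)

      lapcong : ∀ {c c' e e' f f' g g' h h' l l' b d} → c ≈ c' → e ≈ e' → f ≈ f' → g ≈ g' → h ≈ h' → l ≈ l' →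
        b * (x * c + ((e - f) * (g - h) + l)) + d * c ≈ b * (x * c' + ((e' - f') * (g' - h') + l')) + d * c'
      lapcong pc pe pf pg ph pl = +-cong (*-congˡ (+-cong (*-congˡ pc) (+-cong (*-cong (+-cong pe (-‿cong pf)) (+-cong pg (-‿cong ph))) pl))) (*-congˡ pc)

      Mvv : M v v ≈ P
      Mvv = trans (lapcong (δ-refl v) (δ-≢ v≢w) (δ-refl v) (δ-≢ v≢w) (δ-refl v) (laplacian-avoids av v))
        (solve 3 (λ x b c → b :* (x :* :1 :+ ((:0 :- :1) :* (:0 :- :1) :+ :0)) :+ c :* :1 := (:1 :+ x) :* b :+ c) refl x bv cv)

      Mvw : M v w ≈ - bv
      Mvw = trans (lapcong (δ-≢ v≢w) (δ-≢ v≢w) (δ-refl v) (δ-refl w) (δ-≢ w≢v) (laplacian-avoids av w))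
        (solve 3 (λ x b c → b :* (x :* :0 :+ ((:0 :- :1) :* (:1 :- :0) :+ :0)) :+ c :* :0 := :- b) refl x bv cv)

      Mwv : M w v ≈ - bw
      Mwv = trans (lapcong (δ-≢ w≢v) (δ-refl w) (δ-≢ w≢v) (δ-≢ v≢w) (δ-refl v) (trans (laplacian-sym E w v) (laplacian-avoids av w)))
        (solve 3 (λ x b c → b :* (x :* :0 :+ ((:1 :- :0) :* (:0 :- :1) :+ :0)) :+ c :* :0 := :- b) refl x bw cw)

      Mvu : ∀ {u} → w ≢ u → v ≢ u → M v u ≈ 0#
      Mvu {u} w≢u v≢u = trans (lapcong (δ-≢ v≢u) refl refl (δ-≢ (λ e → w≢u (≡.sym e))) (δ-≢ (λ e → v≢u (≡.sym e))) (laplacian-avoids av u))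
        (solve 5 (λ x b c e f → b :* (x :* :0 :+ ((e :- f) :* (:0 :- :0) :+ :0)) :+ c :* :0 := :0) refl x bv cv _ _)

      Muv : ∀ {u} → w ≢ u → v ≢ u → M u v ≈ 0#
      Muv {u} w≢u v≢u = trans (lapcong (δ-≢ (λ e → v≢u (≡.sym e))) (δ-≢ (λ e → w≢u (≡.sym e))) (δ-≢ (λ e → v≢u (≡.sym e))) refl refl
                                 (trans (laplacian-sym E u v) (laplacian-avoids av u)))
        (solve 5 (λ x b c e f → b :* (x :* :0 :+ ((:0 :- :0) :* (e :- f) :+ :0)) :+ c :* :0 := :0) refl x (proj₁ (X u)) (proj₂ (X u)) _ _)

      rows : All (λ u → ∀ c → M' u c ≈ M u c) us
      rows = All.zipWith (λ { {u} (X'u , w≢u , v≢u) c → trans (weighted-congX {E} {X'} {X} {u} c X'u)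
          (sym (trans (lapcong refl (δ-≢ (λ e → w≢u (≡.sym e))) (δ-≢ (λ e → v≢u (≡.sym e))) refl refl refl)
            (solve 7 (λ x b c d e f l → b :* (x :* d :+ ((:0 :- :0) :* (e :- f) :+ l)) :+ c :* d := b :* (x :* d :+ l) :+ c :* d)
              refl x (proj₁ (X u)) (proj₂ (X u)) (δ u c) _ _ (laplacian E u c)))) })
        (X'u , All.zip (w∉ , All.tail v∉))

      -- The coefficients are those of the pendant expansion: P goes with the minor that keeps w,
      -- and - (bv * bw) with the minor in which the unit row `δ w` deletes w.
      rowW : ∀ c → v ≢ c → M' w c ≈ P * M w c + - (bv * bw) * δ w c
      rowW c v≢c = begin
        M' w c ≈⟨ +-cong (*-congʳ (proj₁ X'w)) (*-congʳ (proj₂ X'w)) ⟩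
        P * bw * (x * δ w c + l) + ((x * bv + cv) * bw + P * cw) * δ w c
          ≈⟨ solve 7 (λ x b c b' c' d l →
               ((:1 :+ x) :* b :+ c) :* b' :* (x :* d :+ l) :+ ((x :* b :+ c) :* b' :+ ((:1 :+ x) :* b :+ c) :* c') :* d
               := ((:1 :+ x) :* b :+ c) :* (b' :* (x :* d :+ ((:1 :- :0) :* (d :- :0) :+ l)) :+ c' :* d) :+ :- (b :* b') :* d)
               refl x bv cv bw cw (δ w c) l ⟩
        P * (bw * (x * δ w c + ((1# - 0#) * (δ w c - 0#) + l)) + cw * δ w c) + - (bv * bw) * δ w c
          ≈⟨ +-congʳ (*-congˡ (lapcong refl (δ-refl w) (δ-≢ w≢v) (δ-sym c w) (δ-≢ (λ e → v≢c (≡.sym e))) refl)) ⟨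
        P * M w c + - (bv * bw) * δ w c ∎
        where l = laplacian E w c

    -- This eliminates the pendant vertex v. A Schur complement would divide by the entry P at v;
    -- scaling the row of w by P instead turns its factor into the first component of
    -- `plant (X v) ⊗ X w`.
    minor-prune : minor M (v ∷ w ∷ us) (v ∷ w ∷ us) ≈ minor M' (w ∷ us) (w ∷ us)
    minor-prune = begin
      minor M (v ∷ w ∷ us) (v ∷ w ∷ us)
        ≈⟨ minor-pendant M v w us (All.zipWith (λ { (p , q) → Muv p q }) (w∉ , All.tail v∉))
                                  (All.zipWith (λ { (p , q) → Mvu p q }) (w∉ , All.tail v∉)) ⟩
      M v v * minor M (w ∷ us) (w ∷ us) - M v w * M w v * minor M us us
        ≈⟨ +-cong (*-congʳ Mvv) (-‿cong (*-congʳ (*-cong Mvw Mwv))) ⟩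
      P * minor M (w ∷ us) (w ∷ us) - (- bv) * (- bw) * minor M us us
        ≈⟨ solve 5 (λ p m b b' n → p :* m :- (:- b) :* (:- b') :* n := p :* m :+ :- (b :* b') :* n) refl P _ bv bw _ ⟩
      P * minor M (w ∷ us) (w ∷ us) + - (bv * bw) * minor M us us
        ≈⟨ +-congˡ (*-congˡ (expand-δ w (minor M us) us w∉)) ⟨
      P * expand (M w) (minor M us) (w ∷ us) + - (bv * bw) * expand (δ w) (minor M us) (w ∷ us)
        ≈⟨ expand-linearρ P (- (bv * bw)) (minor M us) (w ∷ us) (All.map (λ {c} → rowW c) v∉) ⟨
      expand (M' w) (minor M us) (w ∷ us)
        ≈⟨ expand-congF (M' w) (minor-row-congʳ us rows) (w ∷ us) ⟨
      expand (M' w) (minor M' us) (w ∷ us) ∎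

  -- The induction prunes the last attached vertex first. When the turn of v comes, all that was
  -- attached below it is already recorded in its pair, and v is pendant.
  determinant-pruned : ∀ {vs E L} → Unique vs → Within vs E → Attach vs L →
    minor (weighted (L ʳ++ E) (const unit)) (vertices L vs) (vertices L vs) ≈ minor (weighted E (pair ∘ forest L)) vs vs
  determinant-pruned uniq W done = refl
  determinant-pruned {vs} {E} {(w , v) ∷ L} uniq W (attach w∈ v∉ A) with ∈-split uniq w∈
  ... | us , p , w∉ , _ = begin
    _ ≈⟨ determinant-pruned (v∉ ∷ uniq) (within-attach w∈ W) A ⟩
    minor M (v ∷ vs) (v ∷ vs)             ≈⟨ principal-↭ M (↭-prep v p) ⟩
    minor M (v ∷ w ∷ us) (v ∷ w ∷ us)
      ≈⟨ minor-prune w∉ (Perm.All-resp-↭ p v∉) (avoids v∉ W) (pair ∘ forest L) (pair ∘ forest ((w , v) ∷ L))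
           (⊗.reflexive (≡.cong pair (graft w v (forest L))))
           (All.map (λ {u} w≢u → ⊗.reflexive (≡.cong pair (graft-other w v (forest L) u (λ u≡w → w≢u (≡.sym u≡w))))) w∉) ⟩
    minor M' (w ∷ us) (w ∷ us)            ≈⟨ principal-↭ M' (↭-sym p) ⟩
    minor M' vs vs ∎
    where M  = weighted ((w , v) ∷ E) (pair ∘ forest L)
          M' = weighted E (pair ∘ forest ((w , v) ∷ L))

-- The bare cycle and its principal minors

upFrom : ℕ → ℕ → List ℕ
upFrom s zero    = []
upFrom s (suc k) = s ∷ upFrom (suc s) k

upFrom-++ : ∀ s m n → upFrom s (m ℕ.+ n) ≡ upFrom s m ++ upFrom (s ℕ.+ m) n
upFrom-++ s zero    n = ≡.cong (λ z → upFrom z n) (≡.sym (ℕₚ.+-identityʳ s))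
upFrom-++ s (suc m) n = ≡.cong (s ∷_) (≡.trans (upFrom-++ (suc s) m n)
  (≡.cong (λ z → upFrom (suc s) m ++ upFrom z n) (≡.sym (+-suc s m))))

length-upFrom : ∀ s k → length (upFrom s k) ≡ k
length-upFrom s zero    = ≡.refl
length-upFrom s (suc k) = ≡.cong suc (length-upFrom (suc s) k)

All-upFrom : ∀ {P : ℕ → Set} s k → (∀ z → s ≤ z → z < s ℕ.+ k → P z) → All P (upFrom s k)
All-upFrom s zero    h = []
All-upFrom s (suc k) h = h s ≤-refl (m<m+n s (s≤s z≤n)) ∷
  All-upFrom (suc s) k (λ z s<z z< → h z (<⇒≤ s<z) (≡.subst (z <_) (≡.sym (+-suc s k)) z<))

cycleEdges : ℕ → List (ℕ × ℕ)
cycleEdges q = (q , 0) ∷ cycleEdgesFrom 0 q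

module CycleDeterminant (R : CommutativeRing 0ℓ 0ℓ) (C : PositiveCone R)
    (x : CommutativeRing.Carrier R) (Pos-x : PositiveCone.Pos C x) where
  open CommutativeRing R
  open Algebra.Properties.Ring ring
  open Relation.Binary.Reasoning.Setoid setoid
  open IntegerSolver R
  open PositiveCone C
  open Order R C
  open RootedPairs R C x Pos-x
  open Determinant R {ℕ}
  open WeightedLaplacian R C x Pos-x ℕₚ._≟_

  diagonal : Carrier
  diagonal = x + (1# + 1#)

  firstRow : ℕ → Carrier
  firstRow zero          = diagonal
  firstRow (suc zero)    = - 1#
  firstRow (suc (suc _)) = 0#

  -- x I + L for the two-way infinite path
  tri : ℕ → ℕ → Carrier
  tri zero    j       = firstRow j
  tri (suc i) zero    = firstRow (suc i)
  tri (suc i) (suc j) = tri i j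

  tri-diagonal : ∀ s → tri s s ≈ diagonal
  tri-diagonal zero    = refl
  tri-diagonal (suc s) = tri-diagonal s

  tri-above : ∀ s → tri s (suc s) ≈ - 1#
  tri-above zero    = refl
  tri-above (suc s) = tri-above s

  tri-below : ∀ s → tri (suc s) s ≈ - 1#
  tri-below zero    = refl
  tri-below (suc s) = tri-below s

  tri-farʳ : ∀ s z → suc (suc s) ≤ z → tri s z ≈ 0#
  tri-farʳ zero    (suc (suc z)) _       = refl
  tri-farʳ zero    (suc zero)    (s≤s ())
  tri-farʳ (suc s) (suc z)       (s≤s p) = tri-farʳ s z p

  tri-farˡ : ∀ s z → suc (suc s) ≤ z → tri z s ≈ 0#
  tri-farˡ zero    (suc (suc z)) _       = refl
  tri-farˡ zero    (suc zero)    (s≤s ())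
  tri-farˡ (suc s) (suc z)       (s≤s p) = tri-farˡ s z p

  -- The Chebyshev polynomials of the second kind at 1 + x / 2.
  pathMinor : ℕ → Carrier
  pathMinor zero          = 1#
  pathMinor (suc zero)    = diagonal
  pathMinor (suc (suc k)) = diagonal * pathMinor (suc k) - pathMinor k

  Zero Linked : (ℕ → ℕ → Carrier) → ℕ → List ℕ → Set
  Zero m a l = All (λ z → (m a z ≈ 0#) × (m z a ≈ 0#)) l
  Linked m a []      = ⊤
  Linked m a (b ∷ l) = (m a b ≈ - 1#) × (m b a ≈ - 1#) × Zero m a l

  -- Neighbours are read off the list and not off the numbers, so a cycle cut at an interior vertex
  -- is recognised as a path once its vertices are listed from one side of the cut round to the
  -- other.
  data Chain (m : ℕ → ℕ → Carrier) : List ℕ → Set where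
    []   : Chain m []
    link : ∀ {a l} → m a a ≈ diagonal → Linked m a l → Chain m l → Chain m (a ∷ l)

  chain-minor : ∀ {m l} → Chain m l → minor m l l ≈ pathMinor (length l)
  chain-minor [] = refl
  chain-minor {m} {a ∷ []} (link d _ []) = begin
    m a a * 1# - 0# ≈⟨ +-congʳ (*-congʳ d) ⟩
    diagonal * 1# - 0# ≈⟨ solve 1 (λ d → d :* :1 :- :0 := d) refl diagonal ⟩
    diagonal ∎
  chain-minor {m} {a ∷ b ∷ l} (link d (ab , ba , zs) ch@(link _ _ ch')) = begin
    minor m (a ∷ b ∷ l) (a ∷ b ∷ l) ≈⟨ minor-pendant m a b l (All.map proj₂ zs) (All.map proj₁ zs) ⟩
    m a a * minor m (b ∷ l) (b ∷ l) - m a b * m b a * minor m l l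
      ≈⟨ +-cong (*-cong d (chain-minor ch)) (-‿cong (*-cong (*-cong ab ba) (chain-minor ch'))) ⟩
    diagonal * pathMinor (suc (length l)) - (- 1#) * (- 1#) * pathMinor (length l)
      ≈⟨ solve 2 (λ a b → a :- (:- :1) :* (:- :1) :* b := a :- b) refl _ _ ⟩
    diagonal * pathMinor (suc (length l)) - pathMinor (length l) ∎

  -- The tail is meant for the cut cycle, where the segment ending at q is continued through the
  -- closing edge by a segment starting at 0.
  segment-chain : ∀ m k s tail →
    (∀ a b → s ≤ a → a ≤ s ℕ.+ k → s ≤ b → b ≤ s ℕ.+ k → m a b ≈ tri a b) →
    (∀ a → s ≤ a → a < s ℕ.+ k → Zero m a tail) → Linked m (s ℕ.+ k) tail → Chain m tail →
    Chain m (upFrom s (suc k) ++ tail)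
  segment-chain m zero s tail T Z L ch =
    link (trans (T s s ≤-refl (m≤m+n s 0) ≤-refl (m≤m+n s 0)) (tri-diagonal s))
         (≡.subst (λ z → Linked m z tail) (ℕₚ.+-identityʳ s) L) ch
  segment-chain m (suc k) s tail T Z L ch =
    link (trans (T s s r sb r sb) (tri-diagonal s))
      ( trans (T s (suc s) r sb (n≤1+n s) s1b) (tri-above s)
      , trans (T (suc s) s (n≤1+n s) s1b r sb) (tri-below s)
      , Allₚ.++⁺ (All-upFrom (suc (suc s)) k (λ z lo hi →
            trans (T s z r sb (≤-trans (n≤1+n s) (<⇒≤ lo)) (up z hi)) (tri-farʳ s z lo)
          , trans (T z s (≤-trans (n≤1+n s) (<⇒≤ lo)) (up z hi) r sb) (tri-farˡ s z lo)))
          (Z s r (m<m+n s (s≤s z≤n))))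
      (segment-chain m k (suc s) tail
        (λ a b p q p' q' → T a b (<⇒≤ p) (≡.subst (a ≤_) e q) (<⇒≤ p') (≡.subst (b ≤_) e q'))
        (λ a p q → Z a (<⇒≤ p) (≡.subst (a <_) e q))
        (≡.subst (λ z → Linked m z tail) (≡.sym e) L) ch)
    where
    r = ≤-refl
    sb = m≤m+n s (suc k)
    e : suc s ℕ.+ k ≡ s ℕ.+ suc k
    e = ≡.sym (+-suc s k)
    s1b : suc s ≤ s ℕ.+ suc k
    s1b = ≡.subst (suc s ≤_) e (m≤m+n (suc s) k)
    up : ∀ z → z < suc (suc s) ℕ.+ k → z ≤ s ℕ.+ suc k
    up z hi = ≡.subst (z ≤_) e (≤-pred hi)

  tri-segment : ∀ s k → Chain tri (upFrom s k)
  tri-segment s zero    = []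
  tri-segment s (suc k) = ≡.subst (Chain tri) (++-identityʳ _)
    (segment-chain tri k s [] (λ _ _ _ _ _ _ → refl) (λ _ _ _ → []) tt [])

  -- The sequence is convex: by the recursion each increment exceeds the one before by x times a
  -- positive term, and the first increment is 1 + x. The bound 1 on the increments is what makes
  -- `excess` positive.
  pathMinor-increasing : ∀ k → Pos (pathMinor k) × (pathMinor k + 1# ⊑ pathMinor (suc k))
  pathMinor-increasing zero = Pos-1 , x , Pos-x , solve 1 (λ x → x :+ (:1 :+ :1) := :1 :+ :1 :+ x) refl x
  pathMinor-increasing (suc k) with pathMinor-increasing k
  ... | pk , inc@(d , pd , e) = ph , x * h + d , Pos-+ (Pos-* Pos-x ph) pd , (begin
    (x + (1# + 1#)) * h - pathMinor k
      ≈⟨ solve 3 (λ x h p → (x :+ (:1 :+ :1)) :* h :- p := h :+ (x :* h :+ (h :- p))) refl x h (pathMinor k) ⟩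
    h + (x * h + (h - pathMinor k))
      ≈⟨ +-congˡ (+-congˡ (+-congʳ e)) ⟩
    h + (x * h + (pathMinor k + 1# + d - pathMinor k))
      ≈⟨ solve 4 (λ h xh p d → h :+ (xh :+ (p :+ :1 :+ d :- p)) := h :+ :1 :+ (xh :+ d)) refl h (x * h) (pathMinor k) d ⟩
    h + 1# + (x * h + d) ∎)
    where h = pathMinor (suc k)
          ph = ⊑-Pos (Pos-+ pk Pos-1) inc

  tri-minor-increasing : ∀ a l → AllPairs _<_ (a ∷ l) → (1# ⊑ minor tri l l) × (minor tri l l ⊑ minor tri (a ∷ l) (a ∷ l))
  tri-minor-increasing a [] _ = ⊑-refl , x + 1# , Pos-+ Pos-x Pos-1 ,
    trans (+-congʳ (*-congʳ (tri-diagonal a))) (solve 1 (λ x → (x :+ (:1 :+ :1)) :* :1 :- :0 := :1 :+ (x :+ :1)) refl x)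
  tri-minor-increasing a (b ∷ l) ((a<b ∷ a<l) ∷ (b<l ∷ asc)) with tri-minor-increasing b l (b<l ∷ asc)
  ... | one , inc@(d , pd , e) = ⊑-trans one inc , increase (ℕₚ.m≤n⇒m<n∨m≡n a<b)
    where
    h = minor tri (b ∷ l) (b ∷ l)
    ph = ⊑-Pos Pos-1 (⊑-trans one inc)
    pendant : minor tri (a ∷ b ∷ l) (a ∷ b ∷ l) ≈ diagonal * h - tri a b * tri b a * minor tri l l
    pendant = trans
      (minor-pendant tri a b l (All.map (λ {z} b<z → tri-farˡ a z (≤-trans (s≤s a<b) b<z)) b<l)
                               (All.map (λ {z} b<z → tri-farʳ a z (≤-trans (s≤s a<b) b<z)) b<l))
      (+-congʳ (*-congʳ (tri-diagonal a)))
    increase : suc a < b ⊎ suc a ≡ b → h ⊑ minor tri (a ∷ b ∷ l) (a ∷ b ∷ l)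
    increase (inj₁ far) = (x + 1#) * h , Pos-* (Pos-+ Pos-x Pos-1) ph , (begin
      minor tri (a ∷ b ∷ l) (a ∷ b ∷ l) ≈⟨ pendant ⟩
      diagonal * h - tri a b * tri b a * minor tri l l
        ≈⟨ +-congˡ (-‿cong (*-congʳ (*-congʳ (tri-farʳ a b far)))) ⟩
      (x + (1# + 1#)) * h - 0# * tri b a * minor tri l l
        ≈⟨ solve 4 (λ x h t m → (x :+ (:1 :+ :1)) :* h :- :0 :* t :* m := h :+ (x :+ :1) :* h) refl x h (tri b a) (minor tri l l) ⟩
      h + (x + 1#) * h ∎)
    increase (inj₂ ≡.refl) = x * h + d , Pos-+ (Pos-* Pos-x ph) pd , (begin
      minor tri (a ∷ b ∷ l) (a ∷ b ∷ l) ≈⟨ pendant ⟩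
      diagonal * h - tri a b * tri b a * minor tri l l
        ≈⟨ +-congˡ (-‿cong (*-congʳ (*-cong (tri-above a) (tri-below a)))) ⟩
      (x + (1# + 1#)) * h - (- 1#) * (- 1#) * minor tri l l
        ≈⟨ solve 3 (λ x h m → (x :+ (:1 :+ :1)) :* h :- (:- :1) :* (:- :1) :* m := h :+ (x :* h :+ (h :- m))) refl x h (minor tri l l) ⟩
      h + (x * h + (h - minor tri l l))
        ≈⟨ +-congˡ (+-congˡ (trans (+-congʳ e) (solve 2 (λ m d → m :+ d :- m := d) refl _ d))) ⟩
      h + (x * h + d) ∎)

  1⊑tri-minor : ∀ l → AllPairs _<_ l → 1# ⊑ minor tri l l
  1⊑tri-minor []      _   = ⊑-refl
  1⊑tri-minor (a ∷ l) asc = ⊑-trans (proj₁ (tri-minor-increasing a l asc)) (proj₂ (tri-minor-increasing a l asc))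

  private
    laplacian-shift : ∀ s k i j → laplacian (cycleEdgesFrom (suc s) k) (suc i) (suc j) ≡ laplacian (cycleEdgesFrom s k) i j
    laplacian-shift s zero    i j = ≡.refl
    laplacian-shift s (suc k) i j = ≡.cong (edgeLaplacian (s , suc s) i j +_) (laplacian-shift (suc s) k i j)

    laplacian-zero : ∀ s k j → laplacian (cycleEdgesFrom (suc s) k) 0 j ≈ 0#
    laplacian-zero s zero    j = refl
    laplacian-zero s (suc k) j = trans (+-congˡ (laplacian-zero (suc s) k j))
      (solve 1 (λ a → (:0 :- :0) :* a :+ :0 := :0) refl _)

    -- The ends of the path have too small a degree, and the δ terms restore the missing units on
    -- the diagonal. The closing edge of the cycle supplies exactly these, besides its two corner
    -- entries.
    path-entry : ∀ q i j → i ≤ q → j ≤ q →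
      x * δ i j + laplacian (cycleEdgesFrom 0 q) i j + δ i 0 * δ j 0 + δ i q * δ j q ≈ tri i j
    path-entry zero zero zero _ _ = solve 1 (λ x → x :* :1 :+ :0 :+ :1 :* :1 :+ :1 :* :1 := x :+ (:1 :+ :1)) refl x
    path-entry (suc q) zero zero _ _ = trans (+-congʳ (+-congʳ (+-congˡ (+-congˡ (laplacian-zero 0 q 0)))))
      (solve 1 (λ x → x :* :1 :+ ((:1 :- :0) :* (:1 :- :0) :+ :0) :+ :1 :* :1 :+ :0 :* :0 := x :+ (:1 :+ :1)) refl x)
    path-entry (suc q) zero (suc zero) _ _ = trans (+-congʳ (+-congʳ (+-congˡ (+-congˡ (laplacian-zero 0 q 1)))))
      (solve 2 (λ x d → x :* :0 :+ ((:1 :- :0) :* (:0 :- :1) :+ :0) :+ :1 :* :0 :+ :0 :* d := :- :1) refl x (δ 0 q))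
    path-entry (suc q) zero (suc (suc j)) _ _ = trans (+-congʳ (+-congʳ (+-congˡ (+-congˡ (laplacian-zero 0 q (suc (suc j)))))))
      (solve 2 (λ x d → x :* :0 :+ ((:1 :- :0) :* (:0 :- :0) :+ :0) :+ :1 :* :0 :+ :0 :* d := :0) refl x (δ (suc j) q))
    path-entry (suc q) (suc zero) zero _ _ =
      trans (+-congʳ (+-congʳ (+-congˡ (+-congˡ (trans (laplacian-sym (cycleEdgesFrom 1 q) 1 0) (laplacian-zero 0 q 1))))))
      (solve 2 (λ x d → x :* :0 :+ ((:0 :- :1) :* (:1 :- :0) :+ :0) :+ :0 :* :1 :+ d :* :0 := :- :1) refl x (δ 0 q))
    path-entry (suc q) (suc (suc i)) zero _ _ =
      trans (+-congʳ (+-congʳ (+-congˡ (+-congˡ (trans (laplacian-sym (cycleEdgesFrom 1 q) (suc (suc i)) 0) (laplacian-zero 0 q (suc (suc i))))))))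
      (solve 2 (λ x d → x :* :0 :+ ((:0 :- :0) :* (:1 :- :0) :+ :0) :+ :0 :* :1 :+ d :* :0 := :0) refl x (δ (suc i) q))
    path-entry (suc q) (suc i) (suc j) (s≤s i≤q) (s≤s j≤q) = begin
      x * δ i j + ((0# - δ i 0) * (0# - δ j 0) + laplacian (cycleEdgesFrom 1 q) (suc i) (suc j)) + 0# * 0# + δ i q * δ j q
        ≈⟨ +-congʳ (+-congʳ (+-congˡ (+-congˡ (reflexive (laplacian-shift 0 q i j))))) ⟩
      x * δ i j + ((0# - δ i 0) * (0# - δ j 0) + laplacian (cycleEdgesFrom 0 q) i j) + 0# * 0# + δ i q * δ j q
        ≈⟨ solve 5 (λ a b c l d → a :+ ((:0 :- b) :* (:0 :- c) :+ l) :+ :0 :* :0 :+ d := a :+ l :+ b :* c :+ d)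
             refl (x * δ i j) (δ i 0) (δ j 0) (laplacian (cycleEdgesFrom 0 q) i j) (δ i q * δ j q) ⟩
      x * δ i j + laplacian (cycleEdgesFrom 0 q) i j + δ i 0 * δ j 0 + δ i q * δ j q
        ≈⟨ path-entry q i j i≤q j≤q ⟩
      tri i j ∎

  cyclic : ℕ → ℕ → ℕ → Carrier
  cyclic q = weighted (cycleEdges q) (const unit)

  cyclic-entry : ∀ q i j → i ≤ q → j ≤ q → cyclic q i j ≈ tri i j - δ i q * δ j 0 - δ i 0 * δ j q
  cyclic-entry q i j i≤q j≤q = begin
    1# * (x * δ i j + ((δ i q - δ i 0) * (δ j q - δ j 0) + l)) + 0# * δ i j
      ≈⟨ solve 7 (λ xd d l iq i0 jq j0 → :1 :* (xd :+ ((iq :- i0) :* (jq :- j0) :+ l)) :+ :0 :* d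
            := xd :+ l :+ i0 :* j0 :+ iq :* jq :- iq :* j0 :- i0 :* jq)
           refl (x * δ i j) (δ i j) l (δ i q) (δ i 0) (δ j q) (δ j 0) ⟩
    x * δ i j + l + δ i 0 * δ j 0 + δ i q * δ j q - δ i q * δ j 0 - δ i 0 * δ j q
      ≈⟨ +-congʳ (+-congʳ (path-entry q i j i≤q j≤q)) ⟩
    tri i j - δ i q * δ j 0 - δ i 0 * δ j q ∎
    where l = laplacian (cycleEdgesFrom 0 q) i j

-- 1 , … , 1 + i + r except 1 + i
without : ℕ → ℕ → List ℕ
without i r = upFrom 1 i ++ upFrom (2 ℕ.+ i) r

upFrom-without : ∀ i r → upFrom 1 (suc (i ℕ.+ r)) ↭ suc i ∷ without i r
upFrom-without i r = ↭-trans (↭-reflexive (≡.trans (≡.cong (upFrom 1) (≡.sym (+-suc i r))) (upFrom-++ 1 i (suc r))))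
  (Perm.shift (suc i) (upFrom 1 i) (upFrom (2 ℕ.+ i) r))

without-bounds : ∀ i r → All (λ a → (1 ≤ a) × (a ≤ suc (i ℕ.+ r))) (without i r)
without-bounds i r = Allₚ.++⁺
  (All-upFrom 1 i (λ z lo hi → lo , ≤-trans (<⇒≤ hi) (s≤s (m≤m+n i r))))
  (All-upFrom (2 ℕ.+ i) r (λ z lo hi → ≤-trans (s≤s z≤n) lo , ≤-pred hi))

∉-upFrom : ∀ a s k → a < s ⊎ s ℕ.+ k ≤ a → All (a ≢_) (upFrom s k)
∉-upFrom a s k (inj₁ a<s) = All-upFrom s k (λ { z lo hi ≡.refl → <⇒≱ a<s lo })
∉-upFrom a s k (inj₂ le)  = All-upFrom s k (λ { z lo hi ≡.refl → <⇒≱ hi le })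

∉-without : ∀ i r → All (suc i ≢_) (without i r)
∉-without i r = Allₚ.++⁺ (∉-upFrom (suc i) 1 i (inj₂ ≤-refl)) (∉-upFrom (suc i) (2 ℕ.+ i) r (inj₁ ≤-refl))

-- Signs of rotations, and expansion in two weighted rows

module Signs (R : CommutativeRing 0ℓ 0ℓ) {V : Set} where
  open CommutativeRing R
  open Algebra.Properties.Ring ring
  open Determinant R {V}
  open IntegerSolver R

  sign : ℕ → Carrier
  sign zero    = 1#
  sign (suc k) = - sign k

  sign² : ∀ k → sign k * sign k ≈ 1#
  sign² zero    = *-identityˡ 1#
  sign² (suc k) = trans (solve 1 (λ s → (:- s) :* (:- s) := s :* s) refl (sign k)) (sign² k)

  rotate : ∀ F → Alternating F → ∀ c ds → F (c ∷ ds) ≈ sign (length ds) * F (ds ++ [ c ])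
  rotate F alt c []       = sym (*-identityˡ _)
  rotate F alt c (d ∷ ds) = trans (alt [] c d ds)
    (trans (-‿cong (rotate (λ ds → F (d ∷ ds)) (λ pre → alt (d ∷ pre)) c ds)) (-‿distribˡ-* _ _))

module AffineExpansion (R : CommutativeRing 0ℓ 0ℓ) (C : PositiveCone R)
    (x : CommutativeRing.Carrier R) (Pos-x : PositiveCone.Pos C x)
    {V : Set} (_≟_ : DecidableEquality V) where
  open CommutativeRing R
  open Relation.Binary.Reasoning.Setoid setoid
  open IntegerSolver R
  open Determinant R {V}
  open RootedPairs R C x Pos-x
  open WeightedLaplacian R C x Pos-x _≟_

  expand-δ-second : ∀ a i F rest → i ≢ a → All (i ≢_) rest → expand (δ i) F (a ∷ i ∷ rest) ≈ - F (a ∷ rest)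
  expand-δ-second a i F rest i≢a i∉ = begin
    δ i a * F (i ∷ rest) - expand (δ i) (λ ds → F (a ∷ ds)) (i ∷ rest)
      ≈⟨ +-cong (*-congʳ (δ-≢ i≢a)) (-‿cong (expand-δ i (λ ds → F (a ∷ ds)) rest i∉)) ⟩
    0# * F (i ∷ rest) - F (a ∷ rest) ≈⟨ solve 2 (λ a b → :0 :* a :- b := :- b) refl _ _ ⟩
    - F (a ∷ rest) ∎

  module _ (E : List (V × V)) (X : V → Pair) (a i : V) (rest : List V)
           (a≢i : a ≢ i) (a∉ : All (a ≢_) rest) (i∉ : All (i ≢_) rest) (Xrest : All (λ z → X z ≋ unit) rest) where
    private
      W = weighted E X
      K = weighted E (const unit)
      ba = proj₁ (X a)
      ca = proj₂ (X a)
      bi = proj₁ (X i)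
      ci = proj₂ (X i)
      G = minor K rest

      row : ∀ u c → W u c ≈ proj₁ (X u) * K u c + proj₂ (X u) * δ u c
      row u c = solve 4 (λ b c l d → b :* l :+ c :* d := b :* (:1 :* l :+ :0 :* d) :+ c :* d)
        refl (proj₁ (X u)) (proj₂ (X u)) (x * δ u c + laplacian E u c) (δ u c)

      restRows : ∀ ds → minor W rest ds ≈ G ds
      restRows = minor-row-congʳ rest (All.map (λ {z} e c → weighted-congX {E} {X} {const unit} {z} c e) Xrest)

      rowI : ∀ cs → minor W (i ∷ rest) cs ≈ bi * expand (K i) G cs + ci * expand (δ i) G cs
      rowI cs = trans (expand-congF (W i) restRows cs) (expand-linearρ bi ci G cs (All.universal (row i) cs))

      inner : expand (K a) (minor W (i ∷ rest)) (a ∷ i ∷ rest) ≈ bi * minor K (a ∷ i ∷ rest) (a ∷ i ∷ rest) + ci * minor K (a ∷ rest) (a ∷ rest)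
      inner = begin
        expand (K a) (minor W (i ∷ rest)) cs
          ≈⟨ expand-congF (K a) rowI cs ⟩
        expand (K a) (λ ds → bi * expand (K i) G ds + ci * expand (δ i) G ds) cs
          ≈⟨ expand-linearF (K a) bi ci (expand (K i) G) (expand (δ i) G) cs ⟩
        bi * minor K cs cs + ci * expand (K a) (expand (δ i) G) cs
          ≈⟨ +-congˡ (*-congˡ (trans (expand-anticomm (K a) (δ i) G cs)
               (trans (-‿cong (expand-δ-second a i (expand (K a) G) rest (λ e → a≢i (≡.sym e)) i∉)) (solve 1 (λ a → :- (:- a) := a) refl _)))) ⟩
        bi * minor K cs cs + ci * minor K (a ∷ rest) (a ∷ rest) ∎
        where cs = a ∷ i ∷ rest

      outer : minor W (i ∷ rest) (i ∷ rest) ≈ bi * minor K (i ∷ rest) (i ∷ rest) + ci * G rest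
      outer = trans (rowI (i ∷ rest)) (+-congˡ (*-congˡ (expand-δ i G rest i∉)))

    -- A row of W is b times the row of K plus c times a unit row, and expanding along a unit row
    -- deletes the vertex. Linearity in the two weighted rows gives the four minors.
    biaffine : minor W (a ∷ i ∷ rest) (a ∷ i ∷ rest)
      ≈ ba * (bi * minor K (a ∷ i ∷ rest) (a ∷ i ∷ rest) + ci * minor K (a ∷ rest) (a ∷ rest))
        + ca * (bi * minor K (i ∷ rest) (i ∷ rest) + ci * minor K rest rest)
    biaffine = trans (expand-linearρ ba ca (minor W (i ∷ rest)) (a ∷ i ∷ rest) (All.universal (row a) _))
      (+-cong (*-congˡ inner) (*-congˡ (trans (expand-δ a (minor W (i ∷ rest)) (i ∷ rest) (a≢i ∷ a∉)) outer)))

-- The determinant of a cycle with two trees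

module CycleValue (R : CommutativeRing 0ℓ 0ℓ) (C : PositiveCone R)
    (x : CommutativeRing.Carrier R) (Pos-x : PositiveCone.Pos C x) where
  open CommutativeRing R
  open Algebra.Properties.Ring ring
  open Relation.Binary.Reasoning.Setoid setoid
  open IntegerSolver R
  open PositiveCone C
  open Order R C
  open RootedPairs R C x Pos-x
  open Determinant R {ℕ}
  open Signs R {ℕ}
  open WeightedLaplacian R C x Pos-x ℕₚ._≟_
  open AffineExpansion R C x Pos-x ℕₚ._≟_
  open CycleDeterminant R C x Pos-x

  private
    upFrom-∷ʳ : ∀ s k → upFrom s k ++ [ s ℕ.+ k ] ≡ upFrom s (suc k)
    upFrom-∷ʳ s k = ≡.trans (≡.sym (upFrom-++ s k 1)) (≡.cong (upFrom s) (ℕₚ.+-comm k 1))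

    -- Shifting the columns by one makes the matrix triangular with -1 on the diagonal.
    upper-minor : ∀ s k → minor tri (upFrom s k) (upFrom (suc s) k) ≈ sign k
    upper-minor s zero    = refl
    upper-minor s (suc k) = begin
      minor tri (upFrom s (suc k)) (upFrom (suc s) (suc k))
        ≈⟨ minor-headRow tri s (upFrom (suc s) k) (suc s) (upFrom (suc (suc s)) k) (All-upFrom (suc (suc s)) k (λ z lo _ → tri-farʳ s z lo)) ⟩
      tri s (suc s) * minor tri (upFrom (suc s) k) (upFrom (suc (suc s)) k)
        ≈⟨ *-cong (tri-above s) (upper-minor (suc s) k) ⟩
      (- 1#) * sign k ≈⟨ solve 1 (λ s → (:- :1) :* s := :- s) refl (sign k) ⟩
      - sign k ∎

    lower-minor : ∀ s k → minor tri (upFrom (suc s) k) (upFrom s k) ≈ sign k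
    lower-minor s zero    = refl
    lower-minor s (suc k) = begin
      minor tri (upFrom (suc s) (suc k)) (upFrom s (suc k))
        ≈⟨ minor-headColumn tri (suc s) (upFrom (suc (suc s)) k) s (upFrom (suc s) k) (All-upFrom (suc (suc s)) k (λ z lo _ → tri-farˡ s z lo)) ⟩
      tri (suc s) s * minor tri (upFrom (suc (suc s)) k) (upFrom (suc s) k)
        ≈⟨ *-cong (tri-below s) (lower-minor (suc s) k) ⟩
      (- 1#) * sign k ≈⟨ solve 1 (λ s → (:- :1) :* s := :- s) refl (sign k) ⟩
      - sign k ∎

    corner : ∀ p → sign p * - sign p ≈ - 1#
    corner p = trans (solve 1 (λ s → s :* (:- s) := :- (s :* s)) refl (sign p)) (-‿cong (sign² p))

    tri-path : ∀ s k → minor tri (upFrom s k) (upFrom s k) ≈ pathMinor k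
    tri-path s k = trans (chain-minor (tri-segment s k)) (reflexive (≡.cong pathMinor (length-upFrom s k)))

  -- The closing edge joins 0 and q = suc p; the off-diagonal entries it adds
  -- are split off the rows of q and 0.
  cyclic-minor : ∀ p → minor (cyclic (suc p)) (upFrom 0 (suc (suc p))) (upFrom 0 (suc (suc p)))
    ≈ pathMinor (suc (suc p)) - pathMinor p - (1# + 1#)
  cyclic-minor p = begin
    minor K (upFrom 0 (suc q)) (upFrom 0 (suc q)) ≈⟨ principal-↭ K reorder ⟩
    minor K cs cs
      ≈⟨ minor-cong (_≤ q) cs (rowQ ∷ row0 ∷ rowMid) cs (≤-refl ∷ z≤n ∷ mid≤q) ⟩
    minor K' cs cs
      ≈⟨ expand-linearρ 1# (- 1#) (minor K' (0 ∷ mid)) cs (All.universal K'q cs) ⟩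
    1# * expand (tri q) (minor K' (0 ∷ mid)) cs + (- 1#) * expand (δ 0) (minor K' (0 ∷ mid)) cs
      ≈⟨ +-cong (*-congˡ first) (*-congˡ second) ⟩
    -- Four terms come from the two rows: the path determinant, two corner minors of value -1, and,
    -- with negative sign, the minor that lacks both ends.
    1# * (pathMinor (suc q) + - 1#) + (- 1#) * - (- 1# - pathMinor p)
      ≈⟨ solve 2 (λ a b → :1 :* (a :+ :- :1) :+ (:- :1) :* (:- (:- :1 :- b)) := a :- b :- (:1 :+ :1)) refl (pathMinor (suc q)) (pathMinor p) ⟩
    pathMinor (suc q) - pathMinor p - (1# + 1#) ∎
    where
    q = suc p
    K = cyclic q
    mid = upFrom 1 p
    cs = q ∷ 0 ∷ mid
    G = minor tri mid
    reorder : upFrom 0 (suc q) ↭ cs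
    reorder = ↭-trans (↭-reflexive (≡.sym (upFrom-∷ʳ 0 q))) (↭-sym (Perm.∷↭∷ʳ q (upFrom 0 q)))
    K' : ℕ → ℕ → Carrier
    K' i j = tri i j - δ i q * δ j 0 - δ i 0 * δ j q
    mid≤q : All (_≤ q) mid
    mid≤q = All-upFrom 1 p (λ z _ hi → <⇒≤ hi)
    rowQ : ∀ c → c ≤ q → K q c ≈ K' q c
    rowQ c = cyclic-entry q q c ≤-refl
    row0 : ∀ c → c ≤ q → K 0 c ≈ K' 0 c
    row0 c = cyclic-entry q 0 c z≤n
    rowMid : All (λ r → ∀ c → c ≤ q → K r c ≈ K' r c) mid
    rowMid = All.map (λ {r} r≤q c → cyclic-entry q r c r≤q) mid≤q
    K'q : ∀ c → K' q c ≈ 1# * tri q c + (- 1#) * δ 0 c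
    K'q c = begin
      tri q c - δ q q * δ c 0 - 0# * δ c q
        ≈⟨ +-congʳ (+-congˡ (-‿cong (*-cong (δ-refl q) (δ-sym c 0)))) ⟩
      tri q c - 1# * δ 0 c - 0# * δ c q
        ≈⟨ solve 3 (λ t d e → t :- :1 :* d :- :0 :* e := :1 :* t :+ (:- :1) :* d) refl _ _ _ ⟩
      1# * tri q c + (- 1#) * δ 0 c ∎
    K'0 : ∀ c → K' 0 c ≈ 1# * tri 0 c + (- 1#) * δ q c
    K'0 c = begin
      tri 0 c - 0# * δ c 0 - 1# * δ c q
        ≈⟨ +-congˡ (-‿cong (*-congˡ (δ-sym c q))) ⟩
      tri 0 c - 0# * δ c 0 - 1# * δ q c
        ≈⟨ solve 3 (λ t d e → t :- :0 :* d :- :1 :* e := :1 :* t :+ (:- :1) :* e) refl _ _ _ ⟩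
      1# * tri 0 c + (- 1#) * δ q c ∎
    K'mid : ∀ ds → minor K' mid ds ≈ G ds
    K'mid = minor-row-congʳ mid (All-upFrom 1 p λ { (suc z) _ hi c → begin
      tri (suc z) c - δ (suc z) q * δ c 0 - 0# * δ c q
        ≈⟨ +-congʳ (+-congˡ (-‿cong (*-congʳ (δ-≢ (<⇒≢ hi))))) ⟩
      tri (suc z) c - 0# * δ c 0 - 0# * δ c q
        ≈⟨ solve 3 (λ t d e → t :- :0 :* d :- :0 :* e := t) refl _ _ _ ⟩
      tri (suc z) c ∎ })
    K'0mid : ∀ ds → minor K' (0 ∷ mid) ds ≈ 1# * expand (tri 0) G ds + (- 1#) * expand (δ q) G ds
    K'0mid ds = trans (expand-congF (K' 0) K'mid ds) (expand-linearρ 1# (- 1#) G ds (All.universal K'0 ds))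
    q∉mid = ∉-upFrom q 1 p (inj₂ ≤-refl)
    0∉mid = ∉-upFrom 0 1 p (inj₁ (s≤s z≤n))
    -- Moving column q behind `mid` costs the sign of p, and the triangular minor that results has p
    -- + 1 factors -1; the product is -1 for every p.
    endUp : minor tri (0 ∷ mid) (q ∷ mid) ≈ - 1#
    endUp = trans (rotate (minor tri (0 ∷ mid)) (minor-alternating-columns tri (0 ∷ mid)) q mid)
      (trans (*-cong (reflexive (≡.cong sign (length-upFrom 1 p)))
               (trans (reflexive (≡.cong (minor tri (0 ∷ mid)) (upFrom-∷ʳ 1 p))) (upper-minor 0 q))) (corner p))
    endDown : minor tri (q ∷ mid) (0 ∷ mid) ≈ - 1#
    endDown = trans (rotate (λ rs → minor tri rs (0 ∷ mid)) (minor-alternating-rows tri (0 ∷ mid)) q mid)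
      (trans (*-cong (reflexive (≡.cong sign (length-upFrom 1 p)))
               (trans (reflexive (≡.cong (λ rs → minor tri rs (0 ∷ mid)) (upFrom-∷ʳ 1 p))) (lower-minor 0 q))) (corner p))
    first : expand (tri q) (minor K' (0 ∷ mid)) cs ≈ pathMinor (suc q) + - 1#
    first = begin
      expand (tri q) (minor K' (0 ∷ mid)) cs ≈⟨ expand-congF (tri q) K'0mid cs ⟩
      expand (tri q) (λ ds → 1# * expand (tri 0) G ds + (- 1#) * expand (δ q) G ds) cs
        ≈⟨ expand-linearF (tri q) 1# (- 1#) (expand (tri 0) G) (expand (δ q) G) cs ⟩
      1# * minor tri cs cs + (- 1#) * expand (tri q) (expand (δ q) G) cs
        ≈⟨ +-cong (*-congˡ (trans (principal-↭ tri (↭-sym reorder)) (tri-path 0 (suc q))))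
                  (*-congˡ (trans (expand-anticomm (tri q) (δ q) G cs)
                     (-‿cong (trans (expand-δ q (expand (tri q) G) (0 ∷ mid) ((λ ()) ∷ q∉mid)) endDown)))) ⟩
      1# * pathMinor (suc q) + (- 1#) * - - 1#
        ≈⟨ solve 1 (λ a → :1 :* a :+ (:- :1) :* (:- (:- :1)) := a :+ :- :1) refl _ ⟩
      pathMinor (suc q) + - 1# ∎
    second : expand (δ 0) (minor K' (0 ∷ mid)) cs ≈ - (- 1# - pathMinor p)
    second = begin
      expand (δ 0) (minor K' (0 ∷ mid)) cs ≈⟨ expand-δ-second q 0 (minor K' (0 ∷ mid)) mid (λ ()) 0∉mid ⟩
      - minor K' (0 ∷ mid) (q ∷ mid) ≈⟨ -‿cong (K'0mid (q ∷ mid)) ⟩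
      - (1# * minor tri (0 ∷ mid) (q ∷ mid) + (- 1#) * expand (δ q) G (q ∷ mid))
        ≈⟨ -‿cong (+-cong (*-congˡ endUp) (*-congˡ (trans (expand-δ q G mid q∉mid) (tri-path 1 p)))) ⟩
      - (1# * - 1# + (- 1#) * pathMinor p)
        ≈⟨ solve 1 (λ a → :- (:1 :* (:- :1) :+ (:- :1) :* a) := :- (:- :1 :- a)) refl _ ⟩
      - (- 1# - pathMinor p) ∎

  private
    interior : ∀ q a b → a ≤ q → b ≤ q → a ≢ q ⊎ b ≢ 0 → a ≢ 0 ⊎ b ≢ q → cyclic q a b ≈ tri a b
    interior q a b a≤ b≤ h h' = trans (cyclic-entry q a b a≤ b≤)
      (trans (+-cong (+-congˡ (-‿cong (vanish h))) (-‿cong (vanish h'))) (solve 1 (λ t → t :- :0 :- :0 := t) refl _))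
      where
      vanish : ∀ {a b c d} → a ≢ c ⊎ b ≢ d → δ a c * δ b d ≈ 0#
      vanish (inj₁ a≢c) = trans (*-congʳ (δ-≢ a≢c)) (zeroˡ _)
      vanish (inj₂ b≢d) = trans (*-congˡ (δ-≢ b≢d)) (zeroʳ _)

    nonzero : ∀ {a} → 1 ≤ a → a ≢ 0
    nonzero (s≤s _) ()

    cyclic-interior-minor : ∀ q l → All (λ a → (1 ≤ a) × (a ≤ q)) l → minor (cyclic q) l l ≈ minor tri l l
    cyclic-interior-minor q l h = minor-cong (λ a → (1 ≤ a) × (a ≤ q)) l
      (All.map (λ { {r} (1≤r , r≤q) c (1≤c , c≤q) → interior q r c r≤q c≤q (inj₂ (nonzero 1≤c)) (inj₁ (nonzero 1≤r)) }) h) l h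

    closing-entry : ∀ q → 2 ≤ q → (cyclic q q 0 ≈ - 1#) × (cyclic q 0 q ≈ - 1#)
    closing-entry q@(suc (suc p)) _ =
      trans (cyclic-entry q q 0 ≤-refl z≤n)
        (trans (+-congʳ (+-congˡ (-‿cong (*-congʳ (δ-refl q))))) (solve 0 (:0 :- :1 :* :1 :- :0 :* :0 := :- :1) refl)) ,
      trans (cyclic-entry q 0 q z≤n ≤-refl)
        (trans (+-congˡ (-‿cong (*-congˡ (δ-refl q)))) (solve 0 (:0 :- :0 :* :0 :- :1 :* :1 := :- :1) refl))

    closing-entry (suc zero) (s≤s ())

    initial-chain : ∀ q i → i < q → Chain (cyclic q) (upFrom 0 (suc i))
    initial-chain q i i<q = ≡.subst (Chain (cyclic q)) (++-identityʳ _)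
      (segment-chain (cyclic q) i 0 []
        (λ a b _ a≤i _ b≤i → interior q a b (≤q a≤i) (≤q b≤i) (inj₁ (<⇒≢ (ℕₚ.≤-<-trans a≤i i<q))) (inj₂ (<⇒≢ (ℕₚ.≤-<-trans b≤i i<q))))
        (λ _ _ _ → []) tt [])
      where
      ≤q : ∀ {a} → a ≤ i → a ≤ q
      ≤q a≤i = <⇒≤ (ℕₚ.≤-<-trans a≤i i<q)

    -- This is behind the independence of D₁ from the vertex: cut at suc i, the cycle is a path when
    -- read from 2 + i to q and then, over the closing edge, from 0 to i.
    rotated-chain : ∀ i r → Chain (cyclic (2 ℕ.+ i ℕ.+ r)) (upFrom (2 ℕ.+ i) (suc r) ++ upFrom 0 (suc i))
    rotated-chain i r = segment-chain (cyclic q) r (2 ℕ.+ i) (upFrom 0 (suc i))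
      (λ a b lo hi lo' hi' → interior q a b hi hi' (inj₂ (nonzero (≤-trans (s≤s z≤n) lo'))) (inj₁ (nonzero (≤-trans (s≤s z≤n) lo))))
      (λ a lo hi → All-upFrom 0 (suc i) (λ z _ z≤i →
          trans (interior q a z (<⇒≤ hi) (z≤q z≤i) (inj₁ (<⇒≢ hi)) (inj₁ (nonzero (≤-trans (s≤s z≤n) lo)))) (tri-farˡ z a (≤-trans (s≤s z≤i) lo))
        , trans (interior q z a (z≤q z≤i) (<⇒≤ hi) (inj₂ (nonzero (≤-trans (s≤s z≤n) lo))) (inj₂ (<⇒≢ hi))) (tri-farʳ z a (≤-trans (s≤s z≤i) lo))))
      ( proj₁ (closing-entry q (s≤s (s≤s z≤n))) , proj₂ (closing-entry q (s≤s (s≤s z≤n)))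
      , All-upFrom 1 i (λ z lo z≤i →
          trans (interior q q z ≤-refl (z≤q z≤i) (inj₂ (nonzero lo)) (inj₁ λ ())) (tri-farˡ z q (≤-trans (s≤s z≤i) (m≤m+n (2 ℕ.+ i) r)))
        , trans (interior q z q (z≤q z≤i) ≤-refl (inj₂ λ ()) (inj₁ (nonzero lo))) (tri-farʳ z q (≤-trans (s≤s z≤i) (m≤m+n (2 ℕ.+ i) r)))))
      (initial-chain q i (≤-trans (n≤1+n _) (m≤m+n (2 ℕ.+ i) r)))
      where
      q = 2 ℕ.+ i ℕ.+ r
      z≤q : ∀ {z} → z < suc i → z ≤ q
      z≤q z≤i = ≤-trans (<⇒≤ z≤i) (≤-trans (n≤1+n _) (m≤m+n (2 ℕ.+ i) r))

  -- The difference D₀ - x D₁, rewritten by the recursion of `pathMinor`; here D₁ is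
  -- `pathMinor (suc p)`.
  excess : ℕ → Carrier
  excess p = (1# + 1#) * (pathMinor (suc p) - pathMinor p - 1#)

  Pos-excess : ∀ p → Pos (excess p)
  Pos-excess p with proj₂ (pathMinor-increasing p)
  ... | d , pd , e = Pos-* (Pos-+ Pos-1 Pos-1) (Pos-resp
    (sym (trans (+-congʳ (+-congʳ e)) (solve 2 (λ h d → h :+ :1 :+ d :- h :- :1 := d) refl (pathMinor p) d))) pd)

  private
    module _ (i r : ℕ) where
      q p : ℕ
      p = i ℕ.+ r
      q = suc p
      rest = without i r

      ascending : AllPairs _<_ rest
      ascending = AllPairsₚ.++⁺ (upFrom-ascending 1 i) (upFrom-ascending (2 ℕ.+ i) r)
        (All-upFrom 1 i (λ z _ hi → All-upFrom (2 ℕ.+ i) r (λ w lo _ → ≤-trans hi (≤-trans (n≤1+n _) lo))))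
        where
        upFrom-ascending : ∀ s k → AllPairs _<_ (upFrom s k)
        upFrom-ascending s zero    = []
        upFrom-ascending s (suc k) = All-upFrom (suc s) k (λ z lo _ → lo) ∷ upFrom-ascending (suc s) k

      D₀ : minor (cyclic q) (0 ∷ suc i ∷ rest) (0 ∷ suc i ∷ rest) ≈ pathMinor (suc q) - pathMinor p - (1# + 1#)
      D₀ = trans (sym (principal-↭ (cyclic q) (↭-prep 0 (upFrom-without i r)))) (cyclic-minor p)

      D₁ : minor (cyclic q) (suc i ∷ rest) (suc i ∷ rest) ≈ pathMinor q
      D₁ = begin
        minor (cyclic q) (suc i ∷ rest) (suc i ∷ rest)     ≈⟨ principal-↭ (cyclic q) (↭-sym (upFrom-without i r)) ⟩
        minor (cyclic q) (upFrom 1 q) (upFrom 1 q)         ≈⟨ cyclic-interior-minor q (upFrom 1 q) (All-upFrom 1 q (λ z lo hi → lo , ≤-pred hi)) ⟩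
        minor tri (upFrom 1 q) (upFrom 1 q)                ≈⟨ tri-path 1 q ⟩
        pathMinor q ∎

      D₂ : 1# ⊑ minor (cyclic q) rest rest
      D₂ = ⊑-trans (1⊑tri-minor rest ascending) (⊑-reflexive (sym (cyclic-interior-minor q rest (without-bounds i r))))

    D₁' : ∀ i r → minor (cyclic (suc (i ℕ.+ r))) (0 ∷ without i r) (0 ∷ without i r) ≈ pathMinor (suc (i ℕ.+ r))
    -- The deleted vertex is the last one, so no segment follows the cut and the initial stretch is
    -- the whole path.
    D₁' i zero = begin
      minor K (0 ∷ without i 0) (0 ∷ without i 0) ≈⟨ principal-↭ K (↭-prep 0 (↭-reflexive (++-identityʳ (upFrom 1 i)))) ⟩
      minor K (upFrom 0 (suc i)) (upFrom 0 (suc i)) ≈⟨ chain-minor (initial-chain _ i (s≤s (m≤m+n i 0))) ⟩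
      pathMinor (length (upFrom 0 (suc i))) ≡⟨ ≡.cong pathMinor (≡.trans (length-upFrom 0 (suc i)) (≡.cong suc (≡.sym (ℕₚ.+-identityʳ i)))) ⟩
      pathMinor (suc (i ℕ.+ 0)) ∎
      where K = cyclic (suc (i ℕ.+ 0))
    D₁' i (suc r) rewrite +-suc i r = begin
      minor K (0 ∷ without i (suc r)) (0 ∷ without i (suc r)) ≈⟨ principal-↭ K (Perm.++-comm (upFrom 0 (suc i)) (upFrom (2 ℕ.+ i) (suc r))) ⟩
      minor K rot rot ≈⟨ chain-minor (rotated-chain i r) ⟩
      pathMinor (length rot) ≡⟨ ≡.cong pathMinor (≡.trans (length-++ (upFrom (2 ℕ.+ i) (suc r)))
                                  (≡.trans (≡.cong₂ ℕ._+_ (length-upFrom (2 ℕ.+ i) (suc r)) (length-upFrom 0 (suc i))) (arith i r))) ⟩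
      pathMinor (2 ℕ.+ i ℕ.+ r) ∎
      where
      K = cyclic (2 ℕ.+ i ℕ.+ r)
      rot = upFrom (2 ℕ.+ i) (suc r) ++ upFrom 0 (suc i)
      arith : ∀ i r → suc r ℕ.+ suc i ≡ 2 ℕ.+ i ℕ.+ r
      arith = solve-∀

  module _ (i r : ℕ) (X : ℕ → Pair) (Xrest : All (λ z → X z ≋ unit) (without i r)) where
    private
      Y = X 0
      Z = X (suc i)

    -- With D₀ split into x D₁ and `excess`, the part x D₁ completes the mixed terms to D₁ times
    -- `total (Y ⊗ Z)`.
    cycle-value : ∃ λ D₂ → (1# ⊑ D₂) ×
      (minor (weighted (cycleEdges (suc (i ℕ.+ r))) X) (upFrom 0 (suc (suc (i ℕ.+ r)))) (upFrom 0 (suc (suc (i ℕ.+ r))))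
        ≈ total (Y ⊗ Z) * pathMinor (suc (i ℕ.+ r)) + proj₁ (Y ⊗ Z) * excess (i ℕ.+ r) + proj₂ Y * proj₂ Z * D₂)
    cycle-value = minor (cyclic (q i r)) rs rs , D₂ i r , (begin
      minor W (upFrom 0 (suc (q i r))) (upFrom 0 (suc (q i r)))
        ≈⟨ principal-↭ W (↭-prep 0 (upFrom-without i r)) ⟩
      minor W (0 ∷ suc i ∷ rs) (0 ∷ suc i ∷ rs)
        ≈⟨ biaffine (cycleEdges (q i r)) X 0 (suc i) rs (λ ())
             (All.map (λ { (s≤s _ , _) () }) (without-bounds i r))
             (∉-without i r) Xrest ⟩
      b * (b' * minor K (0 ∷ suc i ∷ rs) (0 ∷ suc i ∷ rs) + c' * minor K (0 ∷ rs) (0 ∷ rs))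
        + c * (b' * minor K (suc i ∷ rs) (suc i ∷ rs) + c' * minor K rs rs)
        ≈⟨ +-cong (*-congˡ (+-cong (*-congˡ (D₀ i r)) (*-congˡ (D₁' i r)))) (*-congˡ (+-congʳ (*-congˡ (D₁ i r)))) ⟩
      b * (b' * (diagonal * h - h' - h' - (1# + 1#)) + c' * h) + c * (b' * h + c' * minor K rs rs)
        ≈⟨ solve 8 (λ x b c b' c' h h' d →
              b :* (b' :* ((x :+ (:1 :+ :1)) :* h :- h' :- h' :- (:1 :+ :1)) :+ c' :* h) :+ c :* (b' :* h :+ c' :* d)
              := (x :* (b :* b') :+ (c :* b' :+ b :* c')) :* h :+ b :* b' :* ((:1 :+ :1) :* (h :- h' :- :1)) :+ c :* c' :* d)
            refl x b c b' c' h h' (minor K rs rs) ⟩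
      total (Y ⊗ Z) * h + proj₁ (Y ⊗ Z) * excess (p i r) + c * c' * minor K rs rs ∎)
      where
      W = weighted (cycleEdges (q i r)) X
      K = cyclic (q i r)
      rs = without i r
      b = proj₁ Y
      c = proj₂ Y
      b' = proj₁ Z
      c' = proj₂ Z
      h = pathMinor (q i r)
      h' = pathMinor (p i r)

-- Integer polynomials as a ring with a positive cone

module Polynomials where
  open ≡.≡-Reasoning

  infix 4 _≗ₚ_ _≈ₚ_
  _≗ₚ_ : Poly → Poly → Set
  p ≗ₚ q = ∀ k → coeff p k ≡ coeff q k

  -- A record, so that p and q can be inferred from a proof.
  record _≈ₚ_ (p q : Poly) : Set where
    constructor coefficientwise
    field at : p ≗ₚ q
  open _≈ₚ_ public

  -- The ring laws are proved on coefficient functions, where trailing zeros of the lists do not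
  -- matter.
  convolve : (ℕ → ℤ) → (ℕ → ℤ) → ℕ → ℤ
  convolve f g zero    = f 0 ℤ.* g 0
  convolve f g (suc k) = f 0 ℤ.* g (suc k) ℤ.+ convolve (f ∘ suc) g k

  convolve-cong : ∀ {f f' g g'} → (∀ k → f k ≡ f' k) → (∀ k → g k ≡ g' k) → ∀ k → convolve f g k ≡ convolve f' g' k
  convolve-cong f≡ g≡ zero    = ≡.cong₂ ℤ._*_ (f≡ 0) (g≡ 0)
  convolve-cong f≡ g≡ (suc k) = ≡.cong₂ ℤ._+_ (≡.cong₂ ℤ._*_ (f≡ 0) (g≡ (suc k))) (convolve-cong (f≡ ∘ suc) g≡ k)

  -- The shape c f + f' fits three uses: the recursive clause of `convolve` in the proof of
  -- associativity, c = 1 for distributivity, and c = -1 for changes of sign.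
  convolve-linear : ∀ c f f' g k → convolve (λ i → c ℤ.* f i ℤ.+ f' i) g k ≡ c ℤ.* convolve f g k ℤ.+ convolve f' g k
  convolve-linear c f f' g zero = lemma c (f 0) (f' 0) (g 0)
    where lemma : ∀ c a b d → (c ℤ.* a ℤ.+ b) ℤ.* d ≡ c ℤ.* (a ℤ.* d) ℤ.+ b ℤ.* d
          lemma = ℤSolver.solve-∀
  convolve-linear c f f' g (suc k) = ≡.trans (≡.cong (λ z → (c ℤ.* f 0 ℤ.+ f' 0) ℤ.* g (suc k) ℤ.+ z) (convolve-linear c (f ∘ suc) (f' ∘ suc) g k))
      (lemma c (f 0) (f' 0) (g (suc k)) (convolve (f ∘ suc) g k) (convolve (f' ∘ suc) g k))
    where lemma : ∀ c a b d u v → (c ℤ.* a ℤ.+ b) ℤ.* d ℤ.+ (c ℤ.* u ℤ.+ v) ≡ c ℤ.* (a ℤ.* d ℤ.+ u) ℤ.+ (b ℤ.* d ℤ.+ v)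
          lemma = ℤSolver.solve-∀

  convolve-last : ∀ f g k → convolve f g (suc k) ≡ convolve f (g ∘ suc) k ℤ.+ f (suc k) ℤ.* g 0
  convolve-last f g zero    = ≡.refl
  convolve-last f g (suc k) = ≡.trans (≡.cong (λ z → f 0 ℤ.* g (suc (suc k)) ℤ.+ z) (convolve-last (f ∘ suc) g k))
    (≡.sym (ℤₚ.+-assoc (f 0 ℤ.* g (suc (suc k))) (convolve (f ∘ suc) (g ∘ suc) k) (f (suc (suc k)) ℤ.* g 0)))

  convolve-comm : ∀ f g k → convolve f g k ≡ convolve g f k
  convolve-comm f g zero    = ℤₚ.*-comm (f 0) (g 0)
  convolve-comm f g (suc k) = begin
    f 0 ℤ.* g (suc k) ℤ.+ convolve (f ∘ suc) g k ≡⟨ ≡.cong₂ ℤ._+_ (ℤₚ.*-comm (f 0) (g (suc k))) (convolve-comm (f ∘ suc) g k) ⟩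
    g (suc k) ℤ.* f 0 ℤ.+ convolve g (f ∘ suc) k ≡⟨ ℤₚ.+-comm (g (suc k) ℤ.* f 0) (convolve g (f ∘ suc) k) ⟩
    convolve g (f ∘ suc) k ℤ.+ g (suc k) ℤ.* f 0 ≡⟨ ≡.sym (convolve-last g f k) ⟩
    convolve g f (suc k) ∎

  convolve-assoc : ∀ f g h k → convolve (convolve f g) h k ≡ convolve f (convolve g h) k
  convolve-assoc f g h zero    = ℤₚ.*-assoc (f 0) (g 0) (h 0)
  convolve-assoc f g h (suc k) = begin
    f 0 ℤ.* g 0 ℤ.* h (suc k) ℤ.+ convolve (λ i → f 0 ℤ.* g (suc i) ℤ.+ convolve (f ∘ suc) g i) h k
      ≡⟨ ≡.cong (λ z → f 0 ℤ.* g 0 ℤ.* h (suc k) ℤ.+ z) (convolve-linear (f 0) (g ∘ suc) (convolve (f ∘ suc) g) h k) ⟩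
    f 0 ℤ.* g 0 ℤ.* h (suc k) ℤ.+ (f 0 ℤ.* convolve (g ∘ suc) h k ℤ.+ convolve (convolve (f ∘ suc) g) h k)
      ≡⟨ ≡.cong (λ z → f 0 ℤ.* g 0 ℤ.* h (suc k) ℤ.+ (f 0 ℤ.* convolve (g ∘ suc) h k ℤ.+ z)) (convolve-assoc (f ∘ suc) g h k) ⟩
    f 0 ℤ.* g 0 ℤ.* h (suc k) ℤ.+ (f 0 ℤ.* convolve (g ∘ suc) h k ℤ.+ convolve (f ∘ suc) (convolve g h) k)
      ≡⟨ lemma (f 0) (g 0) (h (suc k)) (convolve (g ∘ suc) h k) (convolve (f ∘ suc) (convolve g h) k) ⟩
    f 0 ℤ.* (g 0 ℤ.* h (suc k) ℤ.+ convolve (g ∘ suc) h k) ℤ.+ convolve (f ∘ suc) (convolve g h) k ∎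
    where lemma : ∀ a b c u v → a ℤ.* b ℤ.* c ℤ.+ (a ℤ.* u ℤ.+ v) ≡ a ℤ.* (b ℤ.* c ℤ.+ u) ℤ.+ v
          lemma = ℤSolver.solve-∀

  convolve-zero : ∀ g k → convolve (λ _ → ℤ.+ 0) g k ≡ ℤ.+ 0
  convolve-zero g zero    = ≡.refl
  convolve-zero g (suc k) = ≡.trans (ℤₚ.+-identityˡ _) (convolve-zero g k)

  coeff-+ : ∀ p q k → coeff (p +ₚ q) k ≡ coeff p k ℤ.+ coeff q k
  coeff-+ []      q       k       = ≡.sym (ℤₚ.+-identityˡ _)
  coeff-+ (a ∷ p) []      k       = ≡.sym (ℤₚ.+-identityʳ _)
  coeff-+ (a ∷ p) (b ∷ q) zero    = ≡.refl
  coeff-+ (a ∷ p) (b ∷ q) (suc k) = coeff-+ p q k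

  coeff-scale : ∀ c p k → coeff (scaleₚ c p) k ≡ c ℤ.* coeff p k
  coeff-scale c []      k       = ≡.sym (ℤₚ.*-zeroʳ c)
  coeff-scale c (a ∷ p) zero    = ≡.refl
  coeff-scale c (a ∷ p) (suc k) = coeff-scale c p k

  coeff-* : ∀ p q k → coeff (p *ₚ q) k ≡ convolve (coeff p) (coeff q) k
  coeff-* []      q k       = ≡.sym (convolve-zero (coeff q) k)
  coeff-* (a ∷ p) q zero    = ≡.trans (coeff-+ (scaleₚ a q) _ 0) (≡.trans (ℤₚ.+-identityʳ _) (coeff-scale a q 0))
  coeff-* (a ∷ p) q (suc k) = ≡.trans (coeff-+ (scaleₚ a q) _ (suc k)) (≡.cong₂ ℤ._+_ (coeff-scale a q (suc k)) (coeff-* p q k))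

  -ₚ_ : Poly → Poly
  -ₚ_ = scaleₚ (ℤ.- ℤ.+ 1)

  1ₚ xₚ : Poly
  1ₚ = ℤ.+ 1 ∷ []
  -- x = - λ, so that det (λ I - L) = (-1)^n det (x I + L)
  xₚ = ℤ.+ 0 ∷ ℤ.- ℤ.+ 1 ∷ []

  private
    *-comm : ∀ p q → p *ₚ q ≗ₚ q *ₚ p
    *-comm p q k = ≡.trans (coeff-* p q k) (≡.trans (convolve-comm (coeff p) (coeff q) k) (≡.sym (coeff-* q p k)))

    *-assoc : ∀ p q r → (p *ₚ q) *ₚ r ≗ₚ p *ₚ (q *ₚ r)
    *-assoc p q r k = begin
      coeff ((p *ₚ q) *ₚ r) k                                  ≡⟨ coeff-* (p *ₚ q) r k ⟩
      convolve (coeff (p *ₚ q)) (coeff r) k                    ≡⟨ convolve-cong (coeff-* p q) (λ _ → ≡.refl) k ⟩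
      convolve (convolve (coeff p) (coeff q)) (coeff r) k      ≡⟨ convolve-assoc (coeff p) (coeff q) (coeff r) k ⟩
      convolve (coeff p) (convolve (coeff q) (coeff r)) k      ≡⟨ convolve-cong (λ _ → ≡.refl) (coeff-* q r) k ⟨
      convolve (coeff p) (coeff (q *ₚ r)) k                    ≡⟨ coeff-* p (q *ₚ r) k ⟨
      coeff (p *ₚ (q *ₚ r)) k                                  ∎

    *-identityˡ : ∀ p → 1ₚ *ₚ p ≗ₚ p
    *-identityˡ p k = ≡.trans (coeff-* 1ₚ p k) (lemma k)
      where
      lemma : ∀ k → convolve (coeff 1ₚ) (coeff p) k ≡ coeff p k
      lemma zero    = ℤₚ.*-identityˡ _
      lemma (suc k) = ≡.trans (≡.cong₂ ℤ._+_ (ℤₚ.*-identityˡ (coeff p (suc k))) (convolve-zero (coeff p) k)) (ℤₚ.+-identityʳ _)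

    distribʳ : ∀ r p q → (p +ₚ q) *ₚ r ≗ₚ (p *ₚ r) +ₚ (q *ₚ r)
    distribʳ r p q k = begin
      coeff ((p +ₚ q) *ₚ r) k                                          ≡⟨ coeff-* (p +ₚ q) r k ⟩
      convolve (coeff (p +ₚ q)) (coeff r) k
        ≡⟨ convolve-cong (λ i → ≡.trans (coeff-+ p q i) (≡.cong (ℤ._+ coeff q i) (≡.sym (ℤₚ.*-identityˡ (coeff p i))))) (λ _ → ≡.refl) k ⟩
      convolve (λ i → ℤ.+ 1 ℤ.* coeff p i ℤ.+ coeff q i) (coeff r) k   ≡⟨ convolve-linear (ℤ.+ 1) (coeff p) (coeff q) (coeff r) k ⟩
      ℤ.+ 1 ℤ.* convolve (coeff p) (coeff r) k ℤ.+ convolve (coeff q) (coeff r) k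
        ≡⟨ ≡.cong₂ ℤ._+_ (≡.trans (ℤₚ.*-identityˡ _) (≡.sym (coeff-* p r k))) (≡.sym (coeff-* q r k)) ⟩
      coeff (p *ₚ r) k ℤ.+ coeff (q *ₚ r) k                            ≡⟨ coeff-+ (p *ₚ r) (q *ₚ r) k ⟨
      coeff ((p *ₚ r) +ₚ (q *ₚ r)) k                                   ∎

    +-cong : ∀ {p p' q q'} → p ≗ₚ p' → q ≗ₚ q' → (p +ₚ q) ≗ₚ (p' +ₚ q')
    +-cong {p} {p'} {q} {q'} e f k = ≡.trans (coeff-+ p q k) (≡.trans (≡.cong₂ ℤ._+_ (e k) (f k)) (≡.sym (coeff-+ p' q' k)))

    +-comm : ∀ p q → (p +ₚ q) ≗ₚ (q +ₚ p)
    +-comm p q k = ≡.trans (coeff-+ p q k) (≡.trans (ℤₚ.+-comm (coeff p k) (coeff q k)) (≡.sym (coeff-+ q p k)))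

    inverseˡ : ∀ p → ((-ₚ p) +ₚ p) ≗ₚ []
    inverseˡ p k = ≡.trans (coeff-+ (-ₚ p) p k) (≡.trans (≡.cong (ℤ._+ coeff p k) (coeff-scale (ℤ.- ℤ.+ 1) p k)) (lemma (coeff p k)))
      where lemma : ∀ a → ℤ.- ℤ.+ 1 ℤ.* a ℤ.+ a ≡ ℤ.+ 0
            lemma = ℤSolver.solve-∀

  polyRing : CommutativeRing 0ℓ 0ℓ
  polyRing = record
    { Carrier = Poly ; _≈_ = _≈ₚ_ ; _+_ = _+ₚ_ ; _*_ = _*ₚ_ ; -_ = -ₚ_ ; 0# = [] ; 1# = 1ₚ
    ; isCommutativeRing = record
      { isRing = record
        { +-isAbelianGroup = record
          { isGroup = record
            { isMonoid = record
              { isSemigroup = record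
                { isMagma = record
                  { isEquivalence = record
                    { refl  = coefficientwise λ _ → ≡.refl
                    ; sym   = λ e → coefficientwise λ k → ≡.sym (at e k)
                    ; trans = λ e f → coefficientwise λ k → ≡.trans (at e k) (at f k) }
                  ; ∙-cong = λ {p} {p'} {q} {q'} e f → coefficientwise (+-cong {p} {p'} {q} {q'} (at e) (at f)) }
                ; assoc = λ p q r → coefficientwise λ k → ≡.trans (coeff-+ (p +ₚ q) r k) (≡.trans (≡.cong (ℤ._+ coeff r k) (coeff-+ p q k))
                    (≡.trans (ℤₚ.+-assoc (coeff p k) (coeff q k) (coeff r k))
                      (≡.sym (≡.trans (coeff-+ p (q +ₚ r) k) (≡.cong (λ z → coeff p k ℤ.+ z) (coeff-+ q r k)))))) }
              ; identity = (λ p → coefficientwise λ k → ≡.refl) , (λ p → coefficientwise (+-comm p [])) }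
            ; inverse = (λ p → coefficientwise (inverseˡ p))
                      , (λ p → coefficientwise λ k → ≡.trans (+-comm p (-ₚ p) k) (inverseˡ p k))
            ; ⁻¹-cong = λ {p} {q} e → coefficientwise λ k →
                ≡.trans (coeff-scale _ p k) (≡.trans (≡.cong (λ z → ℤ.- ℤ.+ 1 ℤ.* z) (at e k)) (≡.sym (coeff-scale _ q k))) }
          ; comm = λ p q → coefficientwise (+-comm p q) }
        ; *-cong = λ {p} {p'} {q} {q'} e f → coefficientwise λ k →
            ≡.trans (coeff-* p q k) (≡.trans (convolve-cong (at e) (at f) k) (≡.sym (coeff-* p' q' k)))
        ; *-assoc = λ p q r → coefficientwise (*-assoc p q r)
        ; *-identity = (λ p → coefficientwise (*-identityˡ p))
                     , (λ p → coefficientwise λ k → ≡.trans (*-comm p 1ₚ k) (*-identityˡ p k))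
        ; distrib = (λ r p q → coefficientwise λ k → ≡.trans (*-comm r (p +ₚ q) k) (≡.trans (distribʳ r p q k)
                       (+-cong {p *ₚ r} {r *ₚ p} {q *ₚ r} {r *ₚ q} (*-comm p r) (*-comm q r) k)))
                  , (λ r p q → coefficientwise (distribʳ r p q)) }
      ; *-comm = λ p q → coefficientwise (*-comm p q) } }

  signℕ-suc : ∀ k → signℕ (suc k) ≡ ℤ.- signℕ k
  signℕ-suc zero          = ≡.refl
  signℕ-suc (suc zero)    = ≡.refl
  signℕ-suc (suc (suc k)) = signℕ-suc k

  private
    PosSeq : (ℕ → ℤ) → Set
    PosSeq f = ∀ k → ℤ.+ 0 ℤ.≤ signℕ k ℤ.* f k

    0≤+ : ∀ {a b} → ℤ.+ 0 ℤ.≤ a → ℤ.+ 0 ℤ.≤ b → ℤ.+ 0 ℤ.≤ a ℤ.+ b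
    0≤+ p q = ℤₚ.+-mono-≤ p q

    0≤* : ∀ {a b} → ℤ.+ 0 ℤ.≤ a → ℤ.+ 0 ℤ.≤ b → ℤ.+ 0 ℤ.≤ a ℤ.* b
    0≤* {ℤ.+ m} {ℤ.+ n} _ _ = ≡.subst (ℤ.+ 0 ℤ.≤_) (ℤₚ.pos-* m n) (ℤ.+≤+ z≤n)

    -- A shift by one reverses all expected signs, so the tail is positive only after negation. The
    -- added 0 plays the part of f' in `convolve-linear`.
    PosSeq-tail : ∀ {f} → PosSeq f → PosSeq (λ k → ℤ.- ℤ.+ 1 ℤ.* f (suc k) ℤ.+ ℤ.+ 0)
    PosSeq-tail {f} pf k = ≡.subst (ℤ.+ 0 ℤ.≤_)
      (≡.trans (≡.cong (ℤ._* f (suc k)) (signℕ-suc k)) (lemma (signℕ k) (f (suc k)))) (pf (suc k))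
      where lemma : ∀ s a → (ℤ.- s) ℤ.* a ≡ s ℤ.* (ℤ.- ℤ.+ 1 ℤ.* a ℤ.+ ℤ.+ 0)
            lemma = ℤSolver.solve-∀

    PosSeq-convolve : ∀ {f g} → PosSeq f → PosSeq g → PosSeq (convolve f g)
    PosSeq-convolve {f} {g} pf pg zero = ≡.subst (ℤ.+ 0 ℤ.≤_) (lemma (f 0) (g 0)) (0≤* (pf 0) (pg 0))
      where lemma : ∀ a b → (ℤ.+ 1 ℤ.* a) ℤ.* (ℤ.+ 1 ℤ.* b) ≡ ℤ.+ 1 ℤ.* (a ℤ.* b)
            lemma = ℤSolver.solve-∀
    PosSeq-convolve {f} {g} pf pg (suc k) = ≡.subst (ℤ.+ 0 ℤ.≤_) eq
      (0≤+ (0≤* (pf 0) (pg (suc k))) (PosSeq-convolve {g = g} (PosSeq-tail {f} pf) pg k))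
      where
      lemma : ∀ a b c u s → c ≡ ℤ.- s → (ℤ.+ 1 ℤ.* a) ℤ.* (c ℤ.* b) ℤ.+ s ℤ.* (ℤ.- ℤ.+ 1 ℤ.* u ℤ.+ ℤ.+ 0) ≡ c ℤ.* (a ℤ.* b ℤ.+ u)
      lemma a b c u s ≡.refl = lem a b u s
        where lem : ∀ a b u s → (ℤ.+ 1 ℤ.* a) ℤ.* ((ℤ.- s) ℤ.* b) ℤ.+ s ℤ.* (ℤ.- ℤ.+ 1 ℤ.* u ℤ.+ ℤ.+ 0) ≡ (ℤ.- s) ℤ.* (a ℤ.* b ℤ.+ u)
              lem = ℤSolver.solve-∀
      eq = ≡.trans (≡.cong (λ z → (ℤ.+ 1 ℤ.* f 0) ℤ.* (signℕ (suc k) ℤ.* g (suc k)) ℤ.+ signℕ k ℤ.* z)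
             (≡.trans (convolve-linear (ℤ.- ℤ.+ 1) (f ∘ suc) (λ _ → ℤ.+ 0) g k) (≡.cong (λ z → ℤ.- ℤ.+ 1 ℤ.* convolve (f ∘ suc) g k ℤ.+ z) (convolve-zero g k))))
             (lemma (f 0) (g (suc k)) (signℕ (suc k)) (convolve (f ∘ suc) g k) (signℕ k) (signℕ-suc k))

  -- Nonnegative coefficients in x = - λ.
  polyCone : PositiveCone polyRing
  polyCone = record
    { Pos      = λ p → PosSeq (coeff p)
    ; Pos-resp = λ e pp k → ≡.subst (λ z → ℤ.+ 0 ℤ.≤ signℕ k ℤ.* z) (at e k) (pp k)
    ; Pos-0    = λ k → ℤₚ.≤-reflexive (≡.sym (ℤₚ.*-zeroʳ (signℕ k)))
    ; Pos-1    = λ { zero → ℤ.+≤+ z≤n ; (suc k) → ℤₚ.≤-reflexive (≡.sym (ℤₚ.*-zeroʳ (signℕ (suc k)))) }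
    ; Pos-+    = λ {p} {q} pp pq k → ≡.subst (ℤ.+ 0 ℤ.≤_)
        (≡.trans (≡.sym (ℤₚ.*-distribˡ-+ (signℕ k) (coeff p k) (coeff q k))) (≡.cong (λ z → signℕ k ℤ.* z) (≡.sym (coeff-+ p q k))))
        (0≤+ (pp k) (pq k))
    ; Pos-*    = λ {p} {q} pp pq k → ≡.subst (λ z → ℤ.+ 0 ℤ.≤ signℕ k ℤ.* z) (≡.sym (coeff-* p q k)) (PosSeq-convolve {coeff p} {coeff q} pp pq k)
    }

  Pos-xₚ : PositiveCone.Pos polyCone xₚ
  Pos-xₚ zero          = ℤ.+≤+ z≤n
  Pos-xₚ (suc zero)    = ℤ.+≤+ z≤n
  Pos-xₚ (suc (suc k)) = ℤₚ.≤-reflexive (≡.sym (ℤₚ.*-zeroʳ (signℕ k)))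

-- From determinants over `Fin` to minors over lists

module DeterminantLink {V : Set} where
  open Polynomials
  open CommutativeRing polyRing
  open Algebra.Properties.Ring ring
  open Algebra.Properties.AbelianGroup +-abelianGroup using (⁻¹-∙-comm)
  open Relation.Binary.Reasoning.Setoid setoid
  open Determinant polyRing {V}
  open Signs polyRing {V}

  private
    sumₚ-cong : ∀ {n} {f g : Fin n → Poly} → (∀ j → f j ≈ g j) → sumₚ f ≈ sumₚ g
    sumₚ-cong {zero}  e = refl
    sumₚ-cong {suc n} e = +-cong (e Fin.zero) (sumₚ-cong (λ j → e (Fin.suc j)))

    sumₚ-neg : ∀ {n} (f : Fin n → Poly) → sumₚ (λ j → - f j) ≈ - sumₚ f
    sumₚ-neg {zero}  f = refl
    sumₚ-neg {suc n} f = trans (+-congˡ (sumₚ-neg (f ∘ Fin.suc))) (⁻¹-∙-comm (f Fin.zero) (sumₚ (f ∘ Fin.suc)))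

    scale-suc : ∀ k p → scaleₚ (signℕ (suc k)) p ≈ - scaleₚ (signℕ k) p
    scale-suc k p = coefficientwise λ i → ≡.trans (coeff-scale (signℕ (suc k)) p i) (≡.trans (≡.cong (ℤ._* coeff p i) (signℕ-suc k))
      (≡.trans (lemma (signℕ k) (coeff p i)) (≡.sym (≡.trans (coeff-scale _ (scaleₚ (signℕ k) p) i) (≡.cong (λ z → ℤ.- ℤ.+ 1 ℤ.* z) (coeff-scale (signℕ k) p i))))))
      where lemma : ∀ s a → (ℤ.- s) ℤ.* a ≡ ℤ.- ℤ.+ 1 ℤ.* (s ℤ.* a)
            lemma = ℤSolver.solve-∀

    scale-cong : ∀ c {p q} → p ≈ q → scaleₚ c p ≈ scaleₚ c q
    scale-cong c {p} {q} e = coefficientwise λ k → ≡.trans (coeff-scale c p k) (≡.trans (≡.cong (c ℤ.*_) (at e k)) (≡.sym (coeff-scale c q k)))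

    scale-one : ∀ p → scaleₚ (ℤ.+ 1) p ≈ p
    scale-one p = coefficientwise λ k → ≡.trans (coeff-scale (ℤ.+ 1) p k) (ℤₚ.*-identityˡ _)

    -- Passing over the first column lowers all later positions by one; this turns the alternating
    -- signs of the sum into the subtraction in `expand`.
    expand-as-sum : ∀ n ρ F (κ : Fin (suc n) → V) →
      sumₚ (λ j → scaleₚ (signℕ (toℕ j)) (ρ (κ j) * F (tabulate (κ ∘ punchIn j)))) ≈ expand ρ F (tabulate κ)
    expand-as-sum zero    ρ F κ = +-congʳ (scale-one (ρ (κ Fin.zero) * F []))
    expand-as-sum (suc n) ρ F κ = +-cong (scale-one (ρ (κ Fin.zero) * F (tabulate (κ ∘ Fin.suc)))) (begin
      sumₚ (λ j → scaleₚ (signℕ (suc (toℕ j))) (term j)) ≈⟨ sumₚ-cong (λ j → scale-suc (toℕ j) (term j)) ⟩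
      sumₚ (λ j → - scaleₚ (signℕ (toℕ j)) (term j))     ≈⟨ sumₚ-neg (λ j → scaleₚ (signℕ (toℕ j)) (term j)) ⟩
      - sumₚ (λ j → scaleₚ (signℕ (toℕ j)) (term j))     ≈⟨ -‿cong (expand-as-sum n ρ F' (κ ∘ Fin.suc)) ⟩
      - expand ρ F' (tabulate (κ ∘ Fin.suc)) ∎)
      where
      F' = λ ds → F (κ Fin.zero ∷ ds)
      term : Fin (suc n) → Poly
      term j = ρ (κ (Fin.suc j)) * F' (tabulate (κ ∘ Fin.suc ∘ punchIn j))

  det≈minor : ∀ n (M : Fin n → Fin n → Poly) m (ρ κ : Fin n → V) → (∀ i j → M i j ≈ m (ρ i) (κ j)) →
    det n M ≈ minor m (tabulate ρ) (tabulate κ)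
  det≈minor zero    M m ρ κ e = refl
  det≈minor (suc n) M m ρ κ e = trans
    (sumₚ-cong (λ j → scale-cong (signℕ (toℕ j))
      (*-cong (e Fin.zero j) (det≈minor n _ m (ρ ∘ Fin.suc) (κ ∘ punchIn j) (λ i k → e (Fin.suc i) (punchIn j k))))))
    (expand-as-sum n (m (ρ Fin.zero)) (minor m (tabulate (ρ ∘ Fin.suc))) κ)

-- Degrees and leaves computed from edge lists

sumℕ-cong : ∀ {n} {f g : Fin n → ℕ} → (∀ i → f i ≡ g i) → sumℕ f ≡ sumℕ g
sumℕ-cong {zero}  e = ≡.refl
sumℕ-cong {suc n} e = ≡.cong₂ ℕ._+_ (e Fin.zero) (sumℕ-cong (e ∘ Fin.suc))

sumℕ-zero : ∀ n → sumℕ {n} (λ _ → 0) ≡ 0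
sumℕ-zero zero    = ≡.refl
sumℕ-zero (suc n) = sumℕ-zero n

sumℕ-+ : ∀ {n} (f g : Fin n → ℕ) → sumℕ (λ i → f i ℕ.+ g i) ≡ sumℕ f ℕ.+ sumℕ g
sumℕ-+ {zero}  f g = ≡.refl
sumℕ-+ {suc n} f g = ≡.trans (≡.cong (f Fin.zero ℕ.+ g Fin.zero ℕ.+_) (sumℕ-+ (f ∘ Fin.suc) (g ∘ Fin.suc)))
  (lemma (f Fin.zero) (g Fin.zero) (sumℕ (f ∘ Fin.suc)) (sumℕ (g ∘ Fin.suc)))
  where lemma : ∀ a b c d → a ℕ.+ b ℕ.+ (c ℕ.+ d) ≡ a ℕ.+ c ℕ.+ (b ℕ.+ d)
        lemma = solve-∀

sumℕ-* : ∀ {n} c (f : Fin n → ℕ) → sumℕ (λ i → c ℕ.* f i) ≡ c ℕ.* sumℕ f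
sumℕ-* {zero}  c f = ≡.sym (ℕₚ.*-zeroʳ c)
sumℕ-* {suc n} c f = ≡.trans (≡.cong (c ℕ.* f Fin.zero ℕ.+_) (sumℕ-* c (f ∘ Fin.suc))) (≡.sym (ℕₚ.*-distribˡ-+ c (f Fin.zero) (sumℕ (f ∘ Fin.suc))))

module EdgeLists {V : Set} (_≟_ : DecidableEquality V) where
  open Attachments _≟_

  eqBit : V → V → ℕ
  eqBit u v = bit (does (u ≟ v))

  eqBit-refl : ∀ v → eqBit v v ≡ 1
  eqBit-refl v = ≡.cong bit (≟-refl v)

  eqBit-≢ : ∀ {u v} → u ≢ v → eqBit u v ≡ 0
  eqBit-≢ u≢v = ≡.cong bit (≟-≢ u≢v)

  link : V × V → V → V → ℕ
  link (p , q) u v = eqBit u p ℕ.* eqBit v q ℕ.+ eqBit u q ℕ.* eqBit v p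

  links : List (V × V) → V → V → ℕ
  links []      u v = 0
  links (e ∷ E) u v = link e u v ℕ.+ links E u v

  Loopless : List (V × V) → Set
  Loopless = All (λ e → proj₁ e ≢ proj₂ e)

  -- Adjacency is compared with a count of list edges: one equation says which edges occur and that
  -- none is repeated, and summing it over the vertices gives the degrees.
  record Represents {n} (G : Graph n) (ρ : Fin n → V) (E : List (V × V)) : Set where
    field
      adjacency : ∀ i j → bit (adj G i j) ≡ links E (ρ i) (ρ j)
      injective : ∀ i j → ρ i ≡ ρ j → i ≡ j
      loopless  : Loopless E
      endpoints : All (λ e → (∃ λ i → ρ i ≡ proj₁ e) × (∃ λ i → ρ i ≡ proj₂ e)) E

    private
      sum-point : ∀ {m} (σ : Fin m → V) → (∀ i j → σ i ≡ σ j → i ≡ j) → ∀ k → sumℕ (λ j → eqBit (σ j) (σ k)) ≡ 1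
      sum-point {suc m} σ inj Fin.zero = ≡.cong₂ ℕ._+_ (eqBit-refl (σ Fin.zero))
        (≡.trans (sumℕ-cong (λ j → eqBit-≢ (λ e → suc≢zero (inj (Fin.suc j) Fin.zero e)))) (sumℕ-zero m))
        where suc≢zero : ∀ {m} {j : Fin m} → Fin.suc j ≢ Fin.zero
              suc≢zero ()
      sum-point σ inj (Fin.suc k) = ≡.cong₂ ℕ._+_ (eqBit-≢ (λ e → zero≢suc (inj Fin.zero (Fin.suc k) e)))
        (sum-point (σ ∘ Fin.suc) (λ i j e → Finₚ.suc-injective (inj (Fin.suc i) (Fin.suc j) e)) k)
        where zero≢suc : ∀ {m} {j : Fin m} → Fin.zero ≢ Fin.suc j
              zero≢suc ()

      sum-endpoint : ∀ {p} → (∃ λ i → ρ i ≡ p) → sumℕ (λ j → eqBit (ρ j) p) ≡ 1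
      sum-endpoint (i , ≡.refl) = sum-point ρ injective i

      sum-links : ∀ {F} → All (λ e → (∃ λ i → ρ i ≡ proj₁ e) × (∃ λ i → ρ i ≡ proj₂ e)) F →
        ∀ u → sumℕ (λ j → links F u (ρ j)) ≡ degree F u
      sum-links [] u = sumℕ-zero n
      sum-links {(p , q) ∷ F} ((hp , hq) ∷ hs) u = begin
        sumℕ (λ j → link (p , q) u (ρ j) ℕ.+ links F u (ρ j))
          ≡⟨ sumℕ-+ (λ j → link (p , q) u (ρ j)) _ ⟩
        sumℕ (λ j → link (p , q) u (ρ j)) ℕ.+ sumℕ (λ j → links F u (ρ j))
          ≡⟨ ≡.cong₂ ℕ._+_ (sumℕ-+ (λ j → eqBit u p ℕ.* eqBit (ρ j) q) _) (sum-links hs u) ⟩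
        sumℕ (λ j → eqBit u p ℕ.* eqBit (ρ j) q) ℕ.+ sumℕ (λ j → eqBit u q ℕ.* eqBit (ρ j) p) ℕ.+ degree F u
          ≡⟨ ≡.cong (ℕ._+ degree F u) (≡.cong₂ ℕ._+_ (total p q hq) (total q p hp)) ⟩
        eqBit u p ℕ.+ eqBit u q ℕ.+ degree F u ∎
        where
        open ≡.≡-Reasoning
        total : ∀ p q → (∃ λ i → ρ i ≡ q) → sumℕ (λ j → eqBit u p ℕ.* eqBit (ρ j) q) ≡ eqBit u p
        total p q h = ≡.trans (sumℕ-* (eqBit u p) (λ j → eqBit (ρ j) q))
          (≡.trans (≡.cong (eqBit u p ℕ.*_) (sum-endpoint h)) (ℕₚ.*-identityʳ (eqBit u p)))

    deg≡degree : ∀ i → deg G i ≡ degree E (ρ i)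
    deg≡degree i = ≡.trans (sumℕ-cong (adjacency i)) (sum-links endpoints (ρ i))

    leafCount≡vertexLeaves : leafCount G ≡ sum (map (vertexLeaves E (const pt)) (tabulate ρ))
    leafCount≡vertexLeaves = ≡.trans (sumℕ-cong (λ i → ≡.trans (≡.cong isOne (deg≡degree i))
        (≡.trans (≡.cong isOne (≡.sym (ℕₚ.+-identityʳ (degree E (ρ i))))) (≡.sym (ℕₚ.+-identityʳ _))))) (sumℕ-tabulate ρ)
      where
      f = vertexLeaves E (const pt)
      sumℕ-tabulate : ∀ {m} (σ : Fin m → V) → sumℕ (λ i → f (σ i)) ≡ sum (map f (tabulate σ))
      sumℕ-tabulate {zero}  σ = ≡.refl
      sumℕ-tabulate {suc m} σ = ≡.cong (f (σ Fin.zero) ℕ.+_) (sumℕ-tabulate (σ ∘ Fin.suc))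

-- The Laplacian characteristic polynomial in the variable x

module LaplacianEntries (R : CommutativeRing 0ℓ 0ℓ) (C : PositiveCone R)
    (x : CommutativeRing.Carrier R) (Pos-x : PositiveCone.Pos C x)
    {V : Set} (_≟_ : DecidableEquality V) where
  open CommutativeRing R
  open Algebra.Properties.AbelianGroup +-abelianGroup using (⁻¹-∙-comm; ε⁻¹≈ε)
  open Algebra.Properties.Semiring.Mult semiring using (×-homo-+) renaming (_×_ to _·_)
  open Relation.Binary.Reasoning.Setoid setoid
  open IntegerSolver R
  open WeightedLaplacian R C x Pos-x _≟_
  open EdgeLists _≟_
  open Attachments _≟_

  private
    edge-diagonal : ∀ p q u → p ≢ q → edgeLaplacian (p , q) u u ≈ incidence u (p , q) · 1#
    edge-diagonal p q u p≢q with u ≟ p | u ≟ q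
    ... | yes ≡.refl | yes ≡.refl = ⊥-elim (p≢q ≡.refl)
    ... | yes _      | no _       = solve 0 ((:1 :- :0) :* (:1 :- :0) := :1 :+ :0) refl
    ... | no _       | yes _      = solve 0 ((:0 :- :1) :* (:0 :- :1) := :1 :+ :0) refl
    ... | no _       | no _       = solve 0 ((:0 :- :0) :* (:0 :- :0) := :0) refl

    edge-offDiagonal : ∀ p q u v → p ≢ q → u ≢ v → edgeLaplacian (p , q) u v ≈ - (link (p , q) u v · 1#)
    edge-offDiagonal p q u v p≢q u≢v with u ≟ p | u ≟ q | v ≟ p | v ≟ q
    ... | yes ≡.refl | yes ≡.refl | _          | _          = ⊥-elim (p≢q ≡.refl)
    ... | yes ≡.refl | no _       | yes ≡.refl | _          = ⊥-elim (u≢v ≡.refl)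
    ... | yes _      | no _       | no _       | yes _      = solve 0 ((:1 :- :0) :* (:0 :- :1) := :- (:1 :+ :0)) refl
    ... | yes _      | no _       | no _       | no _       = solve 0 ((:1 :- :0) :* (:0 :- :0) := :- :0) refl
    ... | no _       | yes ≡.refl | _          | yes ≡.refl = ⊥-elim (u≢v ≡.refl)
    ... | no _       | yes _      | yes _      | no _       = solve 0 ((:0 :- :1) :* (:1 :- :0) := :- (:1 :+ :0)) refl
    ... | no _       | yes _      | no _       | no _       = solve 0 ((:0 :- :1) :* (:0 :- :0) := :- :0) refl
    ... | no _       | no _       | _          | _          = solve 1 (λ a → (:0 :- :0) :* a := :- :0) refl _

  laplacian-diagonal : ∀ E → Loopless E → ∀ u → laplacian E u u ≈ degree E u · 1#
  laplacian-diagonal [] [] u = refl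
  laplacian-diagonal ((p , q) ∷ E) (p≢q ∷ ll) u =
    trans (+-cong (edge-diagonal p q u p≢q) (laplacian-diagonal E ll u)) (sym (×-homo-+ 1# (incidence u (p , q)) (degree E u)))

  laplacian-offDiagonal : ∀ E → Loopless E → ∀ u v → u ≢ v → laplacian E u v ≈ - (links E u v · 1#)
  laplacian-offDiagonal [] [] u v _ = sym ε⁻¹≈ε
  laplacian-offDiagonal ((p , q) ∷ E) (p≢q ∷ ll) u v u≢v =
    trans (+-cong (edge-offDiagonal p q u v p≢q u≢v) (laplacian-offDiagonal E ll u v u≢v))
      (trans (⁻¹-∙-comm _ _) (-‿cong (sym (×-homo-+ 1# (link (p , q) u v) (links E u v)))))

module CharacteristicPolynomial {V : Set} (_≟_ : DecidableEquality V) where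
  open Polynomials
  open CommutativeRing polyRing
  open Algebra.Properties.Ring ring
  open Algebra.Properties.Semiring.Mult semiring using () renaming (_×_ to _·_)
  open Relation.Binary.Reasoning.Setoid setoid
  open Determinant polyRing {V}
  open Signs polyRing {V}
  open DeterminantLink {V}
  open RootedPairs polyRing polyCone xₚ Pos-xₚ
  open WeightedLaplacian polyRing polyCone xₚ Pos-xₚ _≟_
  open LaplacianEntries polyRing polyCone xₚ Pos-xₚ _≟_
  open EdgeLists _≟_
  open Attachments _≟_

  -- det (x I + L(E)) on the vertices vs
  laplacianPoly : List (V × V) → List V → Poly
  laplacianPoly E vs = minor (weighted E (const unit)) vs vs

  private
    constant : ∀ k → k · 1# ≈ ℤ.+ k ∷ []
    constant zero    = coefficientwise λ { zero → ≡.refl ; (suc k) → ≡.refl }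
    constant (suc k) = trans (+-congˡ (constant k)) (coefficientwise λ { zero → ≡.refl ; (suc k) → ≡.refl })

    minor-neg : ∀ m rs cs → minor (λ u v → - m u v) rs cs ≈ sign (length rs) * minor m rs cs
    minor-neg m []       cs = trans (empty cs) (sym (*-identityˡ _))
      where empty : ∀ cs → minor (λ u v → - m u v) [] cs ≈ minor m [] cs
            empty []      = refl
            empty (_ ∷ _) = refl
    minor-neg m (r ∷ rs) cs = begin
      expand (λ v → - m r v) (minor (λ u v → - m u v) rs) cs
        ≈⟨ expand-linearρ {ρ₃ = m r} (- 1#) 0# (minor (λ u v → - m u v) rs) cs (All.universal (λ c → entry (m r c)) cs) ⟩
      (- 1#) * expand (m r) (minor (λ u v → - m u v) rs) cs + 0# * expand (m r) (minor (λ u v → - m u v) rs) cs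
        ≈⟨ trans (entry′ _) (-‿cong (expand-congF (m r) (λ ds → trans (minor-neg m rs ds) (sym (+-identityʳ _))) cs)) ⟩
      - expand (m r) (λ ds → sign (length rs) * minor m rs ds + 0# * minor m rs ds) cs
        ≈⟨ -‿cong (expand-linearF (m r) (sign (length rs)) 0# (minor m rs) (minor m rs) cs) ⟩
      - (sign (length rs) * minor m (r ∷ rs) cs + 0# * minor m (r ∷ rs) cs)
        ≈⟨ -‿cong (+-identityʳ _) ⟩
      - (sign (length rs) * minor m (r ∷ rs) cs)
        ≈⟨ -‿distribˡ-* (sign (length rs)) (minor m (r ∷ rs) cs) ⟩
      - sign (length rs) * minor m (r ∷ rs) cs ∎
      where
      entry′ : ∀ a → (- 1#) * a + 0# * a ≈ - a
      entry′ a = trans (+-congˡ (zeroˡ a)) (trans (+-identityʳ _) (trans (sym (-‿distribˡ-* 1# a)) (-‿cong (*-identityˡ a))))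
      entry : ∀ a → - a ≈ (- 1#) * a + 0# * a
      entry a = sym (entry′ a)

    weighted-unit : ∀ E u v → weighted E (const unit) u v ≈ xₚ * δ u v + laplacian E u v
    weighted-unit E u v = trans (+-cong (*-identityˡ _) (zeroˡ (δ u v))) (+-identityʳ _)

  module _ {n} {G : Graph n} {ρ : Fin n → V} {E : List (V × V)} (rep : Represents G ρ E) where
    open Represents rep

    private
      entry : ∀ i j → charMatrix G i j ≈ - weighted E (const unit) (ρ i) (ρ j)
      entry i j with i Fin.≟ j
      ... | yes ≡.refl = begin
        charMatrix G i i
          ≡⟨ ≡.cong (λ b → if b then diag else off) (dec-true (toℕ i ℕₚ.≟ toℕ i) ≡.refl) ⟩
        diag
          ≈⟨ coefficientwise (λ { zero → lemma (ℤ.+ deg G i) ; (suc zero) → ≡.refl ; (suc (suc k)) → ≡.refl }) ⟩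
        - (xₚ + (ℤ.+ deg G i ∷ []))
          ≈⟨ -‿cong (+-cong (sym (trans (*-congˡ {xₚ} (δ-refl (ρ i))) (*-identityʳ xₚ)))
               (trans (sym (constant (deg G i))) (trans (reflexive (≡.cong (_· 1#) (deg≡degree i))) (sym (laplacian-diagonal E loopless (ρ i)))))) ⟩
        - (xₚ * δ (ρ i) (ρ i) + laplacian E (ρ i) (ρ i))
          ≈⟨ -‿cong (weighted-unit E (ρ i) (ρ i)) ⟨
        - weighted E (const unit) (ρ i) (ρ i) ∎
        where
        diag = (ℤ.- (ℤ.+ deg G i)) ∷ ℤ.+ 1 ∷ []
        off = if adj G i i then ℤ.+ 1 ∷ [] else []
        lemma : ∀ d → ℤ.- d ≡ ℤ.- ℤ.+ 1 ℤ.* (ℤ.+ 0 ℤ.+ d)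
        lemma = ℤSolver.solve-∀
      ... | no i≢j = begin
        charMatrix G i j
          ≡⟨ ≡.cong (λ b → if b then diag else off) (dec-false (toℕ i ℕₚ.≟ toℕ j) (λ e → i≢j (Finₚ.toℕ-injective e))) ⟩
        off
          ≈⟨ indicator (adj G i j) ⟩
        bit (adj G i j) · 1#
          ≡⟨ ≡.cong (_· 1#) (adjacency i j) ⟩
        links E (ρ i) (ρ j) · 1#
          ≈⟨ -‿involutive _ ⟨
        - - (links E (ρ i) (ρ j) · 1#)
          ≈⟨ -‿cong (trans (+-congʳ (zeroʳ xₚ)) (+-identityˡ _)) ⟨
        - (xₚ * 0# + - (links E (ρ i) (ρ j) · 1#))
          ≈⟨ -‿cong (+-cong (*-congˡ {xₚ} (δ-≢ ρi≢ρj)) (laplacian-offDiagonal E loopless (ρ i) (ρ j) ρi≢ρj)) ⟨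
        - (xₚ * δ (ρ i) (ρ j) + laplacian E (ρ i) (ρ j))
          ≈⟨ -‿cong (weighted-unit E (ρ i) (ρ j)) ⟨
        - weighted E (const unit) (ρ i) (ρ j) ∎
        where
        diag = (ℤ.- (ℤ.+ deg G i)) ∷ ℤ.+ 1 ∷ []
        off = if adj G i j then ℤ.+ 1 ∷ [] else []
        ρi≢ρj : ρ i ≢ ρ j
        ρi≢ρj e = i≢j (injective i j e)
        indicator : ∀ b → (if b then ℤ.+ 1 ∷ [] else []) ≈ bit b · 1#
        indicator true  = sym (+-identityʳ 1#)
        indicator false = refl

    -- The matrix λ I - L is the negative of x I + L, and each of its n rows contributes a factor
    -- -1.
    lapCharPoly≈ : lapCharPoly G ≈ sign n * laplacianPoly E (tabulate ρ)
    lapCharPoly≈ = trans (det≈minor n (charMatrix G) (λ u v → - weighted E (const unit) u v) ρ ρ entry)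
      (trans (minor-neg (weighted E (const unit)) (tabulate ρ) (tabulate ρ))
        (*-congʳ (reflexive (≡.cong sign (length-tabulate ρ)))))

module LaplacianCoefficients {V : Set} (_≟_ : DecidableEquality V) where
  open Polynomials
  open CommutativeRing polyRing using (_*_; *-identityˡ; sym; -‿cong)
  open Algebra.Properties.Ring (CommutativeRing.ring polyRing)
  open Signs polyRing {V}
  open EdgeLists _≟_
  open CharacteristicPolynomial _≟_

  private
    sign-coefficient : ∀ n p k → coeff (sign n * p) k ≡ signℕ n ℤ.* coeff p k
    sign-coefficient zero    p k = ≡.trans (at (*-identityˡ p) k) (≡.sym (ℤₚ.*-identityˡ _))
    sign-coefficient (suc n) p k = ≡.trans (at (sym (-‿distribˡ-* (sign n) p)) k)
      (≡.trans (coeff-scale _ (sign n * p) k) (≡.trans (≡.cong (λ z → ℤ.- ℤ.+ 1 ℤ.* z) (sign-coefficient n p k))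
        (≡.trans (lemma (signℕ n) (coeff p k)) (≡.cong (ℤ._* coeff p k) (≡.sym (signℕ-suc n))))))
      where lemma : ∀ s a → ℤ.- ℤ.+ 1 ℤ.* (s ℤ.* a) ≡ (ℤ.- s) ℤ.* a
            lemma = ℤSolver.solve-∀

    signℕ-+ : ∀ m n → signℕ (m ℕ.+ n) ≡ signℕ m ℤ.* signℕ n
    signℕ-+ zero    n = ≡.sym (ℤₚ.*-identityˡ _)
    signℕ-+ (suc m) n = ≡.trans (signℕ-suc (m ℕ.+ n)) (≡.trans (≡.cong ℤ.-_ (signℕ-+ m n))
      (≡.trans (ℤₚ.neg-distribˡ-* (signℕ m) (signℕ n)) (≡.cong (ℤ._* signℕ n) (≡.sym (signℕ-suc m)))))

    signℕ² : ∀ k → signℕ k ℤ.* signℕ k ≡ ℤ.+ 1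
    signℕ² zero          = ≡.refl
    signℕ² (suc zero)    = ≡.refl
    signℕ² (suc (suc k)) = signℕ² k

  -- The sign of k in the definition and the sign of n from the rows combine to that of n - k. So
  -- c_k is the coefficient of x^(n-k), which is what the positive cone controls.
  lapCoeff≡ : ∀ {n} {G : Graph n} {ρ : Fin n → V} {E} → Represents G ρ E → ∀ k → k ≤ n →
    lapCoeff G k ≡ signℕ (n ∸ k) ℤ.* coeff (laplacianPoly E (tabulate ρ)) (n ∸ k)
  lapCoeff≡ {n} {G} {ρ} {E} rep k k≤n = begin
    signℕ k ℤ.* coeff (lapCharPoly G) j
      ≡⟨ ≡.cong (λ z → signℕ k ℤ.* z) (≡.trans (at (lapCharPoly≈ rep) j) (sign-coefficient n P j)) ⟩
    signℕ k ℤ.* (signℕ n ℤ.* coeff P j)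
      ≡⟨ ≡.cong (λ s → signℕ k ℤ.* (s ℤ.* coeff P j)) (≡.trans (≡.cong signℕ (≡.sym (ℕₚ.m∸n+n≡m k≤n))) (signℕ-+ j k)) ⟩
    signℕ k ℤ.* (signℕ j ℤ.* signℕ k ℤ.* coeff P j)
      ≡⟨ lemma (signℕ k) (signℕ j) (coeff P j) ⟩
    signℕ k ℤ.* signℕ k ℤ.* (signℕ j ℤ.* coeff P j)
      ≡⟨ ≡.cong (ℤ._* (signℕ j ℤ.* coeff P j)) (signℕ² k) ⟩
    ℤ.+ 1 ℤ.* (signℕ j ℤ.* coeff P j)
      ≡⟨ ℤₚ.*-identityˡ _ ⟩
    signℕ j ℤ.* coeff P j ∎
    where
    open ≡.≡-Reasoning
    j = n ∸ k
    P = laplacianPoly E (tabulate ρ)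
    lemma : ∀ s t a → s ℤ.* (t ℤ.* s ℤ.* a) ≡ s ℤ.* s ℤ.* (t ℤ.* a)
    lemma = ℤSolver.solve-∀

-- A cycle with trees hanging at its vertices

mapEdge : {V W : Set} → (V → W) → V × V → W × W
mapEdge f (p , q) = f p , f q

cycleEdgesFrom-bounds : ∀ s k → All (λ e → (s ≤ proj₁ e) × (proj₂ e ≡ suc (proj₁ e)) × (proj₁ e < s ℕ.+ k)) (cycleEdgesFrom s k)
cycleEdgesFrom-bounds s zero    = []
cycleEdgesFrom-bounds s (suc k) = (≤-refl , ≡.refl , m<m+n s (s≤s z≤n)) ∷
  All.map (λ { {e} (lo , eq , hi) → <⇒≤ lo , eq , ≡.subst (proj₁ e <_) (≡.sym (+-suc s k)) hi }) (cycleEdgesFrom-bounds (suc s) k)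

cycleEdges-bounds : ∀ q → All (λ e → (proj₁ e ≤ q) × (proj₂ e ≤ q)) (cycleEdges q)
cycleEdges-bounds q = (≤-refl , z≤n) ∷ All.map (λ { (_ , ≡.refl , hi) → <⇒≤ hi , hi }) (cycleEdgesFrom-bounds 0 q)

module CycleDegrees where
  open Attachments ℕₚ._≟_
  open EdgeLists ℕₚ._≟_

  private
    degree-shift : ∀ s k i → degree (cycleEdgesFrom (suc s) k) (suc i) ≡ degree (cycleEdgesFrom s k) i
    degree-shift s zero    i = ≡.refl
    degree-shift s (suc k) i = ≡.cong (incidence i (s , suc s) ℕ.+_) (degree-shift (suc s) k i)

    degree-zero : ∀ s k → degree (cycleEdgesFrom (suc s) k) 0 ≡ 0
    degree-zero s zero    = ≡.refl
    degree-zero s (suc k) = degree-zero (suc s) k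

    path-degree : ∀ q i → i ≤ q → eqBit i q ℕ.+ eqBit i 0 ℕ.+ degree (cycleEdgesFrom 0 q) i ≡ 2
    path-degree zero    zero    _ = ≡.refl
    path-degree (suc q) zero    _ = ≡.cong (2 ℕ.+_) (degree-zero 0 q)
    path-degree (suc q) (suc i) (s≤s i≤q) = ≡.trans
      (≡.cong (λ z → eqBit i q ℕ.+ 0 ℕ.+ (eqBit i 0 ℕ.+ z)) (degree-shift 0 q i))
      (≡.trans (lemma (eqBit i q) (eqBit i 0) (degree (cycleEdgesFrom 0 q) i)) (path-degree q i i≤q))
      where lemma : ∀ a b c → a ℕ.+ 0 ℕ.+ (b ℕ.+ c) ≡ a ℕ.+ b ℕ.+ c
            lemma = solve-∀

  cycle-degree : ∀ q i → i ≤ q → degree (cycleEdges q) i ≡ 2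
  cycle-degree = path-degree

-- The two graphs to be compared have different vertex types. Numbering their cycle vertices by κ
-- brings both determinants to minors over the same numbers 0 to q; beyond q nothing is assumed of
-- κ.
module CycleWithTrees {V : Set} (_≟_ : DecidableEquality V) (κ : ℕ → V) (q : ℕ)
    (κ-injective : ∀ {i j} → i ≤ q → j ≤ q → κ i ≡ κ j → i ≡ j) where
  open Polynomials
  open CommutativeRing polyRing
  open Relation.Binary.Reasoning.Setoid setoid
  open RootedPairs polyRing polyCone xₚ Pos-xₚ
  open Attachments _≟_
  open EdgeLists _≟_
  open CharacteristicPolynomial _≟_
  open WeightedLaplacian polyRing polyCone xₚ Pos-xₚ _≟_
  private
    module Idx = WeightedLaplacian polyRing polyCone xₚ Pos-xₚ ℕₚ._≟_
    module IdxA = Attachments ℕₚ._≟_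
  open Determinant polyRing

  cycle : List V
  cycle = map κ (upFrom 0 (suc q))

  edges : List (V × V)
  edges = map (mapEdge κ) (cycleEdges q)

  private
    upFrom≤q : All (_≤ q) (upFrom 0 (suc q))
    upFrom≤q = All-upFrom 0 (suc q) (λ z _ hi → ≤-pred hi)

    does-κ : ∀ {i j} → i ≤ q → j ≤ q → does (κ i ≟ κ j) ≡ does (i ℕₚ.≟ j)
    does-κ {i} {j} i≤ j≤ with i ℕₚ.≟ j
    ... | yes ≡.refl = ≡.trans (≟-refl (κ i)) (≡.sym (IdxA.≟-refl i))
    ... | no i≢j     = ≡.trans (≟-≢ (λ e → i≢j (κ-injective i≤ j≤ e))) (≡.sym (IdxA.≟-≢ i≢j))

    δ-κ : ∀ {i j} → i ≤ q → j ≤ q → δ (κ i) (κ j) ≈ Idx.δ i j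
    δ-κ i≤ j≤ = reflexive (≡.cong (if_then 1# else 0#) (does-κ i≤ j≤))

    laplacian-κ : ∀ F → All (λ e → (proj₁ e ≤ q) × (proj₂ e ≤ q)) F → ∀ {i j} → i ≤ q → j ≤ q →
      laplacian (map (mapEdge κ) F) (κ i) (κ j) ≈ Idx.laplacian F i j
    laplacian-κ [] [] _ _ = refl
    laplacian-κ ((a , b) ∷ F) ((a≤ , b≤) ∷ hs) i≤ j≤ = +-cong
      (*-cong (+-cong (δ-κ i≤ a≤) (-‿cong (δ-κ i≤ b≤))) (+-cong (δ-κ j≤ a≤) (-‿cong (δ-κ j≤ b≤))))
      (laplacian-κ F hs i≤ j≤)

    degree-κ : ∀ F → All (λ e → (proj₁ e ≤ q) × (proj₂ e ≤ q)) F → ∀ {i} → i ≤ q →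
      degree (map (mapEdge κ) F) (κ i) ≡ IdxA.degree F i
    degree-κ [] [] _ = ≡.refl
    degree-κ ((a , b) ∷ F) ((a≤ , b≤) ∷ hs) i≤ =
      ≡.cong₂ ℕ._+_ (≡.cong₂ (λ s t → bit s ℕ.+ bit t) (does-κ i≤ a≤) (does-κ i≤ b≤)) (degree-κ F hs i≤)

  ∈-cycle : ∀ {i} → i ≤ q → κ i ∈ cycle
  ∈-cycle {i} i≤ = ∈ₚ.∈-map⁺ κ (∈-upFrom 0 (suc q) z≤n (s≤s i≤))
    where
    ∈-upFrom : ∀ {z} s k → s ≤ z → z < s ℕ.+ k → z ∈ upFrom s k
    ∈-upFrom s zero lo hi = ⊥-elim (<⇒≱ hi (≡.subst (_≤ _) (≡.sym (ℕₚ.+-identityʳ s)) lo))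
    ∈-upFrom {z} s (suc k) lo hi with ℕₚ.m≤n⇒m<n∨m≡n lo
    ... | inj₁ lt     = there (∈-upFrom (suc s) k lt (≡.subst (z <_) (+-suc s k) hi))
    ... | inj₂ ≡.refl = here ≡.refl

  unique-cycle : Unique cycle
  unique-cycle = go 0 (suc q) (λ z _ hi → ≤-pred hi)
    where
    go : ∀ s k → (∀ z → s ≤ z → z < s ℕ.+ k → z ≤ q) → Unique (map κ (upFrom s k))
    go s zero    h = []
    go s (suc k) h = Allₚ.map⁺ (All-upFrom (suc s) k (λ z lo hi e →
        <⇒≢ lo (κ-injective (h s ≤-refl (m<m+n s (s≤s z≤n))) (h z (<⇒≤ lo) (≡.subst (z <_) (≡.sym (+-suc s k)) hi)) e)))
      ∷ go (suc s) k (λ z lo hi → h z (<⇒≤ lo) (≡.subst (z <_) (≡.sym (+-suc s k)) hi))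

  within-cycle : Within cycle edges
  within-cycle = Allₚ.map⁺ (All.map (λ { (a , b) → ∈-cycle a , ∈-cycle b }) (cycleEdges-bounds q))

  module _ {L : List (V × V)} (A : Attach cycle L) where

    tree : ℕ → Tree
    tree i = forest L (κ i)

    laplacianPoly-cycle : ∀ {vs} → vertices L cycle ↭ vs → laplacianPoly (L ʳ++ edges) vs
      ≈ minor (Idx.weighted (cycleEdges q) (pair ∘ tree)) (upFrom 0 (suc q)) (upFrom 0 (suc q))
    laplacianPoly-cycle {vs} p = begin
      laplacianPoly (L ʳ++ edges) vs                         ≈⟨ principal-↭ (weighted (L ʳ++ edges) (const unit)) (↭-sym p) ⟩
      laplacianPoly (L ʳ++ edges) (vertices L cycle)         ≈⟨ determinant-pruned unique-cycle within-cycle A ⟩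
      minor (weighted edges (pair ∘ forest L)) cycle cycle   ≈⟨ minor-map polyRing κ (weighted edges (pair ∘ forest L)) (upFrom 0 (suc q)) (upFrom 0 (suc q)) ⟩
      minor (λ i j → weighted edges (pair ∘ forest L) (κ i) (κ j)) (upFrom 0 (suc q)) (upFrom 0 (suc q))
        ≈⟨ minor-cong (_≤ q) (upFrom 0 (suc q))
             (All.map (λ {i} i≤ j j≤ → +-cong
               (*-congˡ {proj₁ (pair (tree i))} (+-cong (*-congˡ {xₚ} (δ-κ i≤ j≤)) (laplacian-κ (cycleEdges q) (cycleEdges-bounds q) i≤ j≤)))
               (*-congˡ {proj₂ (pair (tree i))} (δ-κ i≤ j≤))) upFrom≤q)
             (upFrom 0 (suc q)) upFrom≤q ⟩
      minor (Idx.weighted (cycleEdges q) (pair ∘ tree)) (upFrom 0 (suc q)) (upFrom 0 (suc q)) ∎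

    size-cycle : length (vertices L cycle) ≡ sum (map (suc ∘ size ∘ tree) (upFrom 0 (suc q)))
    size-cycle = ≡.trans (size-pruned unique-cycle A) (≡.cong sum (map-∘′ (upFrom 0 (suc q))))
      where
      map-∘′ : ∀ is → map (suc ∘ size ∘ forest L) (map κ is) ≡ map (suc ∘ size ∘ tree) is
      map-∘′ []       = ≡.refl
      map-∘′ (i ∷ is) = ≡.cong (suc (size (tree i)) ∷_) (map-∘′ is)

    leaves-cycle : sum (map (vertexLeaves (L ʳ++ edges) (const pt)) (vertices L cycle))
      ≡ sum (map (rootedLeaves ∘ tree) (upFrom 0 (suc q)))
    leaves-cycle = ≡.trans (leaves-pruned unique-cycle within-cycle A) (≡.cong sum (go _ upFrom≤q))
      where
      go : ∀ is → All (_≤ q) is → map (vertexLeaves edges (forest L)) (map κ is) ≡ map (rootedLeaves ∘ tree) is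
      go []       []         = ≡.refl
      go (i ∷ is) (i≤ ∷ is≤) = ≡.cong₂ _∷_
        -- A cycle vertex has degree 2 before its tree is counted, so `isOne` gives 0 and only the
        -- leaves inside the tree remain.
        (≡.cong (λ d → isOne (d ℕ.+ children (tree i)) ℕ.+ rootedLeaves (tree i))
          (≡.trans (degree-κ (cycleEdges q) (cycleEdges-bounds q) i≤) (CycleDegrees.cycle-degree q i i≤)))
        (go is is≤)

    tree-leafCount : ∀ {n} {G : Graph n} {ρ} → Represents G ρ (L ʳ++ edges) → vertices L cycle ↭ tabulate ρ →
      leafCount G ≡ sum (map (rootedLeaves ∘ tree) (upFrom 0 (suc q)))
    tree-leafCount rep p = ≡.trans (Represents.leafCount≡vertexLeaves rep)
      (≡.trans (sum-↭ (Perm.map⁺ (vertexLeaves (L ʳ++ edges) (const pt)) (↭-sym p))) leaves-cycle)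

    tree-size : ∀ {n} {ρ : Fin n → V} → vertices L cycle ↭ tabulate ρ →
      n ≡ sum (map (suc ∘ size ∘ tree) (upFrom 0 (suc q)))
    tree-size {ρ = ρ} p = ≡.trans (≡.sym (length-tabulate ρ)) (≡.trans (≡.sym (Perm.↭-length p)) size-cycle)

-- Edge lists without repetitions

module EdgeMultiplicity {V : Set} (_≟_ : DecidableEquality V) where
  open Attachments _≟_
  open EdgeLists _≟_

  loopless-attached : ∀ {vs E L} → Attach vs L → Loopless E → Loopless (L ʳ++ E)
  loopless-attached done             ll = ll
  loopless-attached (attach w∈ v∉ A) ll = loopless-attached A ((λ w≡v → All.lookup v∉ w∈ (≡.sym w≡v)) ∷ ll)

  within-attached : ∀ {vs E L} → Attach vs L → Within vs E → Within (vertices L vs) (L ʳ++ E)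
  within-attached done             W = W
  within-attached (attach w∈ v∉ A) W = within-attached A (within-attach w∈ W)

  links-sym : ∀ E u v → links E u v ≡ links E v u
  links-sym [] u v = ≡.refl
  links-sym ((p , q) ∷ E) u v = ≡.cong₂ ℕ._+_ (lemma (eqBit u p) (eqBit v q) (eqBit u q) (eqBit v p)) (links-sym E u v)
    where lemma : ∀ a b c d → a ℕ.* b ℕ.+ c ℕ.* d ≡ d ℕ.* c ℕ.+ b ℕ.* a
          lemma = solve-∀

  Simple : List (V × V) → Set
  Simple E = ∀ u v → links E u v ≤ 1

  private
    product-≢0 : ∀ a b c d → eqBit a b ℕ.* eqBit c d ≡ 0 ⊎ ((a ≡ b) × (c ≡ d))
    product-≢0 a b c d with a ≟ b | c ≟ d
    ... | yes a≡b | yes c≡d = inj₂ (a≡b , c≡d)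
    ... | yes _   | no _    = inj₁ ≡.refl
    ... | no _    | _       = inj₁ ≡.refl

  links-∈ : ∀ E u v → links E u v ≢ 0 → ((u , v) ∈ E) ⊎ ((v , u) ∈ E)
  links-∈ [] u v ne = ⊥-elim (ne ≡.refl)
  links-∈ ((p , q) ∷ E) u v ne with product-≢0 u p v q | product-≢0 u q v p
  ... | inj₂ (≡.refl , ≡.refl) | _ = inj₁ (here ≡.refl)
  ... | inj₁ _ | inj₂ (≡.refl , ≡.refl) = inj₂ (here ≡.refl)
  ... | inj₁ e | inj₁ e' with links-∈ E u v (λ z → ne (≡.cong₂ ℕ._+_ (≡.cong₂ ℕ._+_ e e') z))
  ...   | inj₁ h = inj₁ (there h)
  ...   | inj₂ h = inj₂ (there h)

  ∈-links : ∀ E u v → (u , v) ∈ E → 1 ≤ links E u v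
  ∈-links ((p , q) ∷ E) u v (here ≡.refl) rewrite ≟-refl u | ≟-refl v = s≤s z≤n
  ∈-links (e ∷ E) u v (there h) = ≤-trans (∈-links E u v h) (ℕₚ.m≤n+m (links E u v) (link e u v))

  links-∉ : ∀ E u v → (u , v) ∉ E → (v , u) ∉ E → links E u v ≡ 0
  links-∉ E u v uv∉ vu∉ with links E u v in eq
  ... | zero  = ≡.refl
  ... | suc k with links-∈ E u v (λ z → case (≡.trans (≡.sym eq) z))
    where case : suc k ≢ 0
          case ()
  ...   | inj₁ h = ⊥-elim (uv∉ h)
  ...   | inj₂ h = ⊥-elim (vu∉ h)

  simple-∷ : ∀ {E p q} → p ≢ q → (p , q) ∉ E → (q , p) ∉ E → Simple E → Simple ((p , q) ∷ E)
  simple-∷ {E} {p} {q} p≢q pq∉ qp∉ S u v with product-≢0 u p v q | product-≢0 u q v p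
  ... | inj₁ e | inj₁ e' = ≡.subst (_≤ 1) (≡.sym (≡.cong (ℕ._+ links E u v) (≡.cong₂ ℕ._+_ e e'))) (S u v)
  ... | inj₂ (≡.refl , ≡.refl) | _ = ≤-reflexive (≡.cong₂ ℕ._+_
          (≡.cong₂ ℕ._+_ (≡.cong₂ ℕ._*_ (eqBit-refl p) (eqBit-refl q)) (≡.cong (ℕ._* eqBit q p) (eqBit-≢ p≢q))) (links-∉ E p q pq∉ qp∉))
  ... | inj₁ _ | inj₂ (≡.refl , ≡.refl) = ≤-reflexive (≡.cong₂ ℕ._+_
          (≡.cong₂ ℕ._+_ (≡.cong (ℕ._* eqBit p q) (eqBit-≢ (λ e → p≢q (≡.sym e)))) (≡.cong₂ ℕ._*_ (eqBit-refl q) (eqBit-refl p))) (links-∉ E q p qp∉ pq∉))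

  simple-attached : ∀ {vs E L} → Attach vs L → Within vs E → Simple E → Simple (L ʳ++ E)
  simple-attached done W S = S
  simple-attached (attach {w = w} {v} w∈ v∉ A) W S = simple-attached A (within-attach w∈ W)
    (simple-∷ (λ w≡v → All.lookup v∉ w∈ (≡.sym w≡v)) (λ h → proj₂ (All.lookup av h) ≡.refl) (λ h → proj₁ (All.lookup av h) ≡.refl) S)
    where av = avoids v∉ W

  attached-new : ∀ {vs L w v} → Attach vs L → (w , v) ∈ L → v ∉ vs
  attached-new (attach w∈ v∉ A) (here ≡.refl) v∈ = All.lookup v∉ v∈ ≡.refl
  attached-new (attach w∈ v∉ A) (there e∈)    v∈ = attached-new A e∈ (there v∈)

module CycleEdges {V : Set} (_≟_ : DecidableEquality V) (κ : ℕ → V) (q : ℕ)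
    (κ-injective : ∀ {i j} → i ≤ q → j ≤ q → κ i ≡ κ j → i ≡ j) where
  open EdgeLists _≟_
  open EdgeMultiplicity _≟_
  open CycleWithTrees _≟_ κ q κ-injective

  private
    path-edge : ∀ s k {u v} → (u , v) ∈ map (mapEdge κ) (cycleEdgesFrom s k) →
      ∃ λ a → (s ≤ a) × (a < s ℕ.+ k) × (u ≡ κ a) × (v ≡ κ (suc a))
    path-edge s k h with ∈ₚ.∈-map⁻ (mapEdge κ) h
    ... | (a , b) , ab∈ , ≡.refl with All.lookup (cycleEdgesFrom-bounds s k) ab∈
    ...   | lo , ≡.refl , hi = a , lo , hi , ≡.refl , ≡.refl

    simple-path : ∀ s k → s ℕ.+ k ≤ q → Simple (map (mapEdge κ) (cycleEdgesFrom s k))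
    simple-path s zero    _  = λ _ _ → z≤n
    simple-path s (suc k) s+ = simple-∷
      (λ e → <⇒≢ (n<1+n s) (κ-injective s≤q s+1≤q e))
      (λ h → let (a , lo , hi , e , _) = path-edge (suc s) k h in
             <⇒≢ lo (κ-injective s≤q (a≤q hi) e))
      (λ h → let (a , lo , hi , e , e') = path-edge (suc s) k h in
             <⇒≢ (≤-trans lo (n≤1+n a)) (κ-injective s≤q (≤-trans hi s+'') e'))
      (simple-path (suc s) k s+'')
      where
      s+'' : suc s ℕ.+ k ≤ q
      s+'' = ≡.subst (_≤ q) (+-suc s k) s+
      s+1≤q : suc s ≤ q
      s+1≤q = ≤-trans (m≤m+n (suc s) k) s+''
      s≤q : s ≤ q
      s≤q = <⇒≤ s+1≤q
      a≤q : ∀ {a} → a < suc s ℕ.+ k → a ≤ q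
      a≤q hi = <⇒≤ (≤-trans hi s+'')

  -- For q = 1 the closing edge would double the edge between 0 and 1; this is excluded by the bound
  -- on the girth.
  simple-edges : 2 ≤ q → Simple edges
  simple-edges 2≤q = simple-∷
    (λ e → <⇒≢ 0<q (≡.sym (κ-injective ≤-refl z≤n e)))
    (λ h → let (a , lo , hi , e , _) = path-edge 0 q h in <⇒≢ hi (≡.sym (κ-injective ≤-refl (<⇒≤ hi) e)))
    (λ h → let (a , lo , hi , e , e') = path-edge 0 q h in
           <⇒≢ 2≤q (≡.sym (≡.trans (κ-injective ≤-refl hi e') (≡.cong suc (≡.sym (κ-injective z≤n (<⇒≤ hi) e))))))
    (simple-path 0 q ≤-refl)
    where 0<q = <⇒≤ 2≤q

  loopless-edges : 2 ≤ q → Loopless edges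
  loopless-edges 2≤q = (λ e → <⇒≢ (<⇒≤ 2≤q) (≡.sym (κ-injective ≤-refl z≤n e))) ∷
    Allₚ.map⁺ (All.map (λ { {a , _} (_ , ≡.refl , hi) e → <⇒≢ (n<1+n a) (κ-injective (<⇒≤ hi) hi e) }) (cycleEdgesFrom-bounds 0 q))

-- Two trees on a cycle against one balanced spider

module Comparison (R : CommutativeRing 0ℓ 0ℓ) (C : PositiveCone R)
    (x : CommutativeRing.Carrier R) (Pos-x : PositiveCone.Pos C x) where
  open CommutativeRing R
  open IntegerSolver R
  open PositiveCone C
  open Order R C
  open RootedPairs R C x Pos-x
  open Spiders R C x Pos-x
  open Determinant R {ℕ}
  open WeightedLaplacian R C x Pos-x ℕₚ._≟_
  open CycleDeterminant R C x Pos-x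
  open CycleValue R C x Pos-x

  private
    1⊑1+Pos : ∀ {p q} → 1# ⊑ p → Pos q → 1# ⊑ p + q
    1⊑1+Pos h pq = ⊑-+ʳ pq h

    1⊑* : ∀ {p q} → 1# ⊑ p → 1# ⊑ q → 1# ⊑ p * q
    1⊑* h k = ⊑-resp (*-identityˡ 1#) refl (⊑-* Pos-1 Pos-1 h k)

  1⊑pair : ∀ T → 1# ⊑ proj₁ (pair T)
  1⊑pair pt      = ⊑-refl
  1⊑pair (t ◃ s) = 1⊑* (1⊑1+Pos (1⊑* (1⊑1+Pos ⊑-refl Pos-x) (1⊑pair t)) (proj₂ (PosPair-pair t))) (1⊑pair s)

  -- A single planted branch has second component x b + c with b at least 1, and further branches at
  -- the root only enlarge it.
  x⊑pair : ∀ T → Nontrivial T → x ⊑ proj₂ (pair T)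
  x⊑pair (t ◃ s) _ = ⊑-+ʳ (Pos-* (proj₁ (PosPair-plant (PosPair-pair t))) (proj₂ (PosPair-pair s)))
    (⊑-resp (trans (*-congʳ (*-identityʳ x)) (*-identityʳ x)) refl
      (⊑-* (Pos-* Pos-x Pos-1) Pos-1
        (⊑-+ʳ (proj₂ (PosPair-pair t)) (⊑-* Pos-x Pos-1 ⊑-refl (1⊑pair t))) (1⊑pair s)))

  private
    total-mono : ∀ {t t' b b' h Δ c c' D} → Pos h → Pos Δ → Pos t → Pos b → t ⊑ t' → b ⊑ b' → x ⊑ c → x ⊑ c' → 1# ⊑ D →
      t * h + b * Δ + x * x ⊑ t' * h + b' * Δ + c * c' * D
    total-mono ph pΔ pos-t pos-b t⊑ b⊑ x⊑c x⊑c' 1⊑D = ⊑-+ (⊑-+ (⊑-* pos-t ph t⊑ ⊑-refl) (⊑-* pos-b pΔ b⊑ ⊑-refl))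
      (⊑-resp (*-identityʳ (x * x)) refl (⊑-* (Pos-* Pos-x Pos-x) Pos-1 (⊑-* Pos-x Pos-x x⊑c x⊑c') 1⊑D))

    Pos-total : ∀ {Z} → PosPair Z → Pos (total Z)
    Pos-total (p , p') = Pos-+ (Pos-* Pos-x p) p'

  module _ (i r : ℕ) (X Y : ℕ → Pair) (T S : Tree) (nT : Nontrivial T) (nS : Nontrivial S)
      (X₀ : X 0 ≡ pair T) (Xᵢ : X (suc i) ≡ pair S) (Xrest : All (λ z → X z ≋ unit) (without i r))
      (Y₀ : Y 0 ≋ bst (size T ℕ.+ size S) (rootedLeaves T ℕ.+ rootedLeaves S))
      (Yᵢ : Y (suc i) ≋ unit) (Yrest : All (λ z → Y z ≋ unit) (without i r)) where
    private
      q = suc (i ℕ.+ r)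
      vs = upFrom 0 (suc q)
      B = bst (size T ℕ.+ size S) (rootedLeaves T ℕ.+ rootedLeaves S)

      Y-bst : Y 0 ⊗ Y (suc i) ≋ B
      Y-bst = ⊗.trans (⊗.∙-cong Y₀ Yᵢ) (⊗.identityʳ B)

    -- The margin `x * x` is a lower bound for the term c c' D₂ of X; in Y that term vanishes
    -- because the pair at suc i is `unit`.
    cycle-comparison : minor (weighted (cycleEdges q) Y) vs vs + x * x ⊑ minor (weighted (cycleEdges q) X) vs vs
    cycle-comparison = ⊑-resp {p = total B * h + proj₁ B * Δ + x * x} {q = total Z * h + proj₁ Z * Δ + c * c' * D}
      (+-congʳ (sym (trans eY valueY))) (sym (trans eX valueX))
      (total-mono (proj₁ (pathMinor-increasing q)) (Pos-excess (i ℕ.+ r)) (Pos-total (PosPair-spider lens)) (proj₁ (PosPair-spider lens))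
        (bst-total T S nT nS) (bst-reduced T S nT nS) (x⊑pair T nT) (x⊑pair S nS) 1⊑D)
      where
      D    = proj₁ (cycle-value i r X Xrest)
      1⊑D  = proj₁ (proj₂ (cycle-value i r X Xrest))
      eX   = proj₂ (proj₂ (cycle-value i r X Xrest))
      D'   = proj₁ (cycle-value i r Y Yrest)
      eY   = proj₂ (proj₂ (cycle-value i r Y Yrest))
      lens = bstLengths (size T ℕ.+ size S) (rootedLeaves T ℕ.+ rootedLeaves S)
      h = pathMinor q
      Δ = excess (i ℕ.+ r)
      Z = pair T ⊗ pair S
      c = proj₂ (pair T)
      c' = proj₂ (pair S)
      valueX : total (X 0 ⊗ X (suc i)) * h + proj₁ (X 0 ⊗ X (suc i)) * Δ + proj₂ (X 0) * proj₂ (X (suc i)) * D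
             ≈ total Z * h + proj₁ Z * Δ + c * c' * D
      valueX = reflexive (≡.cong₂ (λ U V → total (U ⊗ V) * h + proj₁ (U ⊗ V) * Δ + proj₂ U * proj₂ V * D) X₀ Xᵢ)
      valueY : total (Y 0 ⊗ Y (suc i)) * h + proj₁ (Y 0 ⊗ Y (suc i)) * Δ + proj₂ (Y 0) * proj₂ (Y (suc i)) * D'
             ≈ total B * h + proj₁ B * Δ
      valueY = trans (+-cong (+-cong (*-congʳ {h} (total-cong Y-bst)) (*-congʳ {Δ} (proj₁ Y-bst)))
                             (trans (*-congʳ {D'} (trans (*-congˡ {proj₂ (Y 0)} (proj₂ Yᵢ)) (zeroʳ (proj₂ (Y 0))))) (zeroˡ D')))
                     (+-identityʳ _)

-- From polynomials to Laplacian coefficients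

module CoefficientComparison {V W : Set} (_≟ⱽ_ : DecidableEquality V) (_≟ᵂ_ : DecidableEquality W) where
  open Polynomials
  open CommutativeRing polyRing using (_+_; _*_)
  open Order polyRing polyCone
  private
    module CV = CharacteristicPolynomial _≟ⱽ_
    module CW = CharacteristicPolynomial _≟ᵂ_
    module EV = EdgeLists _≟ⱽ_
    module EW = EdgeLists _≟ᵂ_

    signed : ℕ → List ℤ → ℤ
    signed k p = signℕ k ℤ.* coeff p k

    signed-+ : ∀ k p q → signed k (p + q) ≡ signed k p ℤ.+ signed k q
    signed-+ k p q = ≡.trans (≡.cong (λ z → signℕ k ℤ.* z) (coeff-+ p q k)) (ℤₚ.*-distribˡ-+ (signℕ k) (coeff p k) (coeff q k))

    signed-⊑ : ∀ {p q} → p ⊑ q → ∀ k → signed k p ℤ.≤ signed k q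
    signed-⊑ {p} {q} (d , pd , e) k = ≡.subst₂ ℤ._≤_ (ℤₚ.+-identityʳ _)
      (≡.trans (≡.sym (signed-+ k p d)) (≡.cong (λ z → signℕ k ℤ.* z) (≡.sym (at e k))))
      (ℤₚ.+-monoʳ-≤ (signed k p) (pd k))

  ≺-from-⊑ : ∀ {n} {G H : Graph n} {ρ : Fin n → V} {σ : Fin n → W} {E F} → 2 ≤ n →
    EV.Represents G ρ E → EW.Represents H σ F →
    CV.laplacianPoly E (tabulate ρ) + xₚ * xₚ ⊑ CW.laplacianPoly F (tabulate σ) → G ≺ H
  ≺-from-⊑ {n} {G} {H} {ρ} {σ} {E} {F} 2≤n repG repH le =
    (λ k k≤n → ≡.subst₂ ℤ._≤_ (≡.sym (LaplacianCoefficients.lapCoeff≡ _≟ⱽ_ repG k k≤n)) (≡.sym (LaplacianCoefficients.lapCoeff≡ _≟ᵂ_ repH k k≤n))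
      (signed-⊑ (⊑-trans (⊑-+ʳ {P} {P} {xₚ * xₚ} (PositiveCone.Pos-* polyCone {xₚ} {xₚ} Pos-xₚ Pos-xₚ) ⊑-refl) le) (n ∸ k))) ,
    -- The margin x^2 is λ^2, and c_k belongs to λ^(n-k); so strictness shows at k = n - 2.
    n ∸ 2 , ℕₚ.m∸n≤m n 2 ,
    ≡.subst₂ ℤ._<_
      (≡.sym (≡.trans (LaplacianCoefficients.lapCoeff≡ _≟ⱽ_ repG (n ∸ 2) (ℕₚ.m∸n≤m n 2)) (≡.cong (λ j → signed j P) (ℕₚ.m∸[m∸n]≡n 2≤n))))
      (≡.sym (≡.trans (LaplacianCoefficients.lapCoeff≡ _≟ᵂ_ repH (n ∸ 2) (ℕₚ.m∸n≤m n 2)) (≡.cong (λ j → signed j Q) (ℕₚ.m∸[m∸n]≡n 2≤n))))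
      (ℤₚ.<-≤-trans (≡.subst₂ ℤ._<_ (ℤₚ.+-identityʳ _) (≡.sym (signed-+ 2 P (xₚ * xₚ))) (ℤₚ.+-monoʳ-< (signed 2 P) (ℤ.+<+ (s≤s z≤n))))
                    (signed-⊑ le 2))
    where P = CV.laplacianPoly E (tabulate ρ)
          Q = CW.laplacianPoly F (tabulate σ)

-- Recovering the cycle and its trees from the given graph

sumℕ-mono : ∀ {n} {f g : Fin n → ℕ} → (∀ i → f i ≤ g i) → sumℕ f ≤ sumℕ g
sumℕ-mono {zero}  h = z≤n
sumℕ-mono {suc n} h = ℕₚ.+-mono-≤ (h Fin.zero) (sumℕ-mono (h ∘ Fin.suc))

private
  +-squeeze : ∀ {a b c d} → a ≤ b → c ≤ d → a ℕ.+ c ≡ b ℕ.+ d → (a ≡ b) × (c ≡ d)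
  +-squeeze {a} {b} {c} {d} a≤b c≤d e = a≡b , ℕₚ.+-cancelˡ-≡ a c d (≡.trans e (≡.cong (ℕ._+ d) (≡.sym a≡b)))
    where
    a≡b : a ≡ b
    a≡b = ≤-antisym a≤b (ℕₚ.+-cancelʳ-≤ d b a (≡.subst (_≤ a ℕ.+ d) e (ℕₚ.+-monoʳ-≤ a c≤d)))

sumℕ-squeeze : ∀ {n} {f g : Fin n → ℕ} → (∀ i → f i ≤ g i) → sumℕ f ≡ sumℕ g → ∀ i → f i ≡ g i
sumℕ-squeeze {suc n} h e Fin.zero    = proj₁ (+-squeeze (h Fin.zero) (sumℕ-mono (h ∘ Fin.suc)) e)
sumℕ-squeeze {suc n} h e (Fin.suc i) = sumℕ-squeeze (h ∘ Fin.suc) (proj₂ (+-squeeze (h Fin.zero) (sumℕ-mono (h ∘ Fin.suc)) e)) i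

extract : {V : Set} (us : List V) {zs : List V} → Unique us → (∀ u → u ∈ us → u ∈ zs) → ∃ λ rest → us ++ rest ↭ zs
extract []       {zs} _            h = zs , ↭-refl
extract (u ∷ us) {zs} (u∉ ∷ uniq) h with ∈ₚ.∈-∃++ (h u (here ≡.refl))
... | ys , ws , ≡.refl with extract us {ys ++ ws} uniq (λ v v∈ → skip v v∈ (∈ₚ.∈-++⁻ ys (h v (there v∈))))
    where
    skip : ∀ v → v ∈ us → v ∈ ys ⊎ v ∈ u ∷ ws → v ∈ ys ++ ws
    skip v v∈ (inj₁ h)              = ∈ₚ.∈-++⁺ˡ h
    skip v v∈ (inj₂ (here ≡.refl))  = ⊥-elim (All.lookup u∉ v∈ ≡.refl)
    skip v v∈ (inj₂ (there h))      = ∈ₚ.∈-++⁺ʳ ys h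
... | rest , p = rest , ↭-trans (↭-prep u p) (↭-sym (Perm.shift u ys ws))

module _ {n : ℕ} where
  open Attachments (Fin._≟_ {n})
  open EdgeLists (Fin._≟_ {n})
  open EdgeMultiplicity (Fin._≟_ {n})
  open DecMembership (Fin._≟_ {n}) using (_∈?_)

  private
    sum-pick : ∀ {m} (h : Fin m → ℕ) q → sumℕ (λ j → h j ℕ.* bit (does (j Fin.≟ q))) ≡ h q
    sum-pick {suc m} h Fin.zero = ≡.trans (≡.cong₂ ℕ._+_ (ℕₚ.*-identityʳ (h Fin.zero))
      (≡.trans (sumℕ-cong (λ j → ℕₚ.*-zeroʳ (h (Fin.suc j)))) (sumℕ-zero m))) (ℕₚ.+-identityʳ _)
    sum-pick {suc m} h (Fin.suc q) = ≡.cong₂ ℕ._+_ (ℕₚ.*-zeroʳ (h Fin.zero)) (sum-pick (h ∘ Fin.suc) q)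

    below : Fin n → Fin n → ℕ
    below i j = bit (suc (toℕ i) ℕ.≤ᵇ toℕ j)

    below-total : ∀ p q → p ≢ q → below p q ℕ.+ below q p ≡ 1
    below-total p q p≢q with ℕₚ.<-cmp (toℕ p) (toℕ q)
    ... | tri< lt _ gt = ≡.cong₂ (λ a b → bit a ℕ.+ bit b) (dec-true (_ ℕₚ.≤? _) lt) (dec-false (_ ℕₚ.≤? _) gt)
    ... | tri≈ _ e _ = ⊥-elim (p≢q (Finₚ.toℕ-injective e))
    ... | tri> lt _ gt = ≡.cong₂ (λ a b → bit a ℕ.+ bit b) (dec-false (_ ℕₚ.≤? _) lt) (dec-true (_ ℕₚ.≤? _) gt)

    -- For an edge with distinct ends exactly one of its two orders passes the test `below`.
    count : ∀ E → Loopless E → sumℕ (λ i → sumℕ (λ j → below i j ℕ.* links E i j)) ≡ length E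
    count [] [] = ≡.trans (sumℕ-cong (λ i → ≡.trans (sumℕ-cong (λ j → ℕₚ.*-zeroʳ (below i j))) (sumℕ-zero n))) (sumℕ-zero n)
    count ((p , q) ∷ E) (p≢q ∷ ll) = begin
      sumℕ (λ i → sumℕ (λ j → below i j ℕ.* (link (p , q) i j ℕ.+ links E i j)))
        ≡⟨ sumℕ-cong (λ i → ≡.trans (sumℕ-cong (λ j → ℕₚ.*-distribˡ-+ (below i j) (link (p , q) i j) (links E i j)))
                                     (sumℕ-+ (λ j → below i j ℕ.* link (p , q) i j) (λ j → below i j ℕ.* links E i j))) ⟩
      sumℕ (λ i → sumℕ (λ j → below i j ℕ.* link (p , q) i j) ℕ.+ sumℕ (λ j → below i j ℕ.* links E i j))
        ≡⟨ sumℕ-+ (λ i → sumℕ (λ j → below i j ℕ.* link (p , q) i j)) _ ⟩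
      sumℕ (λ i → sumℕ (λ j → below i j ℕ.* link (p , q) i j)) ℕ.+ sumℕ (λ i → sumℕ (λ j → below i j ℕ.* links E i j))
        ≡⟨ ≡.cong₂ ℕ._+_ one (count E ll) ⟩
      suc (length E) ∎
      where
      open ≡.≡-Reasoning
      rearrange : ∀ f a b c d → f ℕ.* (a ℕ.* b ℕ.+ c ℕ.* d) ≡ (f ℕ.* a) ℕ.* b ℕ.+ (f ℕ.* c) ℕ.* d
      rearrange = solve-∀
      one : sumℕ (λ i → sumℕ (λ j → below i j ℕ.* link (p , q) i j)) ≡ 1
      one = begin
        sumℕ (λ i → sumℕ (λ j → below i j ℕ.* link (p , q) i j))
          ≡⟨ sumℕ-cong (λ i → ≡.trans (sumℕ-cong (λ j → rearrange (below i j) (eqBit i p) (eqBit j q) (eqBit i q) (eqBit j p)))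
               (≡.trans (sumℕ-+ (λ j → (below i j ℕ.* eqBit i p) ℕ.* eqBit j q) (λ j → (below i j ℕ.* eqBit i q) ℕ.* eqBit j p))
                 (≡.cong₂ ℕ._+_ (sum-pick (λ j → below i j ℕ.* eqBit i p) q) (sum-pick (λ j → below i j ℕ.* eqBit i q) p)))) ⟩
        sumℕ (λ i → below i q ℕ.* eqBit i p ℕ.+ below i p ℕ.* eqBit i q)
          ≡⟨ sumℕ-+ (λ i → below i q ℕ.* eqBit i p) (λ i → below i p ℕ.* eqBit i q) ⟩
        sumℕ (λ i → below i q ℕ.* eqBit i p) ℕ.+ sumℕ (λ i → below i p ℕ.* eqBit i q)
          ≡⟨ ≡.cong₂ ℕ._+_ (sum-pick (λ i → below i q) p) (sum-pick (λ i → below i p) q) ⟩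
        below p q ℕ.+ below q p
          ≡⟨ below-total p q p≢q ⟩
        1 ∎

    edgeCount≡ : ∀ G → edgeCount {n} G ≡ sumℕ (λ i → sumℕ (λ j → below i j ℕ.* bit (adj G i j)))
    edgeCount≡ G = sumℕ-cong (λ i → sumℕ-cong (λ j → bit-∧ (suc (toℕ i) ℕ.≤ᵇ toℕ j) (adj G i j)))
      where
      bit-∧ : ∀ a b → bit (a ∧ b) ≡ bit a ℕ.* bit b
      bit-∧ true  b = ≡.sym (ℕₚ.+-identityʳ (bit b))
      bit-∧ false b = ≡.refl

  -- A repetition-free list of edges of G can only miss some of them, so `links` is pointwise at
  -- most adjacency; having as many edges as G, the list misses none. Thus the edge count of a
  -- unicyclic graph excludes edges outside cycle and attachments.
  adjacency-links : ∀ (G : Graph n) E → Loopless E → Simple E → All (λ e → Edge G (proj₁ e) (proj₂ e)) E →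
    edgeCount G ≡ length E → ∀ i j → bit (adj G i j) ≡ links E i j
  adjacency-links G E ll simple edge num i j = go (ℕₚ.<-cmp (toℕ i) (toℕ j))
    where
    links≤ : ∀ i j → links E i j ≤ bit (adj G i j)
    links≤ i j with adj G i j in e
    ... | true  = simple i j
    ... | false = ≤-reflexive (links-∉ E i j
      (λ h → case (≡.trans (≡.sym e) (All.lookup edge h)))
      (λ h → case (≡.trans (≡.sym e) (≡.trans (Graph.sym G i j) (All.lookup edge h)))))
      where case : false ≢ true
            case ()
    pointwise : ∀ i j → below i j ℕ.* links E i j ≡ below i j ℕ.* bit (adj G i j)
    pointwise i = sumℕ-squeeze (λ j → ℕₚ.*-monoʳ-≤ (below i j) (links≤ i j))
      (sumℕ-squeeze (λ i → sumℕ-mono (λ j → ℕₚ.*-monoʳ-≤ (below i j) (links≤ i j)))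
        (≡.trans (count E ll) (≡.trans (≡.sym num) (edgeCount≡ G))) i)
    ordered : ∀ {i j} → toℕ i < toℕ j → bit (adj G i j) ≡ links E i j
    ordered {i} {j} lt = ≡.trans (≡.sym (ℕₚ.+-identityʳ _)) (≡.trans
      (≡.sym (≡.subst (λ b → b ℕ.* links E i j ≡ b ℕ.* bit (adj G i j)) (≡.cong bit (dec-true (_ ℕₚ.≤? _) lt)) (pointwise i j))) (ℕₚ.+-identityʳ _))
    loop : ∀ F → Loopless F → ∀ i → (i , i) ∉ F
    loop F ll i h = All.lookup ll h ≡.refl
    go : Tri (toℕ i < toℕ j) (toℕ i ≡ toℕ j) (toℕ j < toℕ i) → bit (adj G i j) ≡ links E i j
    go (tri< lt _ _) = ordered lt
    go (tri> _ _ gt) = ≡.trans (≡.cong bit (Graph.sym G i j)) (≡.trans (ordered gt) (links-sym E j i))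
    go (tri≈ _ e _) rewrite Finₚ.toℕ-injective e =
      ≡.trans (≡.cong bit (irrefl G j)) (≡.sym (links-∉ E j j (loop E ll j) (loop E ll j)))

  private
    unique-↭ : ∀ {us vs : List (Fin n)} → us ↭ vs → Unique us → Unique vs
    unique-↭ p = PermSetoid.Unique-resp-↭ (≡.setoid (Fin n)) (↭⇒↭ₛ p)

    -- A walk from inside vs to a vertex outside has a first step that leaves vs.
    crossing : ∀ (G : Graph n) (vs : List (Fin n)) {a b} → ReachBy (Edge G) a b → a ∈ vs → b ∉ vs →
      ∃ λ w → ∃ λ v → (w ∈ vs) × (v ∉ vs) × Edge G w v
    crossing G vs ReachBy.here a∈ a∉ = ⊥-elim (a∉ a∈)
    crossing G vs (ReachBy.step {b = b} e path) a∈ c∉ with b ∈? vs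
    ... | yes b∈ = crossing G vs path b∈ c∉
    ... | no b∉  = _ , _ , a∈ , b∉ , e

  -- Connectedness provides a vertex to attach as long as some vertex is missing; k, the number of
  -- missing vertices, is the measure of the recursion.
  grow : ∀ (G : Graph n) → Connected G → ∀ k vs rest → length rest ≡ k → ∀ {a} → a ∈ vs → vs ++ rest ↭ allFin n →
    ∃ λ L → Attach vs L × All (λ e → Edge G (proj₁ e) (proj₂ e)) L × (vertices L vs ↭ allFin n)
  grow G conn zero    vs []        _ a∈ p = [] , done , [] , ↭-trans (↭-reflexive (≡.sym (++-identityʳ vs))) p
  grow G conn (suc k) vs (y ∷ rest) len {a} a∈ p with crossing G vs (conn a y) a∈ y∉
    where
    y∉ : y ∉ vs
    y∉ y∈ = disjoint vs (unique-↭ (↭-sym p) (Uniqueₚ.allFin⁺ n)) y∈ (here ≡.refl)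
      where
      disjoint : ∀ us {ws} {z : Fin n} → Unique (us ++ ws) → z ∈ us → z ∉ ws
      disjoint (u ∷ us) (u∉ ∷ _) (here ≡.refl) z∈ = All.lookup u∉ (∈ₚ.∈-++⁺ʳ us z∈) ≡.refl
      disjoint (u ∷ us) (_ ∷ uq) (there z∈us)  z∈ = disjoint us uq z∈us z∈
  ... | w , v , w∈ , v∉ , e with ∈ₚ.∈-++⁻ vs (Perm.∈-resp-↭ (↭-sym p) (∈ₚ.∈-allFin v))
  ...   | inj₁ v∈ = ⊥-elim (v∉ v∈)
  ...   | inj₂ v∈ with ∈ₚ.∈-∃++ v∈
  ...     | ys , zs , eq with grow G conn k (v ∷ vs) (ys ++ zs) len' (there a∈) p'
    where
    q : y ∷ rest ↭ v ∷ (ys ++ zs)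
    q = ↭-trans (↭-reflexive eq) (Perm.shift v ys zs)
    len' : length (ys ++ zs) ≡ k
    len' = ℕₚ.suc-injective (≡.trans (≡.sym (Perm.↭-length q)) len)
    p' : v ∷ vs ++ (ys ++ zs) ↭ allFin n
    p' = ↭-trans (↭-trans (↭-sym (Perm.shift v vs (ys ++ zs))) (Perm.++⁺ˡ vs (↭-sym q))) p
  ...       | L , A , es , full = (w , v) ∷ L , attach w∈ (All.tabulate (λ z∈ v≡z → v∉ (≡.subst (_∈ vs) (≡.sym v≡z) z∈))) A , e ∷ es , full

  attached-edges : ∀ {P : Fin n × Fin n → Set} L {E} → All P L → All P E → All P (L ʳ++ E)
  attached-edges []      []       qs = qs
  attached-edges (e ∷ L) (p ∷ ps) qs = attached-edges L ps (p ∷ qs)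

module Structure {n l q : ℕ} (2≤q : 2 ≤ q) (G : Graph n) (U : InU2 n l (suc q) G) where
  open InU2 U
  open Attachments (Fin._≟_ {n})
  open EdgeLists (Fin._≟_ {n})
  open EdgeMultiplicity (Fin._≟_ {n})

  -- indices above q are sent to q
  clip : ℕ → Fin (suc q)
  clip k = fromℕ< (s≤s (ℕₚ.m⊓n≤n k q))

  toℕ-clip : ∀ {k} → k ≤ q → toℕ (clip k) ≡ k
  toℕ-clip k≤q = ≡.trans (Finₚ.toℕ-fromℕ< _) (ℕₚ.m≤n⇒m⊓n≡m k≤q)

  κ : ℕ → Fin n
  κ k = cyc (clip k)

  κ-toℕ : ∀ i → κ (toℕ i) ≡ cyc i
  κ-toℕ i = ≡.cong cyc (Finₚ.toℕ-injective (toℕ-clip (Finₚ.toℕ≤pred[n] i)))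

  κ-injective : ∀ {i j} → i ≤ q → j ≤ q → κ i ≡ κ j → i ≡ j
  κ-injective i≤ j≤ e = ≡.trans (≡.sym (toℕ-clip i≤)) (≡.trans (≡.cong toℕ (cycInj e)) (toℕ-clip j≤))

  open CycleWithTrees Fin._≟_ κ q κ-injective public
  open CycleEdges Fin._≟_ κ q κ-injective

  private
    consecutive : All (λ e → Consec (clip (proj₁ e)) (clip (proj₂ e))) (cycleEdges q)
    consecutive = inj₂ (toℕ-clip ≤-refl , toℕ-clip z≤n) ∷
      All.map (λ { (_ , ≡.refl , hi) → inj₁ (≡.trans (toℕ-clip hi) (≡.cong suc (≡.sym (toℕ-clip (<⇒≤ hi))))) }) (cycleEdgesFrom-bounds 0 q)

    edges-Edge : All (λ e → Edge G (proj₁ e) (proj₂ e)) edges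
    edges-Edge = Allₚ.map⁺ (All.map (λ {e} → cycAdj (clip (proj₁ e)) (clip (proj₂ e))) consecutive)

    edges-CycleEdge : ∀ {u v} → (u , v) ∈ edges → CycleEdge cyc u v × CycleEdge cyc v u
    edges-CycleEdge h with ∈ₚ.∈-map⁻ (mapEdge κ) h
    ... | (a , b) , ab∈ , ≡.refl =
      (clip a , clip b , c , inj₁ (≡.refl , ≡.refl)) , (clip a , clip b , c , inj₂ (≡.refl , ≡.refl))
      where c = All.lookup consecutive ab∈

    cyc∈cycle : ∀ i → cyc i ∈ cycle
    cyc∈cycle i = ≡.subst (_∈ cycle) (κ-toℕ i) (∈-cycle (Finₚ.toℕ≤pred[n] i))

    grown : ∃ λ L → Attach cycle L × All (λ e → Edge G (proj₁ e) (proj₂ e)) L × (vertices L cycle ↭ allFin n)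
    grown with extract cycle unique-cycle (λ u _ → ∈ₚ.∈-allFin u)
    ... | rest , p = grow G connected (length rest) cycle rest ≡.refl (∈-cycle z≤n) p

  L : List (Fin n × Fin n)
  L = proj₁ grown

  attached : Attach cycle L
  attached = proj₁ (proj₂ grown)

  covers : vertices L cycle ↭ tabulate id
  covers = proj₂ (proj₂ (proj₂ grown))

  represents : Represents G id (L ʳ++ edges)
  represents = record
    { adjacency = adjacency-links G (L ʳ++ edges) loopless
        (simple-attached attached within-cycle (simple-edges 2≤q))
        (attached-edges L (proj₁ (proj₂ (proj₂ grown))) edges-Edge)
        (≡.trans unicyclic (≡.sym number))
    ; injective = λ _ _ e → e
    ; loopless  = loopless
    ; endpoints = All.universal (λ e → (proj₁ e , ≡.refl) , (proj₂ e , ≡.refl)) _ }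
    where
    loopless = loopless-attached attached (loopless-edges 2≤q)
    length-cycle≡edges : length cycle ≡ length edges
    length-cycle≡edges = ≡.trans (length-map κ (upFrom 0 (suc q))) (≡.trans (length-upFrom 0 (suc q))
      (≡.sym (≡.trans (length-map (mapEdge κ) (cycleEdges q)) (≡.cong suc (length-cycleEdgesFrom 0 q)))))
      where
      length-cycleEdgesFrom : ∀ s k → length (cycleEdgesFrom s k) ≡ k
      length-cycleEdgesFrom s zero    = ≡.refl
      length-cycleEdgesFrom s (suc k) = ≡.cong suc (length-cycleEdgesFrom (suc s) k)
    number : length (L ʳ++ edges) ≡ n
    number = ≡.trans (length-ʳ++ L) (≡.trans (≡.cong₂ ℕ._+_ (≡.sym (length-map proj₂ L)) (≡.sym length-cycle≡edges))
      (≡.trans (≡.sym (length-ʳ++ (map proj₂ L))) (≡.trans (Perm.↭-length covers) (length-tabulate id))))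

  private
    adjacent-link : ∀ {u v} → Edge G u v → links (L ʳ++ edges) u v ≢ 0
    adjacent-link {u} {v} e z = case (≡.trans (≡.sym (≡.cong bit e)) (≡.trans (Represents.adjacency represents u v) z))
      where case : 1 ≢ 0
            case ()

    ∈-attached : ∀ K {E : List (Fin n × Fin n)} {e} → e ∈ K ʳ++ E → e ∈ K ⊎ e ∈ E
    ∈-attached []      h = inj₂ h
    ∈-attached (k ∷ K) h with ∈-attached K h
    ... | inj₁ h           = inj₁ (there h)
    ... | inj₂ (here e)    = inj₁ (here e)
    ... | inj₂ (there h)   = inj₂ h

    first-edge : ∀ {E : Fin n → Fin n → Set} {a b} → b ≢ a → ReachBy E a b → ∃ λ c → E a c
    first-edge b≢a ReachBy.here        = ⊥-elim (b≢a ≡.refl)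
    first-edge b≢a (ReachBy.step e _)  = _ , e

  -- A walk in T_i away from u_i starts with an edge at u_i that is no cycle edge, hence an attached
  -- one. Its older end is u_i, because the newer end of an attached edge never lies on the cycle.
  nontrivial-tree : ∀ i → NontrivialTree G cyc i → Nontrivial (forest L (cyc i))
  nontrivial-tree i (v , v≢ , path) with first-edge v≢ path
  ... | c , e , notCycle with links-∈ (L ʳ++ edges) (cyc i) c (adjacent-link e)
  ...   | inj₁ h with ∈-attached L h
  ...     | inj₁ h' = forest-nontrivial L (cyc i) c h'
  ...     | inj₂ h' = ⊥-elim (notCycle (proj₁ (edges-CycleEdge h')))
  nontrivial-tree i (v , v≢ , path) | c , e , notCycle | inj₂ h with ∈-attached L h
  ...     | inj₁ h' = ⊥-elim (attached-new attached h' (cyc∈cycle i))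
  ...     | inj₂ h' = ⊥-elim (notCycle (proj₂ (edges-CycleEdge h')))

  -- An attached edge at u_i leads to a vertex off the cycle, so it is no cycle edge and would
  -- already make T_i nontrivial.
  trivial-tree : ∀ i → ¬ NontrivialTree G cyc i → forest L (cyc i) ≡ pt
  trivial-tree i triv with forest-cases L (cyc i)
  ... | inj₁ e        = e
  ... | inj₂ (y , h) = ⊥-elim (triv (y , (λ { ≡.refl → y∉ (cyc∈cycle i) }) ,
      ReachBy.step (All.lookup (proj₁ (proj₂ (proj₂ grown))) h , notCycle) ReachBy.here))
    where
    y∉ : y ∉ cycle
    y∉ = attached-new attached h
    notCycle : ¬ CycleEdge cyc (cyc i) y
    notCycle (a , b , _ , inj₁ (_ , ≡.refl)) = y∉ (cyc∈cycle b)
    notCycle (a , b , _ , inj₂ (≡.refl , _)) = y∉ (cyc∈cycle a)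

-- The extremal graph

module PendantPaths where
  open Polynomials
  open RootedPairs polyRing polyCone xₚ Pos-xₚ
  open Attachments ℕₚ._≟_
  open EdgeLists ℕₚ._≟_
  open EdgeMultiplicity ℕₚ._≟_

  pathFrom-vertices : ∀ prev s k → map proj₂ (pathFrom prev s k) ≡ upFrom s k
  pathFrom-vertices prev s zero    = ≡.refl
  pathFrom-vertices prev s (suc k) = ≡.cong (s ∷_) (pathFrom-vertices s (suc s) k)

  pathsEdges-vertices : ∀ s ks → map proj₂ (pathsEdges s ks) ≡ upFrom s (sum ks)
  pathsEdges-vertices s []       = ≡.refl
  pathsEdges-vertices s (k ∷ ks) = ≡.trans (map-++ proj₂ (pathFrom 0 s k) (pathsEdges (s ℕ.+ k) ks))
    (≡.trans (≡.cong₂ _++_ (pathFrom-vertices 0 s k) (pathsEdges-vertices (s ℕ.+ k) ks)) (≡.sym (upFrom-++ s k (sum ks))))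

  -- What follows the path is a continuation that knows only that the centre 0 is present and that
  -- all numbers used so far lie below s + k.
  attach-path : ∀ k prev s {vs K} → prev ∈ vs → 0 ∈ vs → All (_< s) vs →
    (∀ {ws} → 0 ∈ ws → All (_< s ℕ.+ k) ws → Attach ws K) → Attach vs (pathFrom prev s k ++ K)
  attach-path zero    prev s {vs} p∈ 0∈ vs<s next = next 0∈ (≡.subst (λ t → All (_< t) vs) (≡.sym (ℕₚ.+-identityʳ s)) vs<s)
  attach-path (suc k) prev s {vs} p∈ 0∈ vs<s next =
    attach p∈ (All.map (λ z<s s≡z → <⇒≢ z<s (≡.sym s≡z)) vs<s)
      (attach-path k s (suc s) (here ≡.refl) (there 0∈) (n<1+n s ∷ All.map (λ z<s → ℕₚ.<-trans z<s (n<1+n s)) vs<s)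
        (λ {ws} 0∈ ws< → next 0∈ (≡.subst (λ t → All (_< t) ws) (≡.sym (+-suc s k)) ws<)))

  attach-paths : ∀ ks s {vs} → 0 ∈ vs → All (_< s) vs → Attach vs (pathsEdges s ks)
  attach-paths []       s 0∈ vs<s = done
  attach-paths (k ∷ ks) s 0∈ vs<s = attach-path k 0 s 0∈ 0∈ vs<s (attach-paths ks (s ℕ.+ k))

  -- The path vertices must carry nothing yet, or their trees would be planted along with the path.
  -- The second component lets the recursion, which starts at s, conclude that the tree at the older
  -- `prev` is untouched.
  graft-path : ∀ k prev s τ → prev < s → (∀ z → s ≤ z → z < s ℕ.+ k → τ z ≡ pt) →
    (pair (foldr graftAt τ (pathFrom prev s k) prev) ≋ path k ⊗ pair (τ prev)) ×
    (∀ z → z < s → z ≢ prev → foldr graftAt τ (pathFrom prev s k) z ≡ τ z)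
  graft-path zero    prev s τ p<s fresh = ⊗.sym (⊗.identityˡ (pair (τ prev))) , λ _ _ _ → ≡.refl
  graft-path (suc k) prev s τ p<s fresh with graft-path k s (suc s) τ (n<1+n s)
    (λ z lo hi → fresh z (<⇒≤ lo) (≡.subst (z <_) (≡.sym (+-suc s k)) hi))
  ... | at-s , others =
    ⊗.trans (⊗.reflexive (≡.cong pair (graft prev s τ')))
      (⊗.∙-cong (plant-cong (⊗.trans at-s (⊗.trans (⊗.reflexive (≡.cong (λ t → path k ⊗ pair t) τs)) (⊗.identityʳ (path k)))))
                (⊗.reflexive (≡.cong pair (others prev (ℕₚ.m<n⇒m<1+n p<s) (<⇒≢ p<s))))) ,
    λ z z<s z≢prev → ≡.trans (graft-other prev s τ' z z≢prev) (others z (ℕₚ.m<n⇒m<1+n z<s) (<⇒≢ z<s))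
    where
    τ' = foldr graftAt τ (pathFrom s (suc s) k)
    τs : τ s ≡ pt
    τs = fresh s ≤-refl (m<m+n s (s≤s z≤n))

  paths-forest : ∀ ks s → 1 ≤ s →
    (pair (forest (pathsEdges s ks) 0) ≋ spider ks) × (∀ z → z ≢ 0 → z < s → forest (pathsEdges s ks) z ≡ pt)
  paths-forest []       s 1≤s = ⊗.refl , λ _ _ _ → ≡.refl
  paths-forest (k ∷ ks) s 1≤s with paths-forest ks (s ℕ.+ k) (≤-trans 1≤s (m≤m+n s k))
  ... | at-0 , others with graft-path k 0 s (forest (pathsEdges (s ℕ.+ k) ks)) 1≤s
                             (λ z lo hi → others z (λ z≡0 → <⇒≢ (≤-trans 1≤s lo) (≡.sym z≡0)) hi)
  ...   | new-0 , new-others rewrite foldr-++ graftAt (const pt) (pathFrom 0 s k) (pathsEdges (s ℕ.+ k) ks) =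
    ⊗.trans new-0 (⊗.∙-congˡ {path k} at-0) ,
    λ z z≢0 z<s → ≡.trans (new-others z z<s z≢0) (others z z≢0 (ℕₚ.<-≤-trans z<s (m≤m+n s k)))

  links-++ : ∀ E F u v → links (E ++ F) u v ≡ links E u v ℕ.+ links F u v
  links-++ []      F u v = ≡.refl
  links-++ (e ∷ E) F u v = ≡.trans (≡.cong (link e u v ℕ.+_) (links-++ E F u v)) (≡.sym (ℕₚ.+-assoc (link e u v) _ _))

  links-ʳ++ : ∀ E F u v → links (E ʳ++ F) u v ≡ links F u v ℕ.+ links E u v
  links-ʳ++ []      F u v = ≡.sym (ℕₚ.+-identityʳ _)
  links-ʳ++ (e ∷ E) F u v = ≡.trans (links-ʳ++ E (e ∷ F) u v) (lemma (link e u v) (links F u v) (links E u v))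
    where lemma : ∀ a b c → a ℕ.+ b ℕ.+ c ≡ b ℕ.+ (a ℕ.+ c)
          lemma = solve-∀

  edgeIn-∈ : ∀ es a b → edgeIn es a b ≡ true → (a , b) ∈ es
  edgeIn-∈ ((p , q) ∷ es) a b h with p ℕ.≡ᵇ a in e | q ℕ.≡ᵇ b in e'
  ... | true  | true  rewrite ℕₚ.≡ᵇ⇒≡ p a (≡.subst Bool.T (≡.sym e) _) | ℕₚ.≡ᵇ⇒≡ q b (≡.subst Bool.T (≡.sym e') _) = here ≡.refl
  ... | true  | false = there (edgeIn-∈ es a b h)
  ... | false | _     = there (edgeIn-∈ es a b h)

  ∈-edgeIn : ∀ es a b → (a , b) ∈ es → edgeIn es a b ≡ true
  ∈-edgeIn ((p , q) ∷ es) a b (here ≡.refl) rewrite ≟-refl p | ≟-refl q = ≡.refl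
  ∈-edgeIn ((p , q) ∷ es) a b (there h) =
    ≡.trans (≡.cong ((p ℕ.≡ᵇ a) ∧ (q ℕ.≡ᵇ b) ∨_) (∈-edgeIn es a b h)) (Boolₚ.∨-zeroʳ _)

  graphFromEdges-links : ∀ n es → Simple es → Loopless es → ∀ i j →
    bit (adj (graphFromEdges n es) i j) ≡ links es (toℕ i) (toℕ j)
  graphFromEdges-links n es simple ll i j with edgeIn es (toℕ i) (toℕ j) in e | edgeIn es (toℕ j) (toℕ i) in e'
  ... | true | _ = ≡.trans (≡.cong (bit ∘ not) (≟-≢ (All.lookup ll ij∈))) (≤-antisym (∈-links es _ _ ij∈) (simple _ _))
    where ij∈ = edgeIn-∈ es (toℕ i) (toℕ j) e
  ... | false | true = ≡.trans (≡.cong (bit ∘ not) (≟-≢ (λ i≡j → All.lookup ll ji∈ (≡.sym i≡j))))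
      (≡.trans (≤-antisym (∈-links es _ _ ji∈) (simple _ _)) (links-sym es (toℕ j) (toℕ i)))
    where ji∈ = edgeIn-∈ es (toℕ j) (toℕ i) e'
  ... | false | false = ≡.sym (links-∉ es (toℕ i) (toℕ j) (absent e) (absent e'))
    where
    absent : ∀ {a b} → edgeIn es a b ≡ false → (a , b) ∉ es
    absent f h with ≡.trans (≡.sym f) (∈-edgeIn es _ _ h)
    ... | ()

module BalancedStarlike (q : ℕ) (2≤q : 2 ≤ q) (lens : List ℕ) where
  open Polynomials
  open Attachments ℕₚ._≟_
  open EdgeLists ℕₚ._≟_
  open EdgeMultiplicity ℕₚ._≟_
  open PendantPaths
  open CycleWithTrees ℕₚ._≟_ id q (λ _ _ e → e) public
  open CycleEdges ℕₚ._≟_ id q (λ _ _ e → e)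

  L : List (ℕ × ℕ)
  L = pathsEdges (suc q) lens

  attached : Attach cycle L
  attached = attach-paths lens (suc q) (∈-cycle z≤n) (Allₚ.map⁺ (All-upFrom 0 (suc q) (λ z _ hi → hi)))

  private
    n = suc q ℕ.+ sum lens

    tabulate-toℕ : ∀ s m → tabulate {n = m} (λ i → s ℕ.+ toℕ i) ≡ upFrom s m
    tabulate-toℕ s zero    = ≡.refl
    tabulate-toℕ s (suc m) = ≡.cong₂ _∷_ (ℕₚ.+-identityʳ s)
      (≡.trans (tabulate-cong (λ i → +-suc s (toℕ i))) (tabulate-toℕ (suc s) m))

  covers : vertices L cycle ↭ tabulate {n = n} toℕ
  covers = ↭-trans (↭-sym (Perm.++↭ʳ++ (map proj₂ L) cycle)) (↭-trans (Perm.++-comm (map proj₂ L) cycle)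
    (↭-reflexive (≡.trans (≡.cong₂ _++_ (map-id _) (pathsEdges-vertices (suc q) lens))
      (≡.trans (≡.sym (upFrom-++ 0 (suc q) (sum lens))) (≡.sym (tabulate-toℕ 0 n))))))

  private
    es = cycleEdges q ++ L

    -- The definition of `U0` lists its edges in another order than the attachments produce; `links`
    -- does not see the order.
    links-es : ∀ u v → links (L ʳ++ edges) u v ≡ links es u v
    links-es u v = ≡.trans (links-ʳ++ L edges u v)
      (≡.trans (≡.cong (λ F → links F u v ℕ.+ links L u v) (map-id (cycleEdges q))) (≡.sym (links-++ (cycleEdges q) L u v)))

    loopless = loopless-attached attached (loopless-edges 2≤q)

    loopless-es : Loopless es
    loopless-es = All.tabulate λ {e} h → noLoop e h
      where
      noLoop : ∀ e → e ∈ es → proj₁ e ≢ proj₂ e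
      noLoop (u , v) h ≡.refl = <⇒≢ (∈-links es u u h) (≡.sym (≡.trans (≡.sym (links-es u u))
        (links-∉ (L ʳ++ edges) u u (λ k → All.lookup loopless k ≡.refl) (λ k → All.lookup loopless k ≡.refl))))

  represents : Represents (graphFromEdges n es) toℕ (L ʳ++ edges)
  represents = record
    { adjacency = λ i j → ≡.trans
        (graphFromEdges-links n es (λ u v → ≡.subst (_≤ 1) (links-es u v) (simple-attached attached within-cycle (simple-edges 2≤q) u v)) loopless-es i j)
        (≡.sym (links-es (toℕ i) (toℕ j)))
    ; injective = λ i j → Finₚ.toℕ-injective
    ; loopless  = loopless
    ; endpoints = All.map (λ { (p , q) → covered p , covered q }) (within-attached attached within-cycle) }
    where
    covered : ∀ {u} → u ∈ vertices L cycle → ∃ λ (i : Fin n) → toℕ i ≡ u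
    covered u∈ with ∈ₚ.∈-tabulate⁻ (Perm.∈-resp-↭ covers u∈)
    ... | i , e = i , ≡.sym e

leaves-positive : ∀ T → 1 ≤ leaves T
leaves-positive pt      = s≤s z≤n
leaves-positive (t ◃ s) = ≤-trans (leaves-positive t) (m≤m+n (leaves t) (rootedLeaves s))

-- One leg of length m beside k legs of length 0 balances to this list, and balancing preserves the
-- sum.
sum-bstLengths : ∀ m ℓ → 1 ≤ ℓ → sum (bstLengths m ℓ) ≡ m
sum-bstLengths m (suc k) _ = ≡.trans
  (≡.sym (≡.subst₂ (λ a b → a ≡ sum (bstLengths a b)) total number (⇝-sum (balance m (replicate k 0))))) ≡.refl
  where
  sum-zeros : ∀ k → sum (replicate k 0) ≡ 0
  sum-zeros zero    = ≡.refl
  sum-zeros (suc k) = sum-zeros k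
  total : m ℕ.+ sum (replicate k 0) ≡ m
  total = ≡.trans (≡.cong (m ℕ.+_) (sum-zeros k)) (ℕₚ.+-identityʳ m)
  number : suc (length (replicate k 0)) ≡ suc k
  number = ≡.cong suc (length-replicate k)

-- Matching the parameters of the two graphs

module TwoTrees {n l i r : ℕ} (2≤q : 2 ≤ suc (i ℕ.+ r)) (G : Graph n) (U : InU2 n l (suc (suc (i ℕ.+ r))) G)
    (other≡ : toℕ (InU2.other U) ≡ suc i) where
  open Polynomials
  open CommutativeRing polyRing using (+-congʳ) renaming (sym to ≈-sym)
  open Order polyRing polyCone
  open RootedPairs polyRing polyCone xₚ Pos-xₚ
  open Spiders polyRing polyCone xₚ Pos-xₚ using (bst)
  open Comparison polyRing polyCone xₚ Pos-xₚ

  private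
    q = suc (i ℕ.+ r)
    lens = bstLengths (n ∸ suc q) l
    module S = Structure 2≤q G U
    module B = BalancedStarlike q 2≤q lens
    open InU2 U using (other; tree1; treeOther; restTrivial) renaming (leaves to leafCount≡l)

    clip-i : S.clip (suc i) ≡ other
    clip-i = Finₚ.toℕ-injective (≡.trans (S.toℕ-clip (s≤s (m≤m+n i r))) (≡.sym other≡))

    tree : ℕ → Tree
    tree = S.tree S.attached

    T = tree 0
    T' = tree (suc i)

    nontrivial-T : Nontrivial T
    nontrivial-T = S.nontrivial-tree (S.clip 0) (tree1 (S.clip 0) (S.toℕ-clip z≤n))

    nontrivial-T' : Nontrivial T'
    nontrivial-T' = S.nontrivial-tree (S.clip (suc i)) (≡.subst (NontrivialTree G (InU2.cyc U)) (≡.sym clip-i) treeOther)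

    rest-trivial : All (λ z → tree z ≡ pt) (without i r)
    rest-trivial = All.zipWith (λ { {z} ((1≤z , z≤q) , i≢z) → S.trivial-tree (S.clip z) (restTrivial (S.clip z)
        (λ e → <⇒≢ 1≤z (≡.sym (≡.trans (≡.sym (S.toℕ-clip z≤q)) e)))
        (λ e → i≢z (≡.trans (≡.sym other≡) (≡.trans (≡.cong toℕ (≡.sym e)) (S.toℕ-clip z≤q))))) })
      (without-bounds i r , ∉-without i r)

    sum-cycle : ∀ f c → All (λ z → f z ≡ c) (without i r) → sum (map f (upFrom 0 (suc q))) ≡ f 0 ℕ.+ (f (suc i) ℕ.+ (i ℕ.+ r) ℕ.* c)
    sum-cycle f c h = ≡.cong (f 0 ℕ.+_) (≡.trans (sum-↭ (Perm.map⁺ f (upFrom-without i r)))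
      (≡.cong (f (suc i) ℕ.+_) (≡.trans (constant _ h) (≡.cong (ℕ._* c)
        (≡.trans (length-++ (upFrom 1 i)) (≡.cong₂ ℕ._+_ (length-upFrom 1 i) (length-upFrom (2 ℕ.+ i) r)))))))
      where
      constant : ∀ zs → All (λ z → f z ≡ c) zs → sum (map f zs) ≡ length zs ℕ.* c
      constant []       []       = ≡.refl
      constant (z ∷ zs) (e ∷ es) = ≡.cong₂ ℕ._+_ e (constant zs es)

    m = size T ℕ.+ size T'
    ℓ = rootedLeaves T ℕ.+ rootedLeaves T'

    n≡ : n ≡ suc q ℕ.+ m
    n≡ = ≡.trans (S.tree-size S.attached S.covers)
      (≡.trans (sum-cycle (suc ∘ size ∘ tree) 1 (All.map (≡.cong (suc ∘ size)) rest-trivial)) (arith (size T) (size T') i r))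
      where arith : ∀ a b i r → suc a ℕ.+ (suc b ℕ.+ (i ℕ.+ r) ℕ.* 1) ≡ suc (suc (i ℕ.+ r)) ℕ.+ (a ℕ.+ b)
            arith = solve-∀

    n∸≡ : n ∸ suc q ≡ m
    n∸≡ = ≡.trans (≡.cong (_∸ suc q) n≡) (ℕₚ.m+n∸m≡n (suc q) m)

    l≡ : l ≡ ℓ
    l≡ = ≡.trans (≡.sym leafCount≡l) (≡.trans (S.tree-leafCount S.attached S.represents S.covers)
      (≡.trans (sum-cycle (rootedLeaves ∘ tree) 0 (All.map (≡.cong rootedLeaves) rest-trivial)) (arith (rootedLeaves T) (rootedLeaves T') (i ℕ.+ r))))
      where arith : ∀ a b k → a ℕ.+ (b ℕ.+ k ℕ.* 0) ≡ a ℕ.+ b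
            arith = solve-∀

    1≤l : 1 ≤ l
    1≤l = ≡.subst (1 ≤_) (≡.sym l≡)
      (≤-trans (≡.subst (1 ≤_) (leaves≡rootedLeaves T nontrivial-T) (leaves-positive T)) (m≤m+n _ _))

    -- `BalancedStarlike` computes its number of vertices from the legs, whereas `U0` takes n as
    -- given; this equation carries its results over to `U0`.
    order≡ : suc q ℕ.+ sum lens ≡ n
    order≡ = ≡.trans (≡.cong (suc q ℕ.+_) (≡.trans (sum-bstLengths (n ∸ suc q) l 1≤l) n∸≡)) (≡.sym n≡)

    B-represents : EdgeLists.Represents ℕₚ._≟_ (U0 n l (suc q)) toℕ (B.L ʳ++ B.edges)
    B-represents = ≡.subst (λ k → EdgeLists.Represents ℕₚ._≟_ (graphFromEdges k (U0Edges n l (suc q))) toℕ (B.L ʳ++ B.edges)) order≡ B.represents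

    B-covers : Attachments.vertices ℕₚ._≟_ B.L B.cycle ↭ tabulate {n = n} toℕ
    B-covers = ≡.subst (λ k → Attachments.vertices ℕₚ._≟_ B.L B.cycle ↭ tabulate {n = k} toℕ) order≡ B.covers

    B-trees = PendantPaths.paths-forest lens (suc q) (s≤s z≤n)

    B-root : pair (B.tree B.attached 0) ≋ bst m ℓ
    B-root = ⊗.trans (proj₁ B-trees) (⊗.reflexive (≡.cong₂ bst n∸≡ l≡))

    B-other : ∀ {z} → 1 ≤ z → z ≤ q → pair (B.tree B.attached z) ≋ unit
    B-other {z} 1≤z z≤q = ⊗.reflexive (≡.cong pair (proj₂ B-trees z (λ e → <⇒≢ 1≤z (≡.sym e)) (s≤s z≤q)))

  U0≺G : U0 n l (suc q) ≺ G
  U0≺G = CoefficientComparison.≺-from-⊑ ℕₚ._≟_ Fin._≟_ 2≤n B-represents S.represents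
    (⊑-resp (+-congʳ (≈-sym (B.laplacianPoly-cycle B.attached B-covers))) (≈-sym (S.laplacianPoly-cycle S.attached S.covers))
      (cycle-comparison i r (pair ∘ tree) (pair ∘ B.tree B.attached) T T' nontrivial-T nontrivial-T' ≡.refl ≡.refl
        (All.map (λ e → ⊗.reflexive (≡.cong pair e)) rest-trivial)
        B-root (B-other (s≤s z≤n) (s≤s (m≤m+n i r)))
        (All.map (λ { (1≤z , z≤q) → B-other 1≤z z≤q }) (without-bounds i r))))
    where
    2≤n : 2 ≤ n
    2≤n = ≡.subst (2 ≤_) (≡.sym n≡) (s≤s (s≤s z≤n))

theorem3p4 : (n l g : ℕ) → g ≥ 3 → (G : Graph n) → InU2 n l g G → U0 n l g ≺ G
theorem3p4 n l g g≥3 G U with toℕ (InU2.other U) in other≡ | InU2.otherNot1 U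
... | zero  | ≢0 = ⊥-elim (≢0 ≡.refl)
-- In the two directions round the cycle, i and r count the vertices strictly between u_1 and the
-- root of the second tree, so g = i + r + 2.
... | suc i | _  = at-index (g ∸ suc (suc i)) (ℕₚ.m+[n∸m]≡n (≡.subst (_< g) other≡ (Finₚ.toℕ<n (InU2.other U))))
  where
  at-index : ∀ r → suc (suc (i ℕ.+ r)) ≡ g → U0 n l g ≺ G
  at-index r ≡.refl = TwoTrees.U0≺G {i = i} {r} (≤-pred g≥3) G U other≡
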